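{- For all real or complex numbers $p$ and $x$, $$M(x,p)=E(x,p)+e^x\int_0^x e^{ -t}E(t,p)\,dt,$$ where $$M(x,p)=\sum_{n=1}^{\infty}\left(1^p+2^p+\dots+n^p\right)\frac{x^n}{n!},\qquad E(x,p)=\sum_{n=1}^{\infty}\frac{n^p x^n}{n!}.$$
   Context: For a positive integer $n$ and a complex number $p$, $n^p=e^{p\ln n}$. Both series converge for every complex $x$ and define entire functions of $x$. For complex $x$ the integral is taken along the line segment from $0$ to $x$. -}

module Defs where

open import Data.Integer.Base as ℤ using (+_; +[1+_]; -[1+_]; +≤+)
open import Data.Integer.Properties as ℤₚ using ()
open import Data.Nat.Base as ℕ using (ℕ; zero; suc; _!; z≤n; s≤s)
open import Data.Nat.Properties as ℕₚ using (_!≢0)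
open import Data.Product.Base using (∃-syntax; _×_; _,_; proj₁; proj₂)
open import Data.Rational.Base as ℚ using (ℚ; 0ℚ; 1ℚ; ½; mkℚ)
open import Data.Rational.Properties as ℚₚ using ()
open import Data.Rational.Solver using (module +-*-Solver)
open import Data.Rational.Unnormalised.Base as ℚᵘ using (mkℚᵘ; *≤*)
open import Data.Rational.Unnormalised.Properties as ℚᵘₚ using ()
open import Data.Sum.Base using (inj₁; inj₂)
open import Relation.Binary.PropositionalEquality using (_≡_; refl; sym; trans; cong; cong₂; subst; subst₂)

open +-*-Solver using (solve; _:=_; _:+_; _:*_; _:-_; :-_; con)

0<½* : ∀ {ε} → 0ℚ ℚ.< ε → 0ℚ ℚ.< ½ ℚ.* ε
0<½* {ε} 0<ε = subst (ℚ._< ½ ℚ.* ε) (ℚₚ.*-zeroʳ ½) (ℚₚ.*-monoʳ-<-pos ½ 0<ε)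

halves : ∀ ε → ½ ℚ.* ε ℚ.+ ½ ℚ.* ε ≡ ε
halves = solve 1 (λ ε → con ½ :* ε :+ con ½ :* ε := ε) refl

*-mono-≤ : ∀ {a b c d} → 0ℚ ℚ.≤ b → 0ℚ ℚ.≤ c → a ℚ.≤ b → c ℚ.≤ d → a ℚ.* c ℚ.≤ b ℚ.* d
*-mono-≤ {a} {b} {c} {d} 0≤b 0≤c a≤b c≤d = ℚₚ.≤-trans
  (ℚₚ.*-monoʳ-≤-nonNeg c {{ℚ.nonNegative 0≤c}} a≤b)
  (ℚₚ.*-monoˡ-≤-nonNeg b {{ℚ.nonNegative 0≤b}} c≤d)

0≤* : ∀ {a b} → 0ℚ ℚ.≤ a → 0ℚ ℚ.≤ b → 0ℚ ℚ.≤ a ℚ.* b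
0≤* {a} {b} 0≤a 0≤b = subst (ℚ._≤ a ℚ.* b) (ℚₚ.*-zeroˡ 0ℚ) (*-mono-≤ 0≤a ℚₚ.≤-refl 0≤a 0≤b)

0≤+ : ∀ {a b} → 0ℚ ℚ.≤ a → 0ℚ ℚ.≤ b → 0ℚ ℚ.≤ a ℚ.+ b
0≤+ 0≤a 0≤b = ℚₚ.+-mono-≤ 0≤a 0≤b

≤-+ʳ : ∀ a {b} → 0ℚ ℚ.≤ b → a ℚ.≤ a ℚ.+ b
≤-+ʳ a {b} 0≤b = subst (ℚ._≤ a ℚ.+ b) (ℚₚ.+-identityʳ a) (ℚₚ.+-monoʳ-≤ a 0≤b)

≤-+ˡ : ∀ a {b} → 0ℚ ℚ.≤ b → a ℚ.≤ b ℚ.+ a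
≤-+ˡ a {b} 0≤b = subst (a ℚ.≤_) (ℚₚ.+-comm a b) (≤-+ʳ a 0≤b)

0≤1 : 0ℚ ℚ.≤ 1ℚ
0≤1 = ℚₚ.≤ᵇ⇒≤ _

0<1 : 0ℚ ℚ.< 1ℚ
0<1 = ℚₚ.positive⁻¹ 1ℚ

∣-∣-triangle : ∀ a b c → ℚ.∣ a ℚ.- c ∣ ℚ.≤ ℚ.∣ a ℚ.- b ∣ ℚ.+ ℚ.∣ b ℚ.- c ∣
∣-∣-triangle a b c = subst (λ r → ℚ.∣ r ∣ ℚ.≤ ℚ.∣ a ℚ.- b ∣ ℚ.+ ℚ.∣ b ℚ.- c ∣)
  (solve 3 (λ a b c → (a :- b) :+ (b :- c) := a :- c) refl a b c)
  (ℚₚ.∣p+q∣≤∣p∣+∣q∣ (a ℚ.- b) (b ℚ.- c))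

∣-∣-swap : ∀ a b → ℚ.∣ a ℚ.- b ∣ ≡ ℚ.∣ b ℚ.- a ∣
∣-∣-swap a b = trans (sym (ℚₚ.∣-p∣≡∣p∣ (a ℚ.- b)))
  (cong ℚ.∣_∣ (solve 2 (λ a b → :- (a :- b) := b :- a) refl a b))

≤-∣∣ : ∀ a → a ℚ.≤ ℚ.∣ a ∣
≤-∣∣ a with ℚₚ.≤-total 0ℚ a
... | inj₁ 0≤a = ℚₚ.≤-reflexive (sym (ℚₚ.0≤p⇒∣p∣≡p 0≤a))
... | inj₂ a≤0 = ℚₚ.≤-trans a≤0 (ℚₚ.0≤∣p∣ a)

ℕ→ℚ : ℕ → ℚ
ℕ→ℚ n = + n ℚ./ 1

1/suc : ℕ → ℚ
1/suc n = + 1 ℚ./ suc n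

1/! : ℕ → ℚ
1/! n = (+ 1 ℚ./ (n !)) {{n !≢0}}

nat-suc : ∀ n → ℕ→ℚ (suc n) ≡ 1ℚ ℚ.+ ℕ→ℚ n
nat-suc n = ℚₚ.toℚᵘ-injective (ℚᵘₚ.≃-trans (ℚₚ.toℚᵘ-fromℚᵘ (mkℚᵘ (+ suc n) 0))
  (ℚᵘₚ.≃-sym (ℚᵘₚ.≃-trans (ℚₚ.toℚᵘ-homo-+ 1ℚ (ℕ→ℚ n))
    (ℚᵘₚ.≃-trans (ℚᵘₚ.+-congʳ (mkℚᵘ (+ 1) 0) (ℚₚ.toℚᵘ-fromℚᵘ (mkℚᵘ (+ n) 0)))
      (ℚᵘ.*≡* (trans (ℤₚ.*-identityʳ _) (trans (cong (ℤ._+_ (+ 1)) (ℤₚ.*-identityʳ (+ n))) (sym (ℤₚ.*-identityʳ +[1+ n ])))))))))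

nat-* : ∀ m n → ℕ→ℚ (m ℕ.* n) ≡ ℕ→ℚ m ℚ.* ℕ→ℚ n
nat-* m n = ℚₚ.toℚᵘ-injective (ℚᵘₚ.≃-trans (ℚₚ.toℚᵘ-fromℚᵘ (mkℚᵘ (+ (m ℕ.* n)) 0))
  (ℚᵘₚ.≃-sym (ℚᵘₚ.≃-trans (ℚₚ.toℚᵘ-homo-* (ℕ→ℚ m) (ℕ→ℚ n))
    (ℚᵘₚ.≃-trans (ℚᵘₚ.*-cong (ℚₚ.toℚᵘ-fromℚᵘ (mkℚᵘ (+ m) 0)) (ℚₚ.toℚᵘ-fromℚᵘ (mkℚᵘ (+ n) 0)))
      (ℚᵘ.*≡* (cong (ℤ._* + 1) (sym (ℤₚ.pos-* m n))))))))

1/n*n : ∀ n .{{_ : ℕ.NonZero n}} → (+ 1 ℚ./ n) ℚ.* ℕ→ℚ n ≡ 1ℚ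
1/n*n (suc n) = ℚₚ.toℚᵘ-injective (ℚᵘₚ.≃-trans (ℚₚ.toℚᵘ-homo-* (1/suc n) (ℕ→ℚ (suc n)))
  (ℚᵘₚ.≃-trans (ℚᵘₚ.*-cong (ℚₚ.toℚᵘ-fromℚᵘ (mkℚᵘ (+ 1) n)) (ℚₚ.toℚᵘ-fromℚᵘ (mkℚᵘ (+ suc n) 0)))
    (ℚᵘ.*≡* (cong +[1+_] (trans (ℕₚ.*-identityʳ (n ℕ.+ 0)) (cong (ℕ._+ 0) (sym (ℕₚ.*-identityʳ n))))))))

1/suc-antitone : ∀ {m n} → m ℕ.≤ n → 1/suc n ℚ.≤ 1/suc m
1/suc-antitone {m} {n} m≤n = ℚₚ.toℚᵘ-cancel-≤
  (ℚᵘₚ.≤-respˡ-≃ (ℚᵘₚ.≃-sym (ℚₚ.toℚᵘ-fromℚᵘ (mkℚᵘ (+ 1) n)))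
    (ℚᵘₚ.≤-respʳ-≃ (ℚᵘₚ.≃-sym (ℚₚ.toℚᵘ-fromℚᵘ (mkℚᵘ (+ 1) m)))
      (*≤* (ℤₚ.*-monoˡ-≤-nonNeg (+ 1) (+≤+ (s≤s m≤n))))))

archimedean : ∀ ε → 0ℚ ℚ.< ε → ∃[ n ] 1/suc n ℚ.≤ ε
archimedean (mkℚ +[1+ k ] d c) _ = d , ℚₚ.toℚᵘ-cancel-≤
  (ℚᵘₚ.≤-respˡ-≃ (ℚᵘₚ.≃-sym (ℚₚ.toℚᵘ-fromℚᵘ (mkℚᵘ (+ 1) d)))
    (*≤* (ℤₚ.*-monoʳ-≤-nonNeg (+ suc d) (+≤+ (s≤s (z≤n {k}))))))
archimedean (mkℚ (+ 0) d c) 0<ε with ℚₚ.drop-*<* 0<ε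
... | ℤ.+<+ ()
archimedean (mkℚ -[1+ k ] d c) 0<ε with ℚₚ.drop-*<* 0<ε
... | ()

≤-nat : ∀ q → ∃[ n ] q ℚ.≤ ℕ→ℚ n
≤-nat (mkℚ i d c) = ℤ.∣ i ∣ , ℚₚ.toℚᵘ-cancel-≤
    (ℚᵘₚ.≤-respʳ-≃ (ℚᵘₚ.≃-sym (ℚₚ.toℚᵘ-fromℚᵘ (mkℚᵘ (+ ℤ.∣ i ∣) 0)))
      (*≤* (bound i)))
  where
  bound : ∀ i → i ℤ.* + 1 ℤ.≤ + ℤ.∣ i ∣ ℤ.* + suc d
  bound (+ n) = subst₂ ℤ._≤_ (ℤₚ.pos-* n 1) (ℤₚ.pos-* n (suc d)) (+≤+ (ℕₚ.*-monoʳ-≤ n (s≤s z≤n)))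
  bound -[1+ n ] = ℤ.-≤+

Eventually : (ℕ → Set) → Set
Eventually P = ∃[ N ] (∀ n → N ℕ.≤ n → P n)

always : ∀ {P : ℕ → Set} → (∀ n → P n) → Eventually P
always h = 0 , λ n _ → h n

ev-map : ∀ {P Q : ℕ → Set} → (∀ n → P n → Q n) → Eventually P → Eventually Q
ev-map f (N , h) = N , λ n N≤n → f n (h n N≤n)

ev-zip : ∀ {P Q R : ℕ → Set} → (∀ n → P n → Q n → R n) → Eventually P → Eventually Q → Eventually R
ev-zip f (M , g) (N , h) = M ℕ.⊔ N , λ n le → f n
  (g n (ℕₚ.≤-trans (ℕₚ.m≤m⊔n M N) le)) (h n (ℕₚ.≤-trans (ℕₚ.m≤n⊔m M N) le))

IsCauchy : (ℕ → ℚ) → Set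
IsCauchy a = ∀ ε → 0ℚ ℚ.< ε →
  ∃[ N ] (∀ m n → N ℕ.≤ m → N ℕ.≤ n → ℚ.∣ a m ℚ.- a n ∣ ℚ.≤ ε)

-- ℝ and ℂ are taken up to the equivalences _≈ᵣ_ and _≈_ below.
record ℝ : Set where
  constructor mkℝ
  field
    approx : ℕ → ℚ
    cauchy : IsCauchy approx

open ℝ public

infix 4 _≈ᵣ_ _≤ᵣ_

_≈ᵣ_ _≤ᵣ_ : ℝ → ℝ → Set
x ≈ᵣ y = ∀ ε → 0ℚ ℚ.< ε → Eventually λ n → ℚ.∣ approx x n ℚ.- approx y n ∣ ℚ.≤ ε
x ≤ᵣ y = ∀ ε → 0ℚ ℚ.< ε → Eventually λ n → approx x n ℚ.≤ approx y n ℚ.+ ε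

cauchy-bounded : ∀ a → IsCauchy a → ∃[ B ] (0ℚ ℚ.< B × Eventually λ n → ℚ.∣ a n ∣ ℚ.≤ B)
cauchy-bounded a ca with ca 1ℚ 0<1
... | N , h = 1ℚ ℚ.+ ℚ.∣ a N ∣
    , ℚₚ.<-≤-trans 0<1 (≤-+ʳ 1ℚ (ℚₚ.0≤∣p∣ (a N)))
    , N , λ n N≤n → ℚₚ.≤-trans
        (subst (λ r → ℚ.∣ r ∣ ℚ.≤ ℚ.∣ a n ℚ.- a N ∣ ℚ.+ ℚ.∣ a N ∣)
          (solve 2 (λ s t → (s :- t) :+ t := s) refl (a n) (a N))
          (ℚₚ.∣p+q∣≤∣p∣+∣q∣ (a n ℚ.- a N) (a N)))
        (ℚₚ.+-monoˡ-≤ ℚ.∣ a N ∣ (h n N N≤n ℕₚ.≤-refl))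

shrink : ∀ B ε → 0ℚ ℚ.< B → 0ℚ ℚ.< ε → ∃[ δ ] (0ℚ ℚ.< δ × B ℚ.* δ ℚ.≤ ε)
shrink B ε 0<B 0<ε = δ
    , subst (ℚ._< δ) (ℚₚ.*-zeroʳ B⁻¹) (ℚₚ.*-monoʳ-<-pos B⁻¹ {{ℚₚ.1/pos⇒pos B {{pos}}}} 0<ε)
    , ℚₚ.≤-reflexive (trans (sym (ℚₚ.*-assoc B B⁻¹ ε))
        (trans (cong (ℚ._* ε) (ℚₚ.*-inverseʳ B {{nz}})) (ℚₚ.*-identityˡ ε)))
  where
  pos = ℚ.positive 0<B
  nz = ℚₚ.pos⇒nonZero B {{pos}}
  B⁻¹ = (ℚ.1/ B) {{nz}}
  δ = B⁻¹ ℚ.* ε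

ℚ→ℝ : ℚ → ℝ
ℚ→ℝ q = mkℝ (λ _ → q) λ ε 0<ε → 0 , λ _ _ _ _ →
  subst (ℚ._≤ ε) (cong ℚ.∣_∣ (sym (ℚₚ.+-inverseʳ q))) (ℚₚ.<⇒≤ 0<ε)

infixl 6 _+ᵣ_ _-ᵣ_
infixl 7 _*ᵣ_
infix 8 -ᵣ_

_+ᵣ_ : ℝ → ℝ → ℝ
x +ᵣ y = mkℝ (λ n → approx x n ℚ.+ approx y n) λ ε 0<ε →
  let (M , g) = cauchy x (½ ℚ.* ε) (0<½* 0<ε)
      (N , h) = cauchy y (½ ℚ.* ε) (0<½* 0<ε)
  in M ℕ.⊔ N , λ m n Lm Ln → subst₂ ℚ._≤_
       (cong ℚ.∣_∣ (solve 4 (λ a b c d → a :- b :+ (c :- d) := a :+ c :- (b :+ d)) refl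
          (approx x m) (approx x n) (approx y m) (approx y n)))
       (halves ε)
       (ℚₚ.≤-trans (ℚₚ.∣p+q∣≤∣p∣+∣q∣ (approx x m ℚ.- approx x n) (approx y m ℚ.- approx y n))
         (ℚₚ.+-mono-≤
           (g m n (ℕₚ.m⊔n≤o⇒m≤o M N Lm) (ℕₚ.m⊔n≤o⇒m≤o M N Ln))
           (h m n (ℕₚ.m⊔n≤o⇒n≤o M N Lm) (ℕₚ.m⊔n≤o⇒n≤o M N Ln))))

-ᵣ_ : ℝ → ℝ
-ᵣ x = mkℝ (λ n → ℚ.- approx x n) λ ε 0<ε →
  let (N , h) = cauchy x ε 0<ε
  in N , λ m n Lm Ln → subst (ℚ._≤ ε)
       (trans (∣-∣-swap (approx x m) (approx x n))
         (cong ℚ.∣_∣ (solve 2 (λ a b → b :- a := :- a :- :- b) refl (approx x m) (approx x n))))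
       (h m n Lm Ln)

_-ᵣ_ : ℝ → ℝ → ℝ
x -ᵣ y = x +ᵣ (-ᵣ y)

_*ᵣ_ : ℝ → ℝ → ℝ
x *ᵣ y = mkℝ (λ n → approx x n ℚ.* approx y n) λ ε 0<ε →
  let (A , 0<A , K , p) = cauchy-bounded (approx x) (cauchy x)
      (B , 0<B , L , q) = cauchy-bounded (approx y) (cauchy y)
      (δ , 0<δ , Bδ≤) = shrink B (½ ℚ.* ε) 0<B (0<½* 0<ε)
      (η , 0<η , Aη≤) = shrink A (½ ℚ.* ε) 0<A (0<½* 0<ε)
      (M , g) = cauchy x δ 0<δ
      (N , h) = cauchy y η 0<η
  in (K ℕ.⊔ L) ℕ.⊔ (M ℕ.⊔ N) , λ m n Lm Ln →
    let KL≤m = ℕₚ.m⊔n≤o⇒m≤o (K ℕ.⊔ L) (M ℕ.⊔ N) Lm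
        KL≤n = ℕₚ.m⊔n≤o⇒m≤o (K ℕ.⊔ L) (M ℕ.⊔ N) Ln
        MN≤m = ℕₚ.m⊔n≤o⇒n≤o (K ℕ.⊔ L) (M ℕ.⊔ N) Lm
        MN≤n = ℕₚ.m⊔n≤o⇒n≤o (K ℕ.⊔ L) (M ℕ.⊔ N) Ln
    in subst₂ ℚ._≤_
       (cong ℚ.∣_∣ (solve 4 (λ a b c d → c :* (a :- b) :+ b :* (c :- d) := a :* c :- b :* d) refl
          (approx x m) (approx x n) (approx y m) (approx y n)))
       (halves ε)
       (ℚₚ.≤-trans
         (ℚₚ.∣p+q∣≤∣p∣+∣q∣ (approx y m ℚ.* (approx x m ℚ.- approx x n)) (approx x n ℚ.* (approx y m ℚ.- approx y n)))
         (ℚₚ.+-mono-≤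
           (ℚₚ.≤-trans (ℚₚ.≤-reflexive (ℚₚ.∣p*q∣≡∣p∣*∣q∣ (approx y m) (approx x m ℚ.- approx x n)))
             (ℚₚ.≤-trans (*-mono-≤ (ℚₚ.<⇒≤ 0<B) (ℚₚ.0≤∣p∣ _)
                 (q m (ℕₚ.m⊔n≤o⇒n≤o K L KL≤m))
                 (g m n (ℕₚ.m⊔n≤o⇒m≤o M N MN≤m) (ℕₚ.m⊔n≤o⇒m≤o M N MN≤n)))
               Bδ≤))
           (ℚₚ.≤-trans (ℚₚ.≤-reflexive (ℚₚ.∣p*q∣≡∣p∣*∣q∣ (approx x n) (approx y m ℚ.- approx y n)))
             (ℚₚ.≤-trans (*-mono-≤ (ℚₚ.<⇒≤ 0<A) (ℚₚ.0≤∣p∣ _)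
                 (p n (ℕₚ.m⊔n≤o⇒m≤o K L KL≤n))
                 (h m n (ℕₚ.m⊔n≤o⇒n≤o M N MN≤m) (ℕₚ.m⊔n≤o⇒n≤o M N MN≤n)))
               Aη≤))))

∣∣-drop : ∀ a b → ℚ.∣ a ∣ ℚ.- ℚ.∣ b ∣ ℚ.≤ ℚ.∣ a ℚ.- b ∣
∣∣-drop a b = subst (ℚ.∣ a ∣ ℚ.- ℚ.∣ b ∣ ℚ.≤_)
  (solve 2 (λ s t → s :+ t :- t := s) refl ℚ.∣ a ℚ.- b ∣ ℚ.∣ b ∣)
  (ℚₚ.+-monoˡ-≤ (ℚ.- ℚ.∣ b ∣)
    (subst (λ r → ℚ.∣ r ∣ ℚ.≤ ℚ.∣ a ℚ.- b ∣ ℚ.+ ℚ.∣ b ∣)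
      (solve 2 (λ s t → (s :- t) :+ t := s) refl a b)
      (ℚₚ.∣p+q∣≤∣p∣+∣q∣ (a ℚ.- b) b)))

∣∣-lipschitz : ∀ a b → ℚ.∣ ℚ.∣ a ∣ ℚ.- ℚ.∣ b ∣ ∣ ℚ.≤ ℚ.∣ a ℚ.- b ∣
∣∣-lipschitz a b with ℚₚ.∣p∣≡p∨∣p∣≡-p (ℚ.∣ a ∣ ℚ.- ℚ.∣ b ∣)
... | inj₁ eq = subst (ℚ._≤ ℚ.∣ a ℚ.- b ∣) (sym eq) (∣∣-drop a b)
... | inj₂ eq = subst₂ ℚ._≤_
  (trans (solve 2 (λ s t → t :- s := :- (s :- t)) refl ℚ.∣ a ∣ ℚ.∣ b ∣) (sym eq))
  (∣-∣-swap b a) (∣∣-drop b a)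

∣_∣ᵣ : ℝ → ℝ
∣ x ∣ᵣ = mkℝ (λ n → ℚ.∣ approx x n ∣) λ ε 0<ε →
  let (N , h) = cauchy x ε 0<ε
  in N , λ m n Lm Ln → ℚₚ.≤-trans (∣∣-lipschitz (approx x m) (approx x n)) (h m n Lm Ln)

IsCauchyᵣ : (ℕ → ℝ) → Set
IsCauchyᵣ u = ∀ ε → 0ℚ ℚ.< ε →
  ∃[ N ] (∀ m n → N ℕ.≤ m → N ℕ.≤ n → ∣ u m -ᵣ u n ∣ᵣ ≤ᵣ ℚ→ℝ ε)

infix 4 _⟶ᵣ_
_⟶ᵣ_ : (ℕ → ℝ) → ℝ → Set
u ⟶ᵣ l = ∀ ε → 0ℚ ℚ.< ε → Eventually λ n → ∣ u n -ᵣ l ∣ᵣ ≤ᵣ ℚ→ℝ ε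

0<1/suc : ∀ n → 0ℚ ℚ.< 1/suc n
0<1/suc n = ℚₚ.positive⁻¹ (1/suc n) {{ℚₚ.normalize-pos 1 (suc n)}}

completeᵣ : ∀ u → IsCauchyᵣ u → ∃[ l ] u ⟶ᵣ l
completeᵣ u cu = mkℝ l l-cauchy , l-limit
  where
  K : ℕ → ℕ
  K k = proj₁ (cauchy (u k) (1/suc k) (0<1/suc k))

  l : ℕ → ℚ
  l k = approx (u k) (K k)

  close : ∀ k {e} i → 1/suc k ℚ.≤ e → K k ℕ.≤ i → ℚ.∣ approx (u k) i ℚ.- l k ∣ ℚ.≤ e
  close k i ≤e K≤i = ℚₚ.≤-trans (proj₂ (cauchy (u k) (1/suc k) (0<1/suc k)) i (K k) K≤i ℕₚ.≤-refl) ≤e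

  l-cauchy : IsCauchy l
  l-cauchy ε 0<ε =
    let e = ½ ℚ.* (½ ℚ.* ε)
        0<e = 0<½* (0<½* 0<ε)
        (N , h) = cu e 0<e
        (M , a) = archimedean e 0<e
    in N ℕ.⊔ M , λ m n Lm Ln →
      let (J , g) = h m n (ℕₚ.m⊔n≤o⇒m≤o N M Lm) (ℕₚ.m⊔n≤o⇒m≤o N M Ln) e 0<e
          j = J ℕ.⊔ (K m ℕ.⊔ K n)
          s = ℕₚ.m≤n⊔m J (K m ℕ.⊔ K n)
      in ℚₚ.≤-trans (∣-∣-triangle (l m) (approx (u m) j) (l n))
           (ℚₚ.≤-trans
             (ℚₚ.+-mono-≤
               (subst (ℚ._≤ e) (∣-∣-swap (approx (u m) j) (l m))
                 (close m j (ℚₚ.≤-trans (1/suc-antitone (ℕₚ.m⊔n≤o⇒n≤o N M Lm)) a)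
                   (ℕₚ.≤-trans (ℕₚ.m≤m⊔n (K m) (K n)) s)))
               (ℚₚ.≤-trans (∣-∣-triangle (approx (u m) j) (approx (u n) j) (l n))
                 (ℚₚ.+-mono-≤ (g j (ℕₚ.m≤m⊔n J _))
                   (close n j (ℚₚ.≤-trans (1/suc-antitone (ℕₚ.m⊔n≤o⇒n≤o N M Ln)) a)
                     (ℕₚ.≤-trans (ℕₚ.m≤n⊔m (K m) (K n)) s)))))
             (ℚₚ.≤-reflexive (solve 1 (λ ε →
                let e = con ½ :* (con ½ :* ε) in e :+ (e :+ e :+ e) := ε) refl ε)))

  l-limit : u ⟶ᵣ mkℝ l l-cauchy
  l-limit ε 0<ε =
    let e = ½ ℚ.* ε
        0<e = 0<½* 0<ε
        (N , h) = l-cauchy e 0<e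
        (M , a) = archimedean e 0<e
    in N ℕ.⊔ M , λ n Ln ε′ 0<ε′ → N ℕ.⊔ K n , λ j Lj →
      ℚₚ.≤-trans (∣-∣-triangle (approx (u n) j) (l n) (l j))
        (ℚₚ.≤-trans
          (ℚₚ.+-mono-≤
            (close n j (ℚₚ.≤-trans (1/suc-antitone (ℕₚ.m⊔n≤o⇒n≤o N M Ln)) a) (ℕₚ.m⊔n≤o⇒n≤o N (K n) Lj))
            (h n j (ℕₚ.m⊔n≤o⇒m≤o N M Ln) (ℕₚ.m⊔n≤o⇒m≤o N (K n) Lj)))
          (ℚₚ.≤-trans (ℚₚ.≤-reflexive (halves ε)) (≤-+ʳ ε (ℚₚ.<⇒≤ 0<ε′))))

infix 6 _+i_
record ℂ : Set where
  constructor _+i_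
  field
    re im : ℝ

open ℂ public

infix 4 _≈_
_≈_ : ℂ → ℂ → Set
z ≈ w = re z ≈ᵣ re w × im z ≈ᵣ im w

ℝ→ℂ : ℝ → ℂ
ℝ→ℂ x = x +i ℚ→ℝ 0ℚ

ℚ→ℂ : ℚ → ℂ
ℚ→ℂ q = ℝ→ℂ (ℚ→ℝ q)

infixl 6 _+_ _-_
infixl 7 _*_
infix 8 -_
infixr 8 _^_

_+_ _*_ : ℂ → ℂ → ℂ
z + w = (re z +ᵣ re w) +i (im z +ᵣ im w)
z * w = (re z *ᵣ re w -ᵣ im z *ᵣ im w) +i (re z *ᵣ im w +ᵣ im z *ᵣ re w)

-_ : ℂ → ℂ
- z = (-ᵣ re z) +i (-ᵣ im z)

_-_ : ℂ → ℂ → ℂ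
z - w = z + (- w)

_^_ : ℂ → ℕ → ℂ
z ^ zero = ℚ→ℂ 1ℚ
z ^ suc n = z ^ n * z

-- |re z| + |im z| lies between |z| and √2 |z|, so it gives the same limits, series and integrals
-- as the Euclidean modulus.
‖_‖ : ℂ → ℝ
‖ z ‖ = ∣ re z ∣ᵣ +ᵣ ∣ im z ∣ᵣ

IsCauchyᶜ : (ℕ → ℂ) → Set
IsCauchyᶜ u = ∀ ε → 0ℚ ℚ.< ε →
  ∃[ N ] (∀ m n → N ℕ.≤ m → N ℕ.≤ n → ‖ u m - u n ‖ ≤ᵣ ℚ→ℝ ε)

infix 4 _⟶_
_⟶_ : (ℕ → ℂ) → ℂ → Set
u ⟶ l = ∀ ε → 0ℚ ℚ.< ε → Eventually λ n → ‖ u n - l ‖ ≤ᵣ ℚ→ℝ ε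

complete : ∀ u → IsCauchyᶜ u → ∃[ l ] u ⟶ l
complete u cu = x +i y , λ ε 0<ε →
    ev-zip (λ n p q ε′ 0<ε′ → ev-zip
        (λ j s t → ℚₚ.≤-trans (ℚₚ.+-mono-≤ s t) (ℚₚ.≤-reflexive
          (solve 2 (λ a b → con ½ :* a :+ con ½ :* b :+ (con ½ :* a :+ con ½ :* b) := a :+ b) refl ε ε′)))
        (p (½ ℚ.* ε′) (0<½* 0<ε′)) (q (½ ℚ.* ε′) (0<½* 0<ε′)))
      (x-lim (½ ℚ.* ε) (0<½* 0<ε)) (y-lim (½ ℚ.* ε) (0<½* 0<ε))
  where
  re-limit = completeᵣ (λ n → re (u n)) λ ε 0<ε →
    let (N , h) = cu ε 0<ε
    in N , λ m n Lm Ln ε′ 0<ε′ → ev-map (λ j → ℚₚ.≤-trans (≤-+ʳ ℚ.∣ approx (re (u m - u n)) j ∣ (ℚₚ.0≤∣p∣ (approx (im (u m - u n)) j)))) (h m n Lm Ln ε′ 0<ε′)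
  im-limit = completeᵣ (λ n → im (u n)) λ ε 0<ε →
    let (N , h) = cu ε 0<ε
    in N , λ m n Lm Ln ε′ 0<ε′ → ev-map (λ j → ℚₚ.≤-trans (≤-+ˡ ℚ.∣ approx (im (u m - u n)) j ∣ (ℚₚ.0≤∣p∣ (approx (re (u m - u n)) j)))) (h m n Lm Ln ε′ 0<ε′)
  x = proj₁ re-limit
  y = proj₁ im-limit
  x-lim = proj₂ re-limit
  y-lim = proj₂ im-limit

∑ : ℕ → (ℕ → ℂ) → ℂ
∑ zero a = ℚ→ℂ 0ℚ
∑ (suc n) a = ∑ n a + a n

Summable : (ℕ → ℂ) → Set
Summable a = IsCauchyᶜ λ n → ∑ n a

∑∞ : (a : ℕ → ℂ) → Summable a → ℂ
∑∞ a s = proj₁ (complete (λ n → ∑ n a) s)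

norm : ℂ → ℕ → ℚ
norm z n = ℚ.∣ approx (re z) n ∣ ℚ.+ ℚ.∣ approx (im z) n ∣

Bounded : ℂ → ℚ → Set
Bounded z q = Eventually λ n → norm z n ℚ.≤ q

0≤norm : ∀ z n → 0ℚ ℚ.≤ norm z n
0≤norm z n = 0≤+ (ℚₚ.0≤∣p∣ (approx (re z) n)) (ℚₚ.0≤∣p∣ (approx (im z) n))

norm-+ : ∀ z w n → norm (z + w) n ℚ.≤ norm z n ℚ.+ norm w n
norm-+ z w n = ℚₚ.≤-trans
  (ℚₚ.+-mono-≤ (ℚₚ.∣p+q∣≤∣p∣+∣q∣ a c) (ℚₚ.∣p+q∣≤∣p∣+∣q∣ b d))
  (ℚₚ.≤-reflexive (solve 4 (λ a b c d → a :+ c :+ (b :+ d) := a :+ b :+ (c :+ d)) refl ℚ.∣ a ∣ ℚ.∣ b ∣ ℚ.∣ c ∣ ℚ.∣ d ∣))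
  where
  a = approx (re z) n
  b = approx (im z) n
  c = approx (re w) n
  d = approx (im w) n

norm-* : ∀ z w n → norm (z * w) n ℚ.≤ norm z n ℚ.* norm w n
norm-* z w n = ℚₚ.≤-trans
    (ℚₚ.+-mono-≤ (ℚₚ.∣p-q∣≤∣p∣+∣q∣ (a ℚ.* c) (b ℚ.* d)) (ℚₚ.∣p+q∣≤∣p∣+∣q∣ (a ℚ.* d) (b ℚ.* c)))
    (ℚₚ.≤-reflexive (trans
      (cong₂ ℚ._+_ (cong₂ ℚ._+_ (ℚₚ.∣p*q∣≡∣p∣*∣q∣ a c) (ℚₚ.∣p*q∣≡∣p∣*∣q∣ b d))
                   (cong₂ ℚ._+_ (ℚₚ.∣p*q∣≡∣p∣*∣q∣ a d) (ℚₚ.∣p*q∣≡∣p∣*∣q∣ b c)))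
      (solve 4 (λ a b c d → a :* c :+ b :* d :+ (a :* d :+ b :* c) := (a :+ b) :* (c :+ d)) refl
        ℚ.∣ a ∣ ℚ.∣ b ∣ ℚ.∣ c ∣ ℚ.∣ d ∣)))
  where
  a = approx (re z) n
  b = approx (im z) n
  c = approx (re w) n
  d = approx (im w) n

norm-swap : ∀ z w n → norm (z - w) n ≡ norm (w - z) n
norm-swap z w n = cong₂ ℚ._+_ (∣-∣-swap (approx (re z) n) (approx (re w) n)) (∣-∣-swap (approx (im z) n) (approx (im w) n))

bounded-weaken : ∀ z {a b} → a ℚ.≤ b → Bounded z a → Bounded z b
bounded-weaken z a≤b = ev-map λ n h → ℚₚ.≤-trans h a≤b

bounded-+ : ∀ z w {a b} → Bounded z a → Bounded w b → Bounded (z + w) (a ℚ.+ b)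
bounded-+ z w = ev-zip λ n p q → ℚₚ.≤-trans (norm-+ z w n) (ℚₚ.+-mono-≤ p q)

bounded-* : ∀ z w {a b} → Bounded z a → Bounded w b → Bounded (z * w) (a ℚ.* b)
bounded-* z w = ev-zip λ n p q → ℚₚ.≤-trans (norm-* z w n)
  (*-mono-≤ (ℚₚ.≤-trans (0≤norm z n) p) (0≤norm w n) p q)

bounded-ℝ : ∀ x {q} → Eventually (λ n → ℚ.∣ approx x n ∣ ℚ.≤ q) → Bounded (ℝ→ℂ x) q
bounded-ℝ x = ev-map λ n → subst (ℚ._≤ _) (sym (ℚₚ.+-identityʳ ℚ.∣ approx x n ∣))

bounded-ℚ : ∀ {q} → 0ℚ ℚ.≤ q → Bounded (ℚ→ℂ q) q
bounded-ℚ {q} 0≤q = bounded-ℝ (ℚ→ℝ q) (always λ _ → ℚₚ.≤-reflexive (ℚₚ.0≤p⇒∣p∣≡p 0≤q))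

bounded : ∀ z → ∃[ K ] Bounded z (ℕ→ℚ K)
bounded z =
  let (A , _ , p) = cauchy-bounded (approx (re z)) (cauchy (re z))
      (B , _ , q) = cauchy-bounded (approx (im z)) (cauchy (im z))
      (K , h) = ≤-nat (A ℚ.+ B)
  in K , ev-zip (λ n s t → ℚₚ.≤-trans (ℚₚ.+-mono-≤ s t) h) p q

bounded-limit : ∀ u l {q} → u ⟶ l → (∀ m → Bounded (u m) q) → Bounded l (q ℚ.+ 1ℚ)
bounded-limit u l {q} u⟶l b =
  let (N , h) = u⟶l ½ (ℚₚ.positive⁻¹ ½)
  in ev-zip (λ n s t → ℚₚ.≤-trans
        (subst₂ (λ r r′ → ℚ.∣ r ∣ ℚ.+ ℚ.∣ r′ ∣ ℚ.≤ norm (u N) n ℚ.+ norm (l - u N) n)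
          (cancel (approx (re l) n) (approx (re (u N)) n))
          (cancel (approx (im l) n) (approx (im (u N)) n))
          (norm-+ (u N) (l - u N) n))
        (ℚₚ.+-mono-≤ s (subst (ℚ._≤ 1ℚ) (norm-swap (u N) l n) t)))
      (b N) (h N ℕₚ.≤-refl ½ (ℚₚ.positive⁻¹ ½))
  where
  cancel : ∀ a b → b ℚ.+ (a ℚ.- b) ≡ a
  cancel = solve 2 (λ a b → b :+ (a :- b) := a) refl

½^ : ℕ → ℚ
½^ zero = 1ℚ
½^ (suc n) = ½ ℚ.* ½^ n

0≤½^ : ∀ n → 0ℚ ℚ.≤ ½^ n
0≤½^ zero = 0≤1
0≤½^ (suc n) = 0≤* (ℚₚ.nonNegative⁻¹ ½) (0≤½^ n)

0≤nat : ∀ n → 0ℚ ℚ.≤ ℕ→ℚ n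
0≤nat zero = ℚₚ.≤-refl
0≤nat (suc n) = subst (0ℚ ℚ.≤_) (sym (nat-suc n)) (0≤+ 0≤1 (0≤nat n))

nat-mono : ∀ {m n} → m ℕ.≤ n → ℕ→ℚ m ℚ.≤ ℕ→ℚ n
nat-mono {n = n} z≤n = 0≤nat n
nat-mono {suc m} {suc n} (s≤s m≤n) = subst₂ ℚ._≤_ (sym (nat-suc m)) (sym (nat-suc n))
  (ℚₚ.+-monoʳ-≤ 1ℚ (nat-mono m≤n))

nat-+ : ∀ m n → ℕ→ℚ (m ℕ.+ n) ≡ ℕ→ℚ m ℚ.+ ℕ→ℚ n
nat-+ zero n = sym (ℚₚ.+-identityˡ (ℕ→ℚ n))
nat-+ (suc m) n = trans (nat-suc (m ℕ.+ n)) (trans (cong (1ℚ ℚ.+_) (nat-+ m n))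
  (trans (sym (ℚₚ.+-assoc 1ℚ (ℕ→ℚ m) (ℕ→ℚ n))) (cong (ℚ._+ ℕ→ℚ n) (sym (nat-suc m)))))

1/suc*nat : ∀ n → 1/suc n ℚ.* ℕ→ℚ (suc n) ≡ 1ℚ
1/suc*nat n = 1/n*n (suc n)

0≤1/suc : ∀ n → 0ℚ ℚ.≤ 1/suc n
0≤1/suc n = ℚₚ.<⇒≤ (0<1/suc n)

0≤1/! : ∀ n → 0ℚ ℚ.≤ 1/! n
0≤1/! n = ℚₚ.nonNegative⁻¹ (1/! n) {{ℚₚ.normalize-nonNeg 1 (n !) {{n !≢0}}}}

1/!*nat! : ∀ n → 1/! n ℚ.* ℕ→ℚ (n !) ≡ 1ℚ
1/!*nat! n = 1/n*n (n !) {{n !≢0}}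

½^≤1/suc : ∀ n → ½^ n ℚ.≤ 1/suc n
½^≤1/suc zero = ℚₚ.≤-refl
½^≤1/suc (suc n) = ℚₚ.≤-trans (ℚₚ.*-monoˡ-≤-nonNeg ½ (½^≤1/suc n))
  (subst₂ ℚ._≤_
    (trans (solve 3 (λ r r′ s → r′ :* (con ½ :* (r :+ r :* s)) := con ½ :* r :* (r′ :* (con 1ℚ :+ s))) refl r r′ (ℕ→ℚ (suc n)))
      (trans (cong (½ ℚ.* r ℚ.*_) (trans (cong (r′ ℚ.*_) (sym (nat-suc (suc n)))) (1/suc*nat (suc n)))) (ℚₚ.*-identityʳ (½ ℚ.* r))))
    (ℚₚ.*-identityʳ r′)
    (ℚₚ.*-monoˡ-≤-nonNeg r′ {{ℚ.nonNegative (0≤1/suc (suc n))}}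
      (ℚₚ.*-monoˡ-≤-nonNeg ½ (ℚₚ.+-mono-≤ (1/suc-antitone {0} {n} z≤n) (ℚₚ.≤-reflexive (1/suc*nat n))))))
  where
  r = 1/suc n
  r′ = 1/suc (suc n)

small-½^ : ∀ D ε → 0ℚ ℚ.≤ D → 0ℚ ℚ.< ε → ∃[ N ] (∀ n → N ℕ.≤ n → D ℚ.* ½^ n ℚ.≤ ε)
small-½^ D ε 0≤D 0<ε =
  let (δ , 0<δ , h) = shrink (1ℚ ℚ.+ D) ε (ℚₚ.<-≤-trans 0<1 (≤-+ʳ 1ℚ 0≤D)) 0<ε
      (N , a) = archimedean δ 0<δ
  in N , λ n N≤n → ℚₚ.≤-trans
       (*-mono-≤ (0≤+ 0≤1 0≤D) (0≤½^ n) (≤-+ˡ D 0≤1)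
         (ℚₚ.≤-trans (½^≤1/suc n) (ℚₚ.≤-trans (1/suc-antitone N≤n) a)))
       h

module _ (a : ℕ → ℂ) (c : ℚ) (0≤c : 0ℚ ℚ.≤ c) (a≤ : ∀ n → Bounded (a n) (c ℚ.* ½^ n)) where

  private
    S : ℕ → ℂ
    S n = ∑ n a

    D : ℚ
    D = c ℚ.+ c

    gap : ∀ n d → Bounded (S (d ℕ.+ n) - S n) (D ℚ.* (½^ n ℚ.- ½^ (d ℕ.+ n)))
    gap n zero = always λ j → ℚₚ.≤-reflexive (trans
      (cong₂ (λ r s → ℚ.∣ r ∣ ℚ.+ ℚ.∣ s ∣) (ℚₚ.+-inverseʳ (approx (re (S n)) j)) (ℚₚ.+-inverseʳ (approx (im (S n)) j)))
      (sym (trans (cong (D ℚ.*_) (ℚₚ.+-inverseʳ (½^ n))) (ℚₚ.*-zeroʳ D))))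
    gap n (suc d) = ev-map
      (λ j → subst₂ ℚ._≤_
        (cong₂ (λ r s → ℚ.∣ r ∣ ℚ.+ ℚ.∣ s ∣)
          (reorder (approx (re (S (d ℕ.+ n))) j) (approx (re (S n)) j) (approx (re (a (d ℕ.+ n))) j))
          (reorder (approx (im (S (d ℕ.+ n))) j) (approx (im (S n)) j) (approx (im (a (d ℕ.+ n))) j)))
        (solve 3 (λ c s t → (c :+ c) :* (s :- t) :+ c :* t := (c :+ c) :* (s :- con ½ :* t)) refl c (½^ n) (½^ (d ℕ.+ n))))
      (bounded-+ (S (d ℕ.+ n) - S n) (a (d ℕ.+ n)) (gap n d) (a≤ (d ℕ.+ n)))
      where
      reorder : ∀ s t r → s ℚ.- t ℚ.+ r ≡ s ℚ.+ r ℚ.- t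
      reorder = solve 3 (λ s t r → s :- t :+ r := s :+ r :- t) refl

    gap′ : ∀ m n → n ℕ.≤ m → Bounded (S m - S n) (D ℚ.* ½^ n)
    gap′ m n n≤m = bounded-weaken (S m - S n)
      (ℚₚ.*-monoˡ-≤-nonNeg D {{ℚ.nonNegative (0≤+ 0≤c 0≤c)}}
        (subst (½^ n ℚ.- ½^ (m ℕ.∸ n ℕ.+ n) ℚ.≤_) (ℚₚ.+-identityʳ (½^ n))
          (ℚₚ.+-monoʳ-≤ (½^ n) (ℚₚ.neg-antimono-≤ (0≤½^ (m ℕ.∸ n ℕ.+ n))))))
      (subst (λ k → Bounded (S k - S n) (D ℚ.* (½^ n ℚ.- ½^ (m ℕ.∸ n ℕ.+ n)))) (ℕₚ.m∸n+n≡m n≤m) (gap n (m ℕ.∸ n)))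

  summable : Summable a
  summable ε 0<ε =
    let (N , h) = small-½^ D ε (0≤+ 0≤c 0≤c) 0<ε
    in N , λ m n N≤m N≤n ε′ 0<ε′ → close N h m n N≤m N≤n ε′ 0<ε′
    where
    close : ∀ N → (∀ n → N ℕ.≤ n → D ℚ.* ½^ n ℚ.≤ ε) → ∀ m n → N ℕ.≤ m → N ℕ.≤ n → ‖ S m - S n ‖ ≤ᵣ ℚ→ℝ ε
    close N h m n N≤m N≤n ε′ 0<ε′ with ℕₚ.≤-total m n
    ... | inj₂ n≤m = ev-map (λ j p → ℚₚ.≤-trans p (ℚₚ.≤-trans (h n N≤n) (≤-+ʳ ε (ℚₚ.<⇒≤ 0<ε′)))) (gap′ m n n≤m)
    ... | inj₁ m≤n = ev-map (λ j p → ℚₚ.≤-trans (ℚₚ.≤-reflexive (norm-swap (S m) (S n) j))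
                        (ℚₚ.≤-trans p (ℚₚ.≤-trans (h m N≤m) (≤-+ʳ ε (ℚₚ.<⇒≤ 0<ε′))))) (gap′ n m m≤n)

infixl 7 _/!_
_/!_ : ℂ → ℕ → ℂ
z /! n = z * ℚ→ℂ (1/! n)

L^n≤ : ∀ L n → L ℕ.^ n ℕ.≤ L ℕ.^ L ℕ.* n !
L^n≤ zero zero = ℕₚ.≤-refl
L^n≤ zero (suc n) = z≤n
L^n≤ L@(suc _) zero = subst (1 ℕ.≤_) (sym (ℕₚ.*-identityʳ (L ℕ.^ L))) (ℕₚ.m^n>0 L L)
L^n≤ L@(suc _) (suc n) with ℕₚ.≤-total (suc n) L
... | inj₁ n<L = ℕₚ.≤-trans (ℕₚ.^-monoʳ-≤ L n<L)
      (subst (ℕ._≤ L ℕ.^ L ℕ.* suc n !) (ℕₚ.*-identityʳ (L ℕ.^ L)) (ℕₚ.*-monoʳ-≤ (L ℕ.^ L) (ℕ.>-nonZero⁻¹ (suc n !) {{suc n !≢0}})))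
... | inj₂ L≤n = ℕₚ.≤-trans (ℕₚ.*-mono-≤ L≤n (L^n≤ L n))
      (ℕₚ.≤-reflexive (trans (sym (ℕₚ.*-assoc (suc n) (L ℕ.^ L) (n !)))
        (trans (cong (ℕ._* n !) (ℕₚ.*-comm (suc n) (L ℕ.^ L))) (ℕₚ.*-assoc (L ℕ.^ L) (suc n) (n !)))))

nat2^*½^ : ∀ n → ℕ→ℚ (2 ℕ.^ n) ℚ.* ½^ n ≡ 1ℚ
nat2^*½^ zero = refl
nat2^*½^ (suc n) = trans (cong (ℚ._* (½ ℚ.* ½^ n)) (nat-* 2 (2 ℕ.^ n)))
  (trans (solve 2 (λ s t → con (ℕ→ℚ 2) :* s :* (con ½ :* t) := s :* t) refl (ℕ→ℚ (2 ℕ.^ n)) (½^ n)) (nat2^*½^ n))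

^-distrib-* : ∀ a b n → (a ℕ.* b) ℕ.^ n ≡ a ℕ.^ n ℕ.* b ℕ.^ n
^-distrib-* a b zero = refl
^-distrib-* a b (suc n) = trans (cong (a ℕ.* b ℕ.*_) (^-distrib-* a b n)) (ℕₚ.[m*n]*[o*p]≡[m*o]*[n*p] a b (a ℕ.^ n) (b ℕ.^ n))

majorant : ℕ → ℕ
majorant G = (2 ℕ.* G) ℕ.^ (2 ℕ.* G)

G^n/n!≤ : ∀ G n → ℕ→ℚ (G ℕ.^ n) ℚ.* 1/! n ℚ.≤ ℕ→ℚ (majorant G) ℚ.* ½^ n
G^n/n!≤ G n = subst₂ ℚ._≤_
  (trans (cong (λ r → r ℚ.* ½^ n ℚ.* 1/! n) (trans (cong ℕ→ℚ (^-distrib-* 2 G n)) (nat-* (2 ℕ.^ n) (G ℕ.^ n))))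
    (trans (solve 4 (λ a b h f → a :* b :* h :* f := (a :* h) :* (b :* f)) refl (ℕ→ℚ (2 ℕ.^ n)) (ℕ→ℚ (G ℕ.^ n)) (½^ n) (1/! n))
      (trans (cong (ℚ._* (ℕ→ℚ (G ℕ.^ n) ℚ.* 1/! n)) (nat2^*½^ n)) (ℚₚ.*-identityˡ _))))
  (trans (cong (λ r → r ℚ.* ½^ n ℚ.* 1/! n) (nat-* (majorant G) (n !)))
    (trans (solve 4 (λ a b h f → a :* b :* h :* f := (a :* h) :* (f :* b)) refl (ℕ→ℚ (majorant G)) (ℕ→ℚ (n !)) (½^ n) (1/! n))
      (trans (cong (ℕ→ℚ (majorant G) ℚ.* ½^ n ℚ.*_) (1/!*nat! n)) (ℚₚ.*-identityʳ _))))
  (ℚₚ.*-monoʳ-≤-nonNeg (1/! n) {{ℚ.nonNegative (0≤1/! n)}}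
    (ℚₚ.*-monoʳ-≤-nonNeg (½^ n) {{ℚ.nonNegative (0≤½^ n)}}
      (nat-mono (L^n≤ (2 ℕ.* G) n))))

bounded-/! : ∀ z {q} n → Bounded z q → Bounded (z /! n) (q ℚ.* 1/! n)
bounded-/! z n b = bounded-* z (ℚ→ℂ (1/! n)) b (bounded-ℚ (0≤1/! n))

bounded-^ : ∀ z K n → Bounded z (ℕ→ℚ K) → Bounded (z ^ n) (ℕ→ℚ (K ℕ.^ n))
bounded-^ z K zero b = bounded-ℚ 0≤1
bounded-^ z K (suc n) b = bounded-weaken (z ^ suc n)
  (ℚₚ.≤-reflexive (trans (sym (nat-* (K ℕ.^ n) K)) (cong ℕ→ℚ (ℕₚ.*-comm (K ℕ.^ n) K))))
  (bounded-* (z ^ n) z (bounded-^ z K n b) b)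

exp-summable : ∀ z → Summable λ k → z ^ k /! k
exp-summable z =
  let (K , b) = bounded z
  in summable (λ k → z ^ k /! k) (ℕ→ℚ (majorant K)) (0≤nat (majorant K)) λ k →
       bounded-weaken (z ^ k /! k) (G^n/n!≤ K k) (bounded-/! (z ^ k) k (bounded-^ z K k b))

exp : ℂ → ℂ
exp z = ∑∞ (λ k → z ^ k /! k) (exp-summable z)

shifted-summable : ∀ (c : ℕ → ℂ) x G → (∀ k → Bounded (c k) (ℕ→ℚ (G ℕ.^ suc k))) → Summable λ k → c k * x ^ suc k /! suc k
shifted-summable c x G c≤ =
  let (K , b) = bounded x
      C = majorant (G ℕ.* K)
  in summable (λ k → c k * x ^ suc k /! suc k) (ℕ→ℚ C) (0≤nat C) λ k →
       bounded-weaken (c k * x ^ suc k /! suc k)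
         (ℚₚ.≤-trans
           (ℚₚ.≤-reflexive (cong (ℚ._* 1/! (suc k)) (trans (sym (nat-* (G ℕ.^ suc k) (K ℕ.^ suc k))) (cong ℕ→ℚ (sym (^-distrib-* G K (suc k)))))))
           (ℚₚ.≤-trans (G^n/n!≤ (G ℕ.* K) (suc k))
             (ℚₚ.*-monoˡ-≤-nonNeg (ℕ→ℚ C) {{ℚ.nonNegative (0≤nat C)}} (½^-dec k))))
         (bounded-/! (c k * x ^ suc k) (suc k) (bounded-* (c k) (x ^ suc k) (c≤ k) (bounded-^ x K (suc k) b)))
  where
  ½^-dec : ∀ k → ½^ (suc k) ℚ.≤ ½^ k
  ½^-dec k = subst (½^ (suc k) ℚ.≤_) (halves (½^ k)) (≤-+ʳ (½^ (suc k)) (0≤½^ (suc k)))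

0<nat : ∀ n .{{_ : ℕ.NonZero n}} → 0ℚ ℚ.< ℕ→ℚ n
0<nat (suc n) = subst (0ℚ ℚ.<_) (sym (nat-suc n)) (ℚₚ.<-≤-trans 0<1 (≤-+ʳ 1ℚ (0≤nat n)))

nat*-cancel-≤ : ∀ n .{{_ : ℕ.NonZero n}} {a b} → ℕ→ℚ n ℚ.* a ℚ.≤ ℕ→ℚ n ℚ.* b → a ℚ.≤ b
nat*-cancel-≤ n = ℚₚ.*-cancelˡ-≤-pos (ℕ→ℚ n) {{ℚ.positive (0<nat n)}}

qpow : ℚ → ℕ → ℚ
qpow x zero = 1ℚ
qpow x (suc k) = qpow x k ℚ.* x

expSum : ℕ → ℚ → ℚ
expSum zero x = 0ℚ
expSum (suc m) x = expSum m x ℚ.+ qpow x m ℚ.* 1/! m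

nat-^ : ∀ B k → ℕ→ℚ (B ℕ.^ k) ≡ qpow (ℕ→ℚ B) k
nat-^ B zero = refl
nat-^ B (suc k) = trans (nat-* B (B ℕ.^ k)) (trans (ℚₚ.*-comm (ℕ→ℚ B) (ℕ→ℚ (B ℕ.^ k))) (cong (ℚ._* ℕ→ℚ B) (nat-^ B k)))

1/!-suc : ∀ k → ℕ→ℚ (suc k) ℚ.* 1/! (suc k) ≡ 1/! k
1/!-suc k = trans (sym (ℚₚ.*-identityʳ _)) (trans (cong (ℕ→ℚ (suc k) ℚ.* 1/! (suc k) ℚ.*_) (sym (1/!*nat! k)))
  (trans (solve 4 (λ s f g t → s :* f :* (g :* t) := (f :* (s :* t)) :* g) refl (ℕ→ℚ (suc k)) (1/! (suc k)) (1/! k) (ℕ→ℚ (k !)))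
    (trans (cong (ℚ._* 1/! k) (trans (cong (1/! (suc k) ℚ.*_) (sym (nat-* (suc k) (k !)))) (1/!*nat! (suc k)))) (ℚₚ.*-identityˡ (1/! k)))))

0≤qpow : ∀ {x} k → 0ℚ ℚ.≤ x → 0ℚ ℚ.≤ qpow x k
0≤qpow zero 0≤x = 0≤1
0≤qpow (suc k) 0≤x = 0≤* (0≤qpow k 0≤x) 0≤x

0≤e : ∀ {x} m → 0ℚ ℚ.≤ x → 0ℚ ℚ.≤ expSum m x
0≤e zero 0≤x = ℚₚ.≤-refl
0≤e (suc m) 0≤x = 0≤+ (0≤e m 0≤x) (0≤* (0≤qpow m 0≤x) (0≤1/! m))

qpow-mono : ∀ {b c} k → 0ℚ ℚ.≤ b → b ℚ.≤ c → qpow b k ℚ.≤ qpow c k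
qpow-mono zero 0≤b b≤c = ℚₚ.≤-refl
qpow-mono (suc k) 0≤b b≤c = *-mono-≤ (0≤qpow k (ℚₚ.≤-trans 0≤b b≤c)) 0≤b (qpow-mono k 0≤b b≤c) b≤c

e-mono : ∀ {b c} m → 0ℚ ℚ.≤ b → b ℚ.≤ c → expSum m b ℚ.≤ expSum m c
e-mono zero 0≤b b≤c = ℚₚ.≤-refl
e-mono (suc m) 0≤b b≤c = ℚₚ.+-mono-≤ (e-mono m 0≤b b≤c)
  (ℚₚ.*-monoʳ-≤-nonNeg (1/! m) {{ℚ.nonNegative (0≤1/! m)}} (qpow-mono m 0≤b b≤c))

e-inc : ∀ {x} m → 0ℚ ℚ.≤ x → expSum m x ℚ.≤ expSum (suc m) x
e-inc m 0≤x = ≤-+ʳ _ (0≤* (0≤qpow m 0≤x) (0≤1/! m))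

qpow-upper : ∀ b h k → 0ℚ ℚ.≤ b → 0ℚ ℚ.≤ h →
  qpow (b ℚ.+ h) (suc k) ℚ.≤ qpow b (suc k) ℚ.+ h ℚ.* (ℕ→ℚ (suc k) ℚ.* qpow (b ℚ.+ h) k)
qpow-upper b h zero 0≤b 0≤h = ℚₚ.≤-reflexive
  (solve 2 (λ b h → con 1ℚ :* (b :+ h) := con 1ℚ :* b :+ h :* (con (ℕ→ℚ 1) :* con 1ℚ)) refl b h)
qpow-upper b h (suc k) 0≤b 0≤h = ℚₚ.≤-trans
  (ℚₚ.*-monoʳ-≤-nonNeg (b ℚ.+ h) {{ℚ.nonNegative (0≤+ 0≤b 0≤h)}} (qpow-upper b h k 0≤b 0≤h))
  (ℚₚ.≤-trans
    (ℚₚ.≤-reflexive (solve 5 (λ b h n p q → (p :+ h :* (n :* q)) :* (b :+ h) := p :* b :+ h :* p :+ h :* (n :* (q :* (b :+ h)))) refl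
       b h (ℕ→ℚ (suc k)) (qpow b (suc k)) (qpow (b ℚ.+ h) k)))
    (ℚₚ.≤-trans
      (ℚₚ.+-monoˡ-≤ (h ℚ.* (ℕ→ℚ (suc k) ℚ.* qpow (b ℚ.+ h) (suc k))) (ℚₚ.+-monoʳ-≤ (qpow b (suc (suc k)))
        (ℚₚ.*-monoˡ-≤-nonNeg h {{ℚ.nonNegative 0≤h}} (qpow-mono (suc k) 0≤b (≤-+ʳ b 0≤h)))))
      (ℚₚ.≤-reflexive (trans
        (solve 4 (λ h n p q → p :+ h :* q :+ h :* (n :* q) := p :+ h :* ((con 1ℚ :+ n) :* q)) refl
          h (ℕ→ℚ (suc k)) (qpow b (suc (suc k))) (qpow (b ℚ.+ h) (suc k)))
        (cong (λ r → qpow b (suc (suc k)) ℚ.+ h ℚ.* (r ℚ.* qpow (b ℚ.+ h) (suc k))) (sym (nat-suc (suc k))))))))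

e-upper′ : ∀ b h m → 0ℚ ℚ.≤ b → 0ℚ ℚ.≤ h → expSum (suc m) (b ℚ.+ h) ℚ.≤ expSum (suc m) b ℚ.+ h ℚ.* expSum m (b ℚ.+ h)
e-upper′ b h zero 0≤b 0≤h = ℚₚ.≤-reflexive (solve 1 (λ h → con 0ℚ :+ con 1ℚ :* con (1/! 0) := con 0ℚ :+ con 1ℚ :* con (1/! 0) :+ h :* con 0ℚ) refl h)
e-upper′ b h (suc m) 0≤b 0≤h = ℚₚ.≤-trans
  (ℚₚ.+-mono-≤ (e-upper′ b h m 0≤b 0≤h)
    (ℚₚ.*-monoʳ-≤-nonNeg (1/! (suc m)) {{ℚ.nonNegative (0≤1/! (suc m))}} (qpow-upper b h m 0≤b 0≤h)))
  (ℚₚ.≤-reflexive (trans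
    (solve 7 (λ E h E′ p n q f → E :+ h :* E′ :+ (p :+ h :* (n :* q)) :* f := E :+ p :* f :+ h :* (E′ :+ q :* (n :* f))) refl
      (expSum (suc m) b) h (expSum m (b ℚ.+ h)) (qpow b (suc m)) (ℕ→ℚ (suc m)) (qpow (b ℚ.+ h) m) (1/! (suc m)))
    (cong (λ r → expSum (suc (suc m)) b ℚ.+ h ℚ.* (expSum m (b ℚ.+ h) ℚ.+ qpow (b ℚ.+ h) m ℚ.* r)) (1/!-suc m))))

e-upper : ∀ b h m → 0ℚ ℚ.≤ b → 0ℚ ℚ.≤ h → expSum m (b ℚ.+ h) ℚ.≤ expSum m b ℚ.+ h ℚ.* expSum m (b ℚ.+ h)
e-upper b h zero 0≤b 0≤h = ℚₚ.≤-reflexive (solve 1 (λ h → con 0ℚ := con 0ℚ :+ h :* con 0ℚ) refl h)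
e-upper b h (suc m) 0≤b 0≤h = ℚₚ.≤-trans (e-upper′ b h m 0≤b 0≤h)
  (ℚₚ.+-monoʳ-≤ (expSum (suc m) b) (ℚₚ.*-monoˡ-≤-nonNeg h {{ℚ.nonNegative 0≤h}} (e-inc m (0≤+ 0≤b 0≤h))))

e-0 : ∀ m → expSum m 0ℚ ℚ.≤ 1ℚ
e-0 zero = 0≤1
e-0 (suc m) = ℚₚ.≤-reflexive (eq m)
  where
  eq : ∀ m → expSum (suc m) 0ℚ ≡ 1ℚ
  eq zero = refl
  eq (suc m) = trans (cong₂ ℚ._+_ (eq m) (trans (cong (ℚ._* 1/! (suc m)) (ℚₚ.*-zeroʳ (qpow 0ℚ m))) (ℚₚ.*-zeroˡ (1/! (suc m))))) (ℚₚ.+-identityʳ 1ℚ)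

e-½ : ∀ m j → expSum m (½ ℚ.* ℕ→ℚ j) ℚ.≤ ℕ→ℚ (2 ℕ.^ j)
e-½ m zero = e-0 m
e-½ m (suc j) = subst (λ r → expSum m r ℚ.≤ ℕ→ℚ (2 ℕ.^ suc j))
  (sym (trans (cong (½ ℚ.*_) (nat-suc j)) (solve 1 (λ s → con ½ :* (con 1ℚ :+ s) := con ½ :* s :+ con ½) refl (ℕ→ℚ j))))
  (ℚₚ.≤-trans double (subst (ℕ→ℚ 2 ℚ.* expSum m b ℚ.≤_) (sym (nat-* 2 (2 ℕ.^ j))) (ℚₚ.*-monoˡ-≤-nonNeg (ℕ→ℚ 2) (e-½ m j))))
  where
  b = ½ ℚ.* ℕ→ℚ j
  E = expSum m (b ℚ.+ ½)
  double : E ℚ.≤ ℕ→ℚ 2 ℚ.* expSum m b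
  double = subst₂ ℚ._≤_
    (solve 1 (λ E → con (ℕ→ℚ 2) :* (E :- con ½ :* E) := E) refl E)
    (solve 2 (λ E F → con (ℕ→ℚ 2) :* (F :+ con ½ :* E :- con ½ :* E) := con (ℕ→ℚ 2) :* F) refl E (expSum m b))
    (ℚₚ.*-monoˡ-≤-nonNeg (ℕ→ℚ 2) (ℚₚ.+-monoˡ-≤ (ℚ.- (½ ℚ.* E))
      (e-upper b ½ m (0≤* (ℚₚ.nonNegative⁻¹ ½) (0≤nat j)) (ℚₚ.nonNegative⁻¹ ½))))

e-nat : ∀ m B → expSum m (ℕ→ℚ B) ℚ.≤ ℕ→ℚ (4 ℕ.^ B)
e-nat m B = subst₂ (λ r s → expSum m r ℚ.≤ ℕ→ℚ s)
  (trans (cong (½ ℚ.*_) (nat-* 2 B)) (solve 1 (λ b → con ½ :* (con (ℕ→ℚ 2) :* b) := b) refl (ℕ→ℚ B)))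
  (sym (ℕₚ.^-*-assoc 2 2 B))
  (e-½ m (2 ℕ.* B))

bounded-exp : ∀ z B → Bounded z (ℕ→ℚ B) → Bounded (exp z) (ℕ→ℚ (4 ℕ.^ B ℕ.+ 1))
bounded-exp z B b = bounded-weaken (exp z) (ℚₚ.≤-reflexive (sym (nat-+ (4 ℕ.^ B) 1)))
  (bounded-limit (λ m → ∑ m (λ k → z ^ k /! k)) (exp z)
    (proj₂ (complete (λ m → ∑ m (λ k → z ^ k /! k)) (exp-summable z)))
    (λ m → bounded-weaken (∑ m (λ k → z ^ k /! k)) (e-nat m B) (partial m)))
  where
  partial : ∀ m → Bounded (∑ m (λ k → z ^ k /! k)) (expSum m (ℕ→ℚ B))
  partial zero = bounded-ℚ ℚₚ.≤-refl
  partial (suc m) = bounded-+ (∑ m (λ k → z ^ k /! k)) (z ^ m /! m) (partial m)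
    (bounded-weaken (z ^ m /! m) (ℚₚ.≤-reflexive (cong (ℚ._* 1/! m) (nat-^ B m)))
      (bounded-/! (z ^ m) m (bounded-^ z B m b)))

harmonic : ℕ → ℚ
harmonic zero = 0ℚ
harmonic (suc n) = harmonic n ℚ.+ 1/suc n

harmonic-mono : ∀ k d → harmonic k ℚ.≤ harmonic (d ℕ.+ k)
harmonic-mono k zero = ℚₚ.≤-refl
harmonic-mono k (suc d) = ℚₚ.≤-trans (harmonic-mono k d) (≤-+ʳ _ (0≤1/suc (d ℕ.+ k)))

1/-antitone : ∀ m n .{{_ : ℕ.NonZero m}} .{{_ : ℕ.NonZero n}} → m ℕ.≤ n → + 1 ℚ./ n ℚ.≤ + 1 ℚ./ m
1/-antitone (suc m) (suc n) (s≤s m≤n) = 1/suc-antitone m≤n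

nat*1/ : ∀ n m .{{_ : ℕ.NonZero m}} .{{_ : ℕ.NonZero (n ℕ.* m)}} → ℕ→ℚ n ℚ.* (+ 1 ℚ./ (n ℕ.* m)) ≡ + 1 ℚ./ m
nat*1/ n m = trans (sym (ℚₚ.*-identityʳ _)) (trans (cong (ℕ→ℚ n ℚ.* r ℚ.*_) (sym (1/n*n m)))
  (trans (solve 4 (λ n r s m → n :* r :* (s :* m) := r :* (n :* m) :* s) refl (ℕ→ℚ n) r (+ 1 ℚ./ m) (ℕ→ℚ m))
    (trans (cong (ℚ._* (+ 1 ℚ./ m)) (trans (cong (r ℚ.*_) (sym (nat-* n m))) (1/n*n (n ℕ.* m)))) (ℚₚ.*-identityˡ (+ 1 ℚ./ m)))))
  where r = + 1 ℚ./ (n ℕ.* m)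

harmonic-upper : ∀ k d .{{_ : ℕ.NonZero k}} → harmonic (d ℕ.+ k) ℚ.≤ harmonic k ℚ.+ ℕ→ℚ d ℚ.* (+ 1 ℚ./ k)
harmonic-upper k zero = ℚₚ.≤-reflexive (solve 2 (λ h r → h := h :+ con 0ℚ :* r) refl (harmonic k) (+ 1 ℚ./ k))
harmonic-upper k (suc d) = ℚₚ.≤-trans
  (ℚₚ.+-mono-≤ (harmonic-upper k d) (1/-antitone k (suc (d ℕ.+ k)) (ℕₚ.≤-trans (ℕₚ.m≤n+m k d) (ℕₚ.n≤1+n _))))
  (ℚₚ.≤-reflexive (trans
    (solve 3 (λ h r n → h :+ n :* r :+ r := h :+ (con 1ℚ :+ n) :* r) refl (harmonic k) (+ 1 ℚ./ k) (ℕ→ℚ d))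
    (cong (λ s → harmonic k ℚ.+ s ℚ.* (+ 1 ℚ./ k)) (sym (nat-suc d)))))

harmonic-lower : ∀ k d N .{{_ : ℕ.NonZero N}} → d ℕ.+ k ℕ.≤ N → harmonic k ℚ.+ ℕ→ℚ d ℚ.* (+ 1 ℚ./ N) ℚ.≤ harmonic (d ℕ.+ k)
harmonic-lower k zero N _ = ℚₚ.≤-reflexive (solve 2 (λ h r → h :+ con 0ℚ :* r := h) refl (harmonic k) (+ 1 ℚ./ N))
harmonic-lower k (suc d) N le = ℚₚ.≤-trans
  (ℚₚ.≤-reflexive (trans
    (cong (λ s → harmonic k ℚ.+ s ℚ.* (+ 1 ℚ./ N)) (nat-suc d))
    (solve 3 (λ h r n → h :+ (con 1ℚ :+ n) :* r := h :+ n :* r :+ r) refl (harmonic k) (+ 1 ℚ./ N) (ℕ→ℚ d))))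
  (ℚₚ.+-mono-≤ (harmonic-lower k d N (ℕₚ.≤-trans (ℕₚ.n≤1+n _) le)) (1/-antitone (suc (d ℕ.+ k)) N le))

-- H(nm) − H(m) = Σ_{j=1}^{(n−1)m} (1/m) · 1/(1 + j/m) is the right Riemann sum of ∫₁ⁿ dt/t with
-- step 1/m; exp-ln shows that its limit is the real logarithm of n.
module _ (n : ℕ) .{{n≢0 : ℕ.NonZero n}} where

  lnApprox : ℕ → ℚ
  lnApprox m = harmonic (n ℕ.* m) ℚ.- harmonic m

  private
    step-eq : ∀ M → harmonic (n ℕ.* suc M) ≡ harmonic (n ℕ.+ n ℕ.* M)
    step-eq M = cong harmonic (ℕₚ.*-suc n M)

    instance
      nz : ∀ {M} → ℕ.NonZero (n ℕ.* suc M)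
      nz {M} = ℕₚ.m*n≢0 n (suc M)

    step-lower : ∀ M → lnApprox (suc M) ℚ.≤ lnApprox (suc (suc M))
    step-lower M = subst (lnApprox (suc M) ℚ.≤_)
        (cong (ℚ._- harmonic (suc (suc M))) (sym (step-eq (suc M))))
        (subst (ℚ._≤ harmonic (n ℕ.+ n ℕ.* suc M) ℚ.- harmonic (suc (suc M)))
          (trans (cong (λ r → harmonic (n ℕ.* suc M) ℚ.+ r ℚ.- harmonic (suc (suc M))) (nat*1/ n (suc (suc M))))
            (solve 3 (λ h g r → h :+ r :- (g :+ r) := h :- g) refl (harmonic (n ℕ.* suc M)) (harmonic (suc M)) (1/suc (suc M))))
          (ℚₚ.+-monoˡ-≤ (ℚ.- harmonic (suc (suc M)))
            (harmonic-lower (n ℕ.* suc M) n (n ℕ.* suc (suc M)) (ℕₚ.≤-reflexive (sym (ℕₚ.*-suc n (suc M)))))))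

    step-upper : ∀ M → lnApprox (suc (suc M)) ℚ.≤ lnApprox (suc M) ℚ.+ (1/suc M ℚ.- 1/suc (suc M))
    step-upper M = subst (ℚ._≤ lnApprox (suc M) ℚ.+ (1/suc M ℚ.- 1/suc (suc M)))
        (cong (ℚ._- harmonic (suc (suc M))) (sym (step-eq (suc M))))
        (subst (harmonic (n ℕ.+ n ℕ.* suc M) ℚ.- harmonic (suc (suc M)) ℚ.≤_)
          (trans (cong (λ r → harmonic (n ℕ.* suc M) ℚ.+ r ℚ.- harmonic (suc (suc M))) (nat*1/ n (suc M)))
            (solve 4 (λ h g r s → h :+ s :- (g :+ r) := h :- g :+ (s :- r)) refl (harmonic (n ℕ.* suc M)) (harmonic (suc M)) (1/suc (suc M)) (1/suc M)))
          (ℚₚ.+-monoˡ-≤ (ℚ.- harmonic (suc (suc M))) (harmonic-upper (n ℕ.* suc M) n)))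

  lnApprox-mono : ∀ M d → lnApprox (suc M) ℚ.≤ lnApprox (suc (d ℕ.+ M))
  lnApprox-mono M zero = ℚₚ.≤-refl
  lnApprox-mono M (suc d) = ℚₚ.≤-trans (lnApprox-mono M d) (step-lower (d ℕ.+ M))

  lnApprox-upper : ∀ M d → lnApprox (suc (d ℕ.+ M)) ℚ.≤ lnApprox (suc M) ℚ.+ (1/suc M ℚ.- 1/suc (d ℕ.+ M))
  lnApprox-upper M zero = ℚₚ.≤-reflexive (solve 2 (λ a r → a := a :+ (r :- r)) refl (lnApprox (suc M)) (1/suc M))
  lnApprox-upper M (suc d) = ℚₚ.≤-trans (step-upper (d ℕ.+ M)) (ℚₚ.≤-trans
    (ℚₚ.+-monoˡ-≤ (1/suc (d ℕ.+ M) ℚ.- 1/suc (suc d ℕ.+ M)) (lnApprox-upper M d))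
    (ℚₚ.≤-reflexive (solve 4 (λ a r s t → a :+ (r :- s) :+ (s :- t) := a :+ (r :- t)) refl (lnApprox (suc M)) (1/suc M) (1/suc (d ℕ.+ M)) (1/suc (suc d ℕ.+ M)))))

  private
    gap : ∀ M d → ℚ.∣ lnApprox (suc (d ℕ.+ M)) ℚ.- lnApprox (suc M) ∣ ℚ.≤ 1/suc M
    gap M d = ℚₚ.≤-trans
      (ℚₚ.≤-reflexive (ℚₚ.0≤p⇒∣p∣≡p (subst (ℚ._≤ lnApprox (suc (d ℕ.+ M)) ℚ.- lnApprox (suc M)) (ℚₚ.+-inverseʳ (lnApprox (suc M)))
         (ℚₚ.+-monoˡ-≤ (ℚ.- lnApprox (suc M)) (lnApprox-mono M d)))))
      (ℚₚ.≤-trans (ℚₚ.+-monoˡ-≤ (ℚ.- lnApprox (suc M)) (lnApprox-upper M d))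
        (subst₂ ℚ._≤_
          (solve 3 (λ a r s → r :- s := a :+ (r :- s) :- a) refl (lnApprox (suc M)) (1/suc M) (1/suc (d ℕ.+ M)))
          (ℚₚ.+-identityʳ (1/suc M))
          (ℚₚ.+-monoʳ-≤ (1/suc M) (ℚₚ.neg-antimono-≤ (0≤1/suc (d ℕ.+ M))))))

    gap′ : ∀ M M′ → M ℕ.≤ M′ → ℚ.∣ lnApprox (suc M′) ℚ.- lnApprox (suc M) ∣ ℚ.≤ 1/suc M
    gap′ M M′ M≤M′ = subst (λ k → ℚ.∣ lnApprox (suc k) ℚ.- lnApprox (suc M) ∣ ℚ.≤ 1/suc M) (ℕₚ.m∸n+n≡m M≤M′) (gap M (M′ ℕ.∸ M))

  lnApprox-cauchy : IsCauchy lnApprox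
  lnApprox-cauchy ε 0<ε =
    let (N , a) = archimedean ε 0<ε
    in suc N , close N a
    where
    close : ∀ N → 1/suc N ℚ.≤ ε → ∀ m k → suc N ℕ.≤ m → suc N ℕ.≤ k → ℚ.∣ lnApprox m ℚ.- lnApprox k ∣ ℚ.≤ ε
    close N a (suc m) (suc k) (s≤s N≤m) (s≤s N≤k) with ℕₚ.≤-total m k
    ... | inj₁ m≤k = ℚₚ.≤-trans (ℚₚ.≤-reflexive (∣-∣-swap (lnApprox (suc m)) (lnApprox (suc k))))
                       (ℚₚ.≤-trans (gap′ m k m≤k) (ℚₚ.≤-trans (1/suc-antitone N≤m) a))
    ... | inj₂ k≤m = ℚₚ.≤-trans (gap′ k m k≤m) (ℚₚ.≤-trans (1/suc-antitone N≤k) a)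

  ln : ℝ
  ln = mkℝ lnApprox lnApprox-cauchy

0≤lnApprox : ∀ n m .{{_ : ℕ.NonZero n}} → 0ℚ ℚ.≤ lnApprox n m
0≤lnApprox (suc n) m = subst (ℚ._≤ lnApprox (suc n) m) (ℚₚ.+-inverseʳ (harmonic m))
  (ℚₚ.+-monoˡ-≤ (ℚ.- harmonic m) (subst (λ k → harmonic m ℚ.≤ harmonic k) (ℕₚ.+-comm (n ℕ.* m) m) (harmonic-mono m (n ℕ.* m))))

lnApprox≤ : ∀ n m → lnApprox (suc n) (suc m) ℚ.≤ ℕ→ℚ n
lnApprox≤ n m = subst (lnApprox (suc n) (suc m) ℚ.≤_)
  (trans (solve 2 (λ h r → h :+ r :- h := r) refl (harmonic M) (ℕ→ℚ (n ℕ.* M) ℚ.* 1/suc m))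
    (trans (cong (ℚ._* 1/suc m) (nat-* n M)) (trans (ℚₚ.*-assoc (ℕ→ℚ n) (ℕ→ℚ M) (1/suc m))
      (trans (cong (ℕ→ℚ n ℚ.*_) (trans (ℚₚ.*-comm (ℕ→ℚ M) (1/suc m)) (1/suc*nat m))) (ℚₚ.*-identityʳ (ℕ→ℚ n))))))
  (ℚₚ.+-monoˡ-≤ (ℚ.- harmonic M)
    (subst (λ k → harmonic k ℚ.≤ harmonic M ℚ.+ ℕ→ℚ (n ℕ.* M) ℚ.* 1/suc m) (ℕₚ.+-comm (n ℕ.* M) M) (harmonic-upper M (n ℕ.* M))))
  where M = suc m

bounded-ln : ∀ n .{{_ : ℕ.NonZero n}} → Bounded (ℝ→ℂ (ln n)) (ℕ→ℚ n)
bounded-ln (suc n) = bounded-ℝ (ln (suc n)) (1 , λ { (suc m) _ →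
  ℚₚ.≤-trans (ℚₚ.≤-reflexive (ℚₚ.0≤p⇒∣p∣≡p (0≤lnApprox (suc n) (suc m))))
    (ℚₚ.≤-trans (lnApprox≤ n m) (nat-mono (ℕₚ.n≤1+n n))) })

qpow-lower : ∀ b h k → 0ℚ ℚ.≤ b → 0ℚ ℚ.≤ h →
  qpow b (suc k) ℚ.+ h ℚ.* (ℕ→ℚ (suc k) ℚ.* qpow b k) ℚ.≤ qpow (b ℚ.+ h) (suc k)
qpow-lower b h zero 0≤b 0≤h = ℚₚ.≤-reflexive
  (solve 2 (λ b h → con 1ℚ :* b :+ h :* (con (ℕ→ℚ 1) :* con 1ℚ) := con 1ℚ :* (b :+ h)) refl b h)
qpow-lower b h (suc k) 0≤b 0≤h = ℚₚ.≤-trans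
  (≤-+ʳ _ (0≤* 0≤h (0≤* 0≤h (0≤* (0≤nat (suc k)) (0≤qpow k 0≤b)))))
  (ℚₚ.≤-trans
    (ℚₚ.≤-reflexive (trans
      (cong (λ r → qpow b (suc (suc k)) ℚ.+ h ℚ.* (r ℚ.* qpow b (suc k)) ℚ.+ h ℚ.* (h ℚ.* (ℕ→ℚ (suc k) ℚ.* qpow b k))) (nat-suc (suc k)))
      (solve 4 (λ b h n q → q :* b :* b :+ h :* ((con 1ℚ :+ n) :* (q :* b)) :+ h :* (h :* (n :* q)) := (q :* b :+ h :* (n :* q)) :* (b :+ h)) refl
        b h (ℕ→ℚ (suc k)) (qpow b k))))
    (ℚₚ.*-monoʳ-≤-nonNeg (b ℚ.+ h) {{ℚ.nonNegative (0≤+ 0≤b 0≤h)}} (qpow-lower b h k 0≤b 0≤h)))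

e-lower : ∀ b h m → 0ℚ ℚ.≤ b → 0ℚ ℚ.≤ h → expSum (suc m) b ℚ.+ h ℚ.* expSum m b ℚ.≤ expSum (suc m) (b ℚ.+ h)
e-lower b h zero 0≤b 0≤h = ℚₚ.≤-reflexive (solve 1 (λ h → con 0ℚ :+ con 1ℚ :* con (1/! 0) :+ h :* con 0ℚ := con 0ℚ :+ con 1ℚ :* con (1/! 0)) refl h)
e-lower b h (suc m) 0≤b 0≤h = ℚₚ.≤-trans
  (ℚₚ.≤-reflexive (trans
    (cong (λ r → expSum (suc (suc m)) b ℚ.+ h ℚ.* (expSum m b ℚ.+ qpow b m ℚ.* r)) (sym (1/!-suc m)))
    (solve 7 (λ E h E′ p n q f → E :+ p :* f :+ h :* (E′ :+ q :* (n :* f)) := E :+ h :* E′ :+ (p :+ h :* (n :* q)) :* f) refl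
      (expSum (suc m) b) h (expSum m b) (qpow b (suc m)) (ℕ→ℚ (suc m)) (qpow b m) (1/! (suc m)))))
  (ℚₚ.+-mono-≤ (e-lower b h m 0≤b 0≤h)
    (ℚₚ.*-monoʳ-≤-nonNeg (1/! (suc m)) {{ℚ.nonNegative (0≤1/! (suc m))}} (qpow-lower b h m 0≤b 0≤h)))

e-inc-≤ : ∀ {x} {m n} → m ℕ.≤ n → 0ℚ ℚ.≤ x → expSum m x ℚ.≤ expSum n x
e-inc-≤ {x} {m} {n} m≤n 0≤x = subst (λ k → expSum m x ℚ.≤ expSum k x) (ℕₚ.m∸n+n≡m m≤n) (go (n ℕ.∸ m))
  where
  go : ∀ d → expSum m x ℚ.≤ expSum (d ℕ.+ m) x
  go zero = ℚₚ.≤-refl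
  go (suc d) = ℚₚ.≤-trans (go d) (e-inc (d ℕ.+ m) 0≤x)

0≤Δharmonic : ∀ k d → 0ℚ ℚ.≤ harmonic (d ℕ.+ k) ℚ.- harmonic k
0≤Δharmonic k d = subst (ℚ._≤ harmonic (d ℕ.+ k) ℚ.- harmonic k) (ℚₚ.+-inverseʳ (harmonic k))
  (ℚₚ.+-monoˡ-≤ (ℚ.- harmonic k) (harmonic-mono k d))

Δharmonic-suc : ∀ k d → harmonic (suc d ℕ.+ k) ℚ.- harmonic k ≡ harmonic (d ℕ.+ k) ℚ.- harmonic k ℚ.+ 1/suc (d ℕ.+ k)
Δharmonic-suc k d = solve 3 (λ h g r → h :+ r :- g := h :- g :+ r) refl (harmonic (d ℕ.+ k)) (harmonic k) (1/suc (d ℕ.+ k))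

e-harmonic-upper : ∀ m M d .{{_ : ℕ.NonZero M}} → ℕ→ℚ M ℚ.* expSum m (harmonic (d ℕ.+ M) ℚ.- harmonic M) ℚ.≤ ℕ→ℚ (d ℕ.+ M)
e-harmonic-upper m M zero = subst₂ ℚ._≤_
  (cong (λ r → ℕ→ℚ M ℚ.* expSum m r) (sym (ℚₚ.+-inverseʳ (harmonic M)))) (ℚₚ.*-identityʳ (ℕ→ℚ M))
  (ℚₚ.*-monoˡ-≤-nonNeg (ℕ→ℚ M) {{ℚ.nonNegative (0≤nat M)}} (e-0 m))
e-harmonic-upper m M@(suc _) (suc d) = subst (λ x → ℕ→ℚ M ℚ.* expSum m x ℚ.≤ s) (sym (Δharmonic-suc M d))
  (nat*-cancel-≤ (d ℕ.+ M) {{ℕ.>-nonZero (ℕₚ.m≤n⇒m≤o+n d (s≤s z≤n))}}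
    (ℚₚ.≤-trans
      (ℚₚ.≤-trans
        (ℚₚ.≤-reflexive (solve 3 (λ t M E → t :* (M :* E) := M :* (t :* E)) refl t (ℕ→ℚ M) E))
        (ℚₚ.*-monoˡ-≤-nonNeg (ℕ→ℚ M) {{ℚ.nonNegative (0≤nat M)}} tE≤))
      (ℚₚ.≤-trans
        (ℚₚ.≤-reflexive (solve 3 (λ M s E → M :* (s :* E) := s :* (M :* E)) refl (ℕ→ℚ M) s (expSum m b)))
        (ℚₚ.≤-trans (ℚₚ.*-monoˡ-≤-nonNeg s {{ℚ.nonNegative (0≤nat (suc (d ℕ.+ M)))}} (e-harmonic-upper m M d))
          (ℚₚ.≤-reflexive (ℚₚ.*-comm s t))))))
  where
  b = harmonic (d ℕ.+ M) ℚ.- harmonic M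
  r = 1/suc (d ℕ.+ M)
  t = ℕ→ℚ (d ℕ.+ M)
  s = ℕ→ℚ (suc (d ℕ.+ M))
  E = expSum m (b ℚ.+ r)
  tE≤ : t ℚ.* E ℚ.≤ s ℚ.* expSum m b
  tE≤ = subst₂ ℚ._≤_
    (trans (cong (λ q → q ℚ.* E ℚ.- E) (nat-suc (d ℕ.+ M))) (solve 2 (λ t E → (con 1ℚ :+ t) :* E :- E := t :* E) refl t E))
    (trans (solve 4 (λ s F r E → s :* (F :+ r :* E) :- E := s :* F :+ ((r :* s) :* E :- E)) refl s (expSum m b) r E)
      (trans (cong (λ q → s ℚ.* expSum m b ℚ.+ (q ℚ.* E ℚ.- E)) (1/suc*nat (d ℕ.+ M)))
        (solve 2 (λ F E → F :+ (con 1ℚ :* E :- E) := F) refl (s ℚ.* expSum m b) E)))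
    (ℚₚ.+-monoˡ-≤ (ℚ.- E) (ℚₚ.*-monoˡ-≤-nonNeg s {{ℚ.nonNegative (0≤nat (suc (d ℕ.+ M)))}}
      (e-upper b r m (0≤Δharmonic M d) (0≤1/suc (d ℕ.+ M)))))

e-harmonic-lower : ∀ M d → ℕ→ℚ (suc (d ℕ.+ M)) ℚ.≤ ℕ→ℚ (suc M) ℚ.* expSum (suc d) (harmonic (d ℕ.+ M) ℚ.- harmonic M)
e-harmonic-lower M zero = ℚₚ.≤-reflexive (solve 1 (λ s → s := s :* (con 0ℚ :+ con 1ℚ :* con (1/! 0))) refl (ℕ→ℚ (suc M)))
e-harmonic-lower M (suc d) = subst (λ x → ℕ→ℚ (suc (suc d ℕ.+ M)) ℚ.≤ ℕ→ℚ (suc M) ℚ.* expSum (suc (suc d)) x) (sym (Δharmonic-suc M d))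
  (ℚₚ.≤-trans
    (ℚₚ.≤-reflexive (trans (nat-suc (suc (d ℕ.+ M)))
      (trans (cong (ℚ._+ s) (sym (1/suc*nat (d ℕ.+ M)))) (solve 2 (λ r s → r :* s :+ s := (con 1ℚ :+ r) :* s) refl r s))))
    (ℚₚ.≤-trans (ℚₚ.*-monoˡ-≤-nonNeg (1ℚ ℚ.+ r) {{ℚ.nonNegative (0≤+ 0≤1 (0≤1/suc (d ℕ.+ M)))}} (e-harmonic-lower M d))
      (ℚₚ.≤-trans
        (ℚₚ.≤-reflexive (solve 3 (λ r S F → (con 1ℚ :+ r) :* (S :* F) := S :* (F :+ r :* F)) refl r (ℕ→ℚ (suc M)) (expSum (suc d) b)))
        (ℚₚ.*-monoˡ-≤-nonNeg (ℕ→ℚ (suc M)) {{ℚ.nonNegative (0≤nat (suc M))}}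
          (ℚₚ.≤-trans (ℚₚ.+-monoˡ-≤ (r ℚ.* expSum (suc d) b) (e-inc (suc d) (0≤Δharmonic M d)))
            (e-lower b r (suc d) (0≤Δharmonic M d) (0≤1/suc (d ℕ.+ M))))))))
  where
  b = harmonic (d ℕ.+ M) ℚ.- harmonic M
  r = 1/suc (d ℕ.+ M)
  s = ℕ→ℚ (suc (d ℕ.+ M))

∑∞-limit : ∀ a (s : Summable a) → (λ n → ∑ n a) ⟶ ∑∞ a s
∑∞-limit a s = proj₂ (complete (λ n → ∑ n a) s)

⟶-≈ : ∀ u l c → u ⟶ l →
  (∀ ε → 0ℚ ℚ.< ε → ∃[ N ] (∀ m j → N ℕ.≤ m → N ℕ.≤ j → norm (u m - c) j ℚ.≤ ε)) → l ≈ c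
⟶-≈ u l c u⟶l u-c =
    (λ ε 0<ε → ev-map (λ j → ℚₚ.≤-trans (≤-+ʳ (re-dist j) (ℚₚ.0≤∣p∣ (approx (im (l - c)) j)))) (near ε 0<ε))
  , (λ ε 0<ε → ev-map (λ j → ℚₚ.≤-trans (≤-+ˡ (im-dist j) (ℚₚ.0≤∣p∣ (approx (re (l - c)) j)))) (near ε 0<ε))
  where
  re-dist im-dist : ℕ → ℚ
  re-dist j = ℚ.∣ approx (re (l - c)) j ∣
  im-dist j = ℚ.∣ approx (im (l - c)) j ∣

  reorder : ∀ a b c → (a ℚ.- b) ℚ.+ (b ℚ.- c) ≡ a ℚ.- c
  reorder = solve 3 (λ a b c → (a :- b) :+ (b :- c) := a :- c) refl

  triangle : ∀ m j → norm (l - c) j ℚ.≤ norm (l - u m) j ℚ.+ norm (u m - c) j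
  triangle m j = subst (ℚ._≤ norm (l - u m) j ℚ.+ norm (u m - c) j)
    (cong₂ (λ r s → ℚ.∣ r ∣ ℚ.+ ℚ.∣ s ∣)
      (reorder (approx (re l) j) (approx (re (u m)) j) (approx (re c) j))
      (reorder (approx (im l) j) (approx (im (u m)) j) (approx (im c) j)))
    (norm-+ (l - u m) (u m - c) j)

  near : ∀ ε → 0ℚ ℚ.< ε → Eventually λ j → norm (l - c) j ℚ.≤ ε
  near ε 0<ε =
    let q = ½ ℚ.* (½ ℚ.* ε)
        0<q = 0<½* (0<½* 0<ε)
        (N , h) = u⟶l (½ ℚ.* ε) (0<½* 0<ε)
        (K , g) = u-c q 0<q
        m = N ℕ.⊔ K
    in ev-zip
        (λ j s t → ℚₚ.≤-trans (triangle m j) (ℚₚ.≤-trans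
          (ℚₚ.+-mono-≤ (ℚₚ.≤-trans (ℚₚ.≤-reflexive (norm-swap l (u m) j)) s) t)
          (ℚₚ.≤-reflexive (solve 1 (λ ε → con ½ :* ε :+ con ½ :* (con ½ :* ε) :+ con ½ :* (con ½ :* ε) := ε) refl ε))))
        (h m (ℕₚ.m≤m⊔n N K) q 0<q)
        (K , λ j → g m j (ℕₚ.m≤n⊔m N K))

^-approx : ∀ x k j → approx (re (ℝ→ℂ x ^ k)) j ≡ qpow (approx x j) k × approx (im (ℝ→ℂ x ^ k)) j ≡ 0ℚ
^-approx x zero j = refl , refl
^-approx x (suc k) j =
    trans (cong₂ (λ a b → a ℚ.* r ℚ.- b ℚ.* 0ℚ) (proj₁ ih) (proj₂ ih))
      (solve 2 (λ a r → a :* r :- con 0ℚ :* con 0ℚ := a :* r) refl (qpow r k) r)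
  , trans (cong₂ (λ a b → a ℚ.* 0ℚ ℚ.+ b ℚ.* r) (proj₁ ih) (proj₂ ih))
      (solve 2 (λ a r → a :* con 0ℚ :+ con 0ℚ :* r := con 0ℚ) refl (qpow r k) r)
  where
  r = approx x j
  ih = ^-approx x k j

∑-approx : ∀ x m j → let S = ∑ m (λ k → ℝ→ℂ x ^ k /! k) in approx (re S) j ≡ expSum m (approx x j) × approx (im S) j ≡ 0ℚ
∑-approx x zero j = refl , refl
∑-approx x (suc m) j =
    cong₂ ℚ._+_ (proj₁ ih) (trans (cong₂ (λ a b → a ℚ.* 1/! m ℚ.- b ℚ.* 0ℚ) (proj₁ pw) (proj₂ pw))
      (solve 2 (λ a r → a :* r :- con 0ℚ :* con 0ℚ := a :* r) refl (qpow r m) (1/! m)))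
  , cong₂ ℚ._+_ (proj₂ ih) (trans (cong₂ (λ a b → a ℚ.* 0ℚ ℚ.+ b ℚ.* 1/! m) (proj₁ pw) (proj₂ pw))
      (solve 2 (λ a r → a :* con 0ℚ :+ con 0ℚ :* r := con 0ℚ) refl (qpow r m) (1/! m)))
  where
  r = approx x j
  ih = ∑-approx x m j
  pw = ^-approx x m j

norm-∑ : ∀ x q m j → norm (∑ m (λ k → ℝ→ℂ x ^ k /! k) - ℚ→ℂ q) j ≡ ℚ.∣ expSum m (approx x j) ℚ.- q ∣
norm-∑ x q m j = trans
  (cong₂ (λ r s → ℚ.∣ r ℚ.- q ∣ ℚ.+ ℚ.∣ s ℚ.- 0ℚ ∣) (proj₁ (∑-approx x m j)) (proj₂ (∑-approx x m j)))
  (ℚₚ.+-identityʳ ℚ.∣ expSum m (approx x j) ℚ.- q ∣)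

exp-ℝ : ∀ x q → (∀ ε → 0ℚ ℚ.< ε → ∃[ N ] (∀ m j → N ℕ.≤ m → N ℕ.≤ j → ℚ.∣ expSum m (approx x j) ℚ.- q ∣ ℚ.≤ ε)) →
  exp (ℝ→ℂ x) ≈ ℚ→ℂ q
exp-ℝ x q h = ⟶-≈ (λ m → ∑ m (λ k → ℝ→ℂ x ^ k /! k)) (exp (ℝ→ℂ x)) (ℚ→ℂ q)
  (∑∞-limit (λ k → ℝ→ℂ x ^ k /! k) (exp-summable (ℝ→ℂ x))) λ ε 0<ε →
    proj₁ (h ε 0<ε) , λ m j Lm Lj → subst (ℚ._≤ ε) (sym (norm-∑ x q m j)) (proj₂ (h ε 0<ε) m j Lm Lj)

module _ (n′ : ℕ) where

  private
    R : ℕ → ℚ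
    R = lnApprox (suc n′)

    R-eq : ∀ M → R M ≡ harmonic (n′ ℕ.* M ℕ.+ M) ℚ.- harmonic M
    R-eq M = cong (λ k → harmonic k ℚ.- harmonic M) (ℕₚ.+-comm M (n′ ℕ.* M))

  e-ln-upper : ∀ m M .{{_ : ℕ.NonZero M}} → expSum m (R M) ℚ.≤ ℕ→ℚ (suc n′)
  e-ln-upper m M = nat*-cancel-≤ M (subst₂ ℚ._≤_ (cong (λ r → ℕ→ℚ M ℚ.* expSum m r) (sym (R-eq M)))
    (trans (cong ℕ→ℚ (trans (ℕₚ.+-comm (n′ ℕ.* M) M) (ℕₚ.*-comm (suc n′) M))) (nat-* M (suc n′)))
    (e-harmonic-upper m M (n′ ℕ.* M)))

  e-ln-lower : ∀ M → ℕ→ℚ (suc n′) ℚ.- ℕ→ℚ n′ ℚ.* 1/suc M ℚ.≤ expSum (suc (n′ ℕ.* M)) (R M)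
  e-ln-lower M = nat*-cancel-≤ (suc M) (subst₂ ℚ._≤_
    (sym (trans (solve 4 (λ S n n′ r → S :* (n :- n′ :* r) := S :* n :- n′ :* (r :* S)) refl (ℕ→ℚ (suc M)) (ℕ→ℚ (suc n′)) (ℕ→ℚ n′) (1/suc M))
      (trans (cong (λ q → ℕ→ℚ (suc M) ℚ.* ℕ→ℚ (suc n′) ℚ.- ℕ→ℚ n′ ℚ.* q) (1/suc*nat M))
        (trans (cong₂ (λ q q′ → q ℚ.* q′ ℚ.- ℕ→ℚ n′ ℚ.* 1ℚ) (nat-suc M) (nat-suc n′))
          (trans (solve 2 (λ M n → (con 1ℚ :+ M) :* (con 1ℚ :+ n) :- n :* con 1ℚ := con 1ℚ :+ (n :* M :+ M)) refl (ℕ→ℚ M) (ℕ→ℚ n′))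
            (sym (trans (nat-suc (n′ ℕ.* M ℕ.+ M)) (cong (1ℚ ℚ.+_) (trans (nat-+ (n′ ℕ.* M) M) (cong (ℚ._+ ℕ→ℚ M) (nat-* n′ M)))))))))))
    (cong (λ r → ℕ→ℚ (suc M) ℚ.* expSum (suc (n′ ℕ.* M)) r) (sym (R-eq M)))
    (e-harmonic-lower M (n′ ℕ.* M)))

  e-ln-limit : ∀ ε → 0ℚ ℚ.< ε → ∃[ N ] (∀ m j → N ℕ.≤ m → N ℕ.≤ j → ℚ.∣ expSum m (R j) ℚ.- ℕ→ℚ (suc n′) ∣ ℚ.≤ ε)
  e-ln-limit ε 0<ε =
    let (δ , 0<δ , h) = shrink (1ℚ ℚ.+ ℕ→ℚ n′) ε (ℚₚ.<-≤-trans 0<1 (≤-+ʳ 1ℚ (0≤nat n′))) 0<ε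
        (K , a) = archimedean δ 0<δ
        M = suc K
        small : ℕ→ℚ n′ ℚ.* 1/suc M ℚ.≤ ε
        small = ℚₚ.≤-trans (*-mono-≤ (0≤+ 0≤1 (0≤nat n′)) (0≤1/suc M) (≤-+ˡ (ℕ→ℚ n′) 0≤1)
          (ℚₚ.≤-trans (1/suc-antitone (ℕₚ.n≤1+n K)) a)) h
    in suc (n′ ℕ.* M) ℕ.⊔ M , λ m j Lm Lj → close K small m j
         (ℕₚ.m⊔n≤o⇒m≤o (suc (n′ ℕ.* M)) M Lm) (ℕₚ.m⊔n≤o⇒n≤o (suc (n′ ℕ.* M)) M Lj)
    where
    close : ∀ K → ℕ→ℚ n′ ℚ.* 1/suc (suc K) ℚ.≤ ε → ∀ m j → suc (n′ ℕ.* suc K) ℕ.≤ m → suc K ℕ.≤ j → ℚ.∣ expSum m (R j) ℚ.- ℕ→ℚ (suc n′) ∣ ℚ.≤ ε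
    close K small m (suc j) Lm (s≤s Lj) = ℚₚ.≤-trans
      (ℚₚ.≤-reflexive (trans (∣-∣-swap (expSum m (R (suc j))) (ℕ→ℚ (suc n′)))
        (ℚₚ.0≤p⇒∣p∣≡p (subst (ℚ._≤ ℕ→ℚ (suc n′) ℚ.- expSum m (R (suc j))) (ℚₚ.+-inverseʳ (expSum m (R (suc j))))
          (ℚₚ.+-monoˡ-≤ (ℚ.- expSum m (R (suc j))) (e-ln-upper m (suc j)))))))
      (subst (ℕ→ℚ (suc n′) ℚ.- expSum m (R (suc j)) ℚ.≤_) (solve 2 (λ n ε → n :- (n :- ε) := ε) refl (ℕ→ℚ (suc n′)) ε)
        (ℚₚ.+-monoʳ-≤ (ℕ→ℚ (suc n′)) (ℚₚ.neg-antimono-≤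
          (ℚₚ.≤-trans (ℚₚ.+-monoʳ-≤ (ℕ→ℚ (suc n′)) (ℚₚ.neg-antimono-≤ small))
            (ℚₚ.≤-trans (e-ln-lower (suc K))
              (ℚₚ.≤-trans (e-inc-≤ Lm (0≤lnApprox (suc n′) (suc K)))
                (e-mono m (0≤lnApprox (suc n′) (suc K))
                  (subst (λ k → R (suc K) ℚ.≤ R (suc k)) (ℕₚ.m∸n+n≡m Lj) (lnApprox-mono (suc n′) K (j ℕ.∸ K))))))))))

  exp-ln : exp (ℝ→ℂ (ln (suc n′))) ≈ ℚ→ℂ (ℕ→ℚ (suc n′))
  exp-ln = exp-ℝ (ln (suc n′)) (ℕ→ℚ (suc n′)) e-ln-limit

infixr 8 _^ᶜ_
_^ᶜ_ : (n : ℕ) .{{_ : ℕ.NonZero n}} → ℂ → ℂ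
n ^ᶜ p = exp (p * ℝ→ℂ (ln n))

pow-base : ℂ → ℕ
pow-base p = 4 ℕ.^ proj₁ (bounded p) ℕ.+ 1

bounded-^ᶜ : ∀ p k → Bounded (suc k ^ᶜ p) (ℕ→ℚ (pow-base p ℕ.^ suc k))
bounded-^ᶜ p k =
  let (P , b) = bounded p
  in bounded-weaken (suc k ^ᶜ p) (nat-mono (grow P))
       (bounded-exp (p * ℝ→ℂ (ln (suc k))) (P ℕ.* suc k)
         (bounded-weaken (p * ℝ→ℂ (ln (suc k))) (ℚₚ.≤-reflexive (sym (nat-* P (suc k))))
           (bounded-* p (ℝ→ℂ (ln (suc k))) b (bounded-ln (suc k)))))
  where
  sum-pow : ∀ a n → a ℕ.^ suc n ℕ.+ 1 ℕ.≤ (a ℕ.+ 1) ℕ.^ suc n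
  sum-pow a zero = ℕₚ.≤-reflexive (trans (cong (ℕ._+ 1) (ℕₚ.*-identityʳ a)) (sym (ℕₚ.*-identityʳ (a ℕ.+ 1))))
  sum-pow a (suc n) = ℕₚ.≤-trans
    (ℕₚ.+-mono-≤ (ℕₚ.*-monoʳ-≤ a (ℕₚ.≤-trans (ℕₚ.m≤m+n (a ℕ.^ suc n) 1) (sum-pow a n)))
                 (ℕₚ.m^n>0 (a ℕ.+ 1) {{ℕ.>-nonZero (ℕₚ.m≤n+m 1 a)}} (suc n)))
    (ℕₚ.≤-reflexive (trans (cong (a ℕ.* t ℕ.+_) (sym (ℕₚ.*-identityˡ t))) (sym (ℕₚ.*-distribʳ-+ t a 1))))
    where t = (a ℕ.+ 1) ℕ.^ suc n
  grow : ∀ P → 4 ℕ.^ (P ℕ.* suc k) ℕ.+ 1 ℕ.≤ (4 ℕ.^ P ℕ.+ 1) ℕ.^ suc k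
  grow P = subst (λ t → t ℕ.+ 1 ℕ.≤ (4 ℕ.^ P ℕ.+ 1) ℕ.^ suc k) (ℕₚ.^-*-assoc 4 P (suc k)) (sum-pow (4 ℕ.^ P) k)

bounded-power-sum : ∀ (a : ℕ → ℂ) K → (∀ k → Bounded (a k) (ℕ→ℚ (K ℕ.^ suc k))) → ∀ n → Bounded (∑ n a) (ℕ→ℚ ((K ℕ.+ 1) ℕ.^ n))
bounded-power-sum a K b zero = bounded-weaken (ℚ→ℂ 0ℚ) 0≤1 (bounded-ℚ ℚₚ.≤-refl)
bounded-power-sum a K b (suc n) = bounded-weaken (∑ (suc n) a)
  (ℚₚ.≤-trans (ℚₚ.≤-reflexive (sym (nat-+ t (K ℕ.^ suc n))))
    (nat-mono (ℕₚ.≤-trans (ℕₚ.+-monoʳ-≤ t (ℕₚ.*-monoʳ-≤ K (ℕₚ.^-monoˡ-≤ n (ℕₚ.m≤m+n K 1))))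
      (ℕₚ.≤-reflexive (trans (ℕₚ.+-comm t (K ℕ.* t)) (trans (cong (K ℕ.* t ℕ.+_) (sym (ℕₚ.*-identityˡ t))) (sym (ℕₚ.*-distribʳ-+ t K 1))))))))
  (bounded-+ (∑ n a) (a n) (bounded-power-sum a K b n) (b n))
  where t = (K ℕ.+ 1) ℕ.^ n

E-summable : ∀ x p → Summable λ k → suc k ^ᶜ p * x ^ suc k /! suc k
E-summable x p = shifted-summable (λ k → suc k ^ᶜ p) x (pow-base p) (bounded-^ᶜ p)

M-summable : ∀ x p → Summable λ k → ∑ (suc k) (λ j → suc j ^ᶜ p) * x ^ suc k /! suc k
M-summable x p = shifted-summable (λ k → ∑ (suc k) (λ j → suc j ^ᶜ p)) x (pow-base p ℕ.+ 1)
  (λ k → bounded-power-sum (λ j → suc j ^ᶜ p) (pow-base p) (bounded-^ᶜ p) (suc k))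

-- The series over n ≥ 1 are indexed by k with n = suc k.
E M : ℂ → ℂ → ℂ
E x p = ∑∞ (λ k → suc k ^ᶜ p * x ^ suc k /! suc k) (E-summable x p)
M x p = ∑∞ (λ k → ∑ (suc k) (λ j → suc j ^ᶜ p) * x ^ suc k /! suc k) (M-summable x p)

-- Tagged partitions of [0, 1] with mesh at most δ.
record TaggedPartition (δ : ℚ) : Set where
  field
    size     : ℕ
    node tag : ℕ → ℝ
    first    : node 0 ≈ᵣ ℚ→ℝ 0ℚ
    last     : node size ≈ᵣ ℚ→ℝ 1ℚ
    node≤tag : ∀ i → i ℕ.< size → node i ≤ᵣ tag i
    tag≤node : ∀ i → i ℕ.< size → tag i ≤ᵣ node (suc i)
    mesh     : ∀ i → i ℕ.< size → node (suc i) -ᵣ node i ≤ᵣ ℚ→ℝ δ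

riemannSum : ∀ {δ} → (ℂ → ℂ) → ℂ → TaggedPartition δ → ℂ
riemannSum f x P = ∑ size λ i → f (ℝ→ℂ (tag i) * x) * (ℝ→ℂ (node (suc i) -ᵣ node i) * x)
  where open TaggedPartition P

-- I is the Riemann integral of f along the segment from 0 to x, parametrised by t = s x, 0 ≤ s ≤ 1.
IsIntegral : (ℂ → ℂ) → ℂ → ℂ → Set
IsIntegral f x I = ∀ ε → 0ℚ ℚ.< ε →
  ∃[ δ ] (0ℚ ℚ.< δ × (∀ (P : TaggedPartition δ) → ‖ riemannSum f x P - I ‖ ≤ᵣ ℚ→ℝ ε))

{-# OPTIONS --safe #-}
-- Let G = M − E. Its coefficients are the partial sums shifted by one place, so G′ = M termwise, and
-- F(y) = e⁻ʸ G(y) satisfies F′(y) = e⁻ʸ (M(y) − G(y)) = e⁻ʸ E(y). Since F(0) = 0, the integral is F(x),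
-- and multiplying by eˣ gives M − E; here eʸ e⁻ʸ = 1 because this product has derivative 0.
-- Differentiability is used in the form |H(b) − H(a) − h(t)(b − a)| ≤ C d |b − a| for a, b within d of t
-- in a ball. It passes from partial sums to limits, is stable under products, and telescopes over a
-- tagged partition, so it yields the Riemann integral of h directly.

module Submission where

open import Algebra.Bundles using (CommutativeRing)
import Algebra.Solver.Ring.AlmostCommutativeRing as ACR
import Algebra.Solver.Ring.Simple as RingSolver
open import Data.Nat.Base as ℕ using (ℕ; zero; suc; z≤n; s≤s)
open import Data.Nat.Properties as ℕₚ using ()
open import Data.Product.Base using (∃-syntax; _×_; _,_; proj₁; proj₂)
open import Data.Product.Properties using (≡-dec)
open import Data.Rational.Base as ℚ using (ℚ; 0ℚ; 1ℚ; ½)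
open import Data.Rational.Properties as ℚₚ using ()
open import Data.Rational.Solver using (module +-*-Solver)
open import Data.Sum.Base using (inj₁; inj₂)
open import Relation.Binary.PropositionalEquality
  using (_≡_; refl; sym; trans; cong; cong₂; subst; subst₂; isEquivalence)
open import Defs

open +-*-Solver using (solve; _:=_; _:+_; _:*_; _:-_; :-_; con)

-- A complex number is given through rational stages, and each inequality holds from a threshold on
-- that depends on the inequality. Infinitely many terms therefore cannot be bounded at one stage:
-- only finite partial sums are estimated directly, with a constant that does not depend on the
-- number of terms, and the bound is then carried to the limit. That constant comes from bounding
-- the first-order remainder of a power by its second derivative at the radius of the ball; weighted
-- by a geometric bound on the coefficients and by 1/n!, these stay below a fixed multiple of an
-- exponential. The error C d |b - a| keeps two separate factors because they are consumed
-- differently: d bounds the distance from the tag and shrinks with the mesh, while the factors |b -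
-- a| add up to the length of the segment. This also replaces the mean value theorem: a function
-- with derivative 0 is constant because the Riemann sums of its derivative vanish. Ring identities
-- hold exactly at each stage, so a comparison splits into an identity in ℚ[i] and an estimate.

-- Exact arithmetic of the approximations in ℚ[i].

ℚ[i] : Set
ℚ[i] = ℚ × ℚ

infixl 6 _⊕_
infixl 7 _⊗_

_⊕_ _⊗_ : ℚ[i] → ℚ[i] → ℚ[i]
(a , b) ⊕ (c , d) = a ℚ.+ c , b ℚ.+ d
(a , b) ⊗ (c , d) = a ℚ.* c ℚ.- b ℚ.* d , a ℚ.* d ℚ.+ b ℚ.* c

⊖_ : ℚ[i] → ℚ[i]
⊖ (a , b) = ℚ.- a , ℚ.- b

ℚ[i]-commutativeRing : CommutativeRing _ _
ℚ[i]-commutativeRing = record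
  { Carrier = ℚ[i] ; _≈_ = _≡_ ; _+_ = _⊕_ ; _*_ = _⊗_ ; -_ = ⊖_ ; 0# = 0ℚ , 0ℚ ; 1# = 1ℚ , 0ℚ
  ; isCommutativeRing = record
    { isRing = record
      { +-isAbelianGroup = record
        { isGroup = record
          { isMonoid = record
            { isSemigroup = record
              { isMagma = record { isEquivalence = isEquivalence ; ∙-cong = cong₂ _⊕_ }
              ; assoc = λ (a , b) (c , d) (e , f) → cong₂ _,_ (ℚₚ.+-assoc a c e) (ℚₚ.+-assoc b d f) }
            ; identity = (λ (a , b) → cong₂ _,_ (ℚₚ.+-identityˡ a) (ℚₚ.+-identityˡ b))
                       , (λ (a , b) → cong₂ _,_ (ℚₚ.+-identityʳ a) (ℚₚ.+-identityʳ b)) }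
          ; inverse = (λ (a , b) → cong₂ _,_ (ℚₚ.+-inverseˡ a) (ℚₚ.+-inverseˡ b))
                    , (λ (a , b) → cong₂ _,_ (ℚₚ.+-inverseʳ a) (ℚₚ.+-inverseʳ b))
          ; ⁻¹-cong = cong ⊖_ }
        ; comm = λ (a , b) (c , d) → cong₂ _,_ (ℚₚ.+-comm a c) (ℚₚ.+-comm b d) }
      ; *-cong = cong₂ _⊗_
      ; *-assoc = λ (a , b) (c , d) (e , f) → cong₂ _,_
          (solve 6 (λ a b c d e f → (a :* c :- b :* d) :* e :- (a :* d :+ b :* c) :* f
            := a :* (c :* e :- d :* f) :- b :* (c :* f :+ d :* e)) refl a b c d e f)
          (solve 6 (λ a b c d e f → (a :* c :- b :* d) :* f :+ (a :* d :+ b :* c) :* e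
            := a :* (c :* f :+ d :* e) :+ b :* (c :* e :- d :* f)) refl a b c d e f)
      ; *-identity = (λ (a , b) → cong₂ _,_
            (solve 2 (λ a b → con 1ℚ :* a :- con 0ℚ :* b := a) refl a b)
            (solve 2 (λ a b → con 1ℚ :* b :+ con 0ℚ :* a := b) refl a b))
        , (λ (a , b) → cong₂ _,_
            (solve 2 (λ a b → a :* con 1ℚ :- b :* con 0ℚ := a) refl a b)
            (solve 2 (λ a b → a :* con 0ℚ :+ b :* con 1ℚ := b) refl a b))
      ; distrib = (λ (a , b) (c , d) (e , f) → cong₂ _,_
            (solve 6 (λ a b c d e f → a :* (c :+ e) :- b :* (d :+ f)
              := a :* c :- b :* d :+ (a :* e :- b :* f)) refl a b c d e f)
            (solve 6 (λ a b c d e f → a :* (d :+ f) :+ b :* (c :+ e)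
              := a :* d :+ b :* c :+ (a :* f :+ b :* e)) refl a b c d e f))
        , (λ (a , b) (c , d) (e , f) → cong₂ _,_
            (solve 6 (λ a b c d e f → (c :+ e) :* a :- (d :+ f) :* b
              := c :* a :- d :* b :+ (e :* a :- f :* b)) refl a b c d e f)
            (solve 6 (λ a b c d e f → (c :+ e) :* b :+ (d :+ f) :* a
              := c :* b :+ d :* a :+ (e :* b :+ f :* a)) refl a b c d e f)) }
    ; *-comm = λ (a , b) (c , d) → cong₂ _,_
        (solve 4 (λ a b c d → a :* c :- b :* d := c :* a :- d :* b) refl a b c d)
        (solve 4 (λ a b c d → a :* d :+ b :* c := c :* b :+ d :* a) refl a b c d) } }

module 𝔾 = RingSolver (ACR.fromCommutativeRing ℚ[i]-commutativeRing) (≡-dec ℚₚ._≟_ ℚₚ._≟_)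
open 𝔾 using ()
  renaming (solve to solve𝔾; _:=_ to _:≡_; _:+_ to _:⊕_; _:*_ to _:⊗_; _:-_ to _:⊝_; :-_ to :⊖_; con to con𝔾)

-- All operations of ℂ act on approximations termwise, so z ↦ at z j is a ring homomorphism
-- definitionally.
at : ℂ → ℕ → ℚ[i]
at z j = approx (re z) j , approx (im z) j

-- Stagewise equality, bounds up to arbitrarily small error, and limits.

infix 4 _≗_ _≲_

_≗_ : ℂ → ℂ → Set
z ≗ w = ∀ j → at z j ≡ at w j

∣_∣ᵢ : ℚ[i] → ℚ
∣ a , b ∣ᵢ = ℚ.∣ a ∣ ℚ.+ ℚ.∣ b ∣

norm-cong : ∀ z w j → at z j ≡ at w j → norm z j ≡ norm w j
norm-cong z w j = cong ∣_∣ᵢ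

-- The bound is a rational sequence rather than a real: it typically contains `norm (b - a) j` at
-- the same stage `j` and need not be Cauchy. The slack ε, absent from `Bounded`, is what makes the
-- relation closed under limits.
record _≲_ (z : ℂ) (f : ℕ → ℚ) : Set where
  constructor mk≲
  field
    dominated : ∀ ε → 0ℚ ℚ.< ε → Eventually λ j → norm z j ℚ.≤ f j ℚ.+ ε

open _≲_

≗-≲ : ∀ {z w f} → z ≗ w → z ≲ f → w ≲ f
≗-≲ {z} {w} {f} z≗w z≲f = mk≲ λ ε 0<ε →
  ev-map (λ j → subst (ℚ._≤ f j ℚ.+ ε) (norm-cong z w j (z≗w j))) (dominated z≲f ε 0<ε)

≗-bounded : ∀ z w {q} → z ≗ w → Bounded z q → Bounded w q
≗-bounded z w {q} z≗w = ev-map (λ j → subst (ℚ._≤ q) (norm-cong z w j (z≗w j)))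

bounded-≲ : ∀ {z} {f : ℕ → ℚ} → Eventually (λ j → norm z j ℚ.≤ f j) → z ≲ f
bounded-≲ {z} {f} h = mk≲ λ ε 0<ε → ev-map (λ j p → ℚₚ.≤-trans p (≤-+ʳ (f j) (ℚₚ.<⇒≤ 0<ε))) h

≲-relax : ∀ {z f g} → (∀ ε → 0ℚ ℚ.< ε → Eventually λ j → f j ℚ.≤ g j ℚ.+ ε) → z ≲ f → z ≲ g
≲-relax {z} {f} {g} f≤g z≲f = mk≲ λ ε 0<ε → ev-zip
  (λ j p q → ℚₚ.≤-trans p (ℚₚ.≤-trans (ℚₚ.+-monoˡ-≤ (½ ℚ.* ε) q)
    (ℚₚ.≤-reflexive (solve 2 (λ g ε → g :+ con ½ :* ε :+ con ½ :* ε := g :+ ε) refl (g j) ε))))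
  (dominated z≲f (½ ℚ.* ε) (0<½* 0<ε)) (f≤g (½ ℚ.* ε) (0<½* 0<ε))

≲-mono : ∀ {z} {f g : ℕ → ℚ} → Eventually (λ j → f j ℚ.≤ g j) → z ≲ f → z ≲ g
≲-mono {z} {f} {g} f≤g = ≲-relax λ ε 0<ε → ev-map (λ j p → ℚₚ.≤-trans p (≤-+ʳ (g j) (ℚₚ.<⇒≤ 0<ε))) f≤g

≲-+ : ∀ {z w f g} → z ≲ f → w ≲ g → z + w ≲ λ j → f j ℚ.+ g j
≲-+ {z} {w} {f} {g} z≲f w≲g = mk≲ λ ε 0<ε → ev-zip
  (λ j p q → ℚₚ.≤-trans (norm-+ z w j) (ℚₚ.≤-trans (ℚₚ.+-mono-≤ p q)
    (ℚₚ.≤-reflexive (solve 3 (λ f g ε → f :+ con ½ :* ε :+ (g :+ con ½ :* ε) := f :+ g :+ ε) refl (f j) (g j) ε))))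
  (dominated z≲f (½ ℚ.* ε) (0<½* 0<ε)) (dominated w≲g (½ ℚ.* ε) (0<½* 0<ε))

norm-neg : ∀ z j → norm (- z) j ≡ norm z j
norm-neg z j = cong₂ ℚ._+_ (ℚₚ.∣-p∣≡∣p∣ (approx (re z) j)) (ℚₚ.∣-p∣≡∣p∣ (approx (im z) j))

≲-neg : ∀ {z f} → z ≲ f → - z ≲ f
≲-neg {z} {f} z≲f = mk≲ λ ε 0<ε → ev-map (λ j → subst (ℚ._≤ f j ℚ.+ ε) (sym (norm-neg z j))) (dominated z≲f ε 0<ε)

bounded-neg : ∀ z {q} → Bounded z q → Bounded (- z) q
bounded-neg z {q} = ev-map (λ j → subst (ℚ._≤ q) (sym (norm-neg z j)))

bounded-- : ∀ z w {a b} → Bounded z a → Bounded w b → Bounded (z - w) (a ℚ.+ b)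
bounded-- z w p q = bounded-+ z (- w) p (bounded-neg w q)

shrink-nonNeg : ∀ B ε → 0ℚ ℚ.≤ B → 0ℚ ℚ.< ε → ∃[ δ ] (0ℚ ℚ.< δ × B ℚ.* δ ℚ.≤ ε)
shrink-nonNeg B ε 0≤B 0<ε =
  let (δ , 0<δ , h) = shrink (1ℚ ℚ.+ B) ε (ℚₚ.<-≤-trans 0<1 (≤-+ʳ 1ℚ 0≤B)) 0<ε
  in δ , 0<δ , ℚₚ.≤-trans (ℚₚ.*-monoʳ-≤-nonNeg δ {{ℚ.nonNegative (ℚₚ.<⇒≤ 0<δ)}} (≤-+ˡ B 0≤1)) h

-- The slack of `z` is multiplied by `norm w j`, so it has to be chosen small against an eventual
-- bound `K` of that norm.
≲-* : ∀ {z w f} → z ≲ f → z * w ≲ λ j → f j ℚ.* norm w j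
≲-* {z} {w} {f} z≲f = mk≲ λ ε 0<ε →
  let (K , w≤K) = bounded w
      (δ , 0<δ , Kδ≤ε) = shrink-nonNeg (ℕ→ℚ K) ε (0≤nat K) 0<ε
  in ev-zip
    (λ j p q → ℚₚ.≤-trans (norm-* z w j) (ℚₚ.≤-trans
      (ℚₚ.*-monoʳ-≤-nonNeg (norm w j) {{ℚ.nonNegative (0≤norm w j)}} p)
      (ℚₚ.≤-trans
        (ℚₚ.≤-reflexive (solve 3 (λ f δ n → (f :+ δ) :* n := f :* n :+ n :* δ) refl (f j) δ (norm w j)))
        (ℚₚ.+-monoʳ-≤ (f j ℚ.* norm w j) (ℚₚ.≤-trans
          (ℚₚ.*-monoʳ-≤-nonNeg δ {{ℚ.nonNegative (ℚₚ.<⇒≤ 0<δ)}} q) Kδ≤ε)))))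
    (dominated z≲f δ 0<δ) w≤K

≲-*-bounded : ∀ {z w} {f g : ℕ → ℚ} → (∀ j → 0ℚ ℚ.≤ f j) → z ≲ f → Eventually (λ j → norm w j ℚ.≤ g j) →
  z * w ≲ λ j → f j ℚ.* g j
≲-*-bounded {z} {w} {f} {g} 0≤f z≲f w≤g = ≲-mono {z * w}
  (ev-map (λ j (h : norm w j ℚ.≤ g j) → ℚₚ.*-monoˡ-≤-nonNeg (f j) {{ℚ.nonNegative (0≤f j)}} h) w≤g) (≲-* {z} {w} {f} z≲f)

-- Nothing is lost in the limit, in contrast to `bounded-limit`, since the index `N` may depend on
-- ε. Half of ε pays for the bound on `u N`, one quarter for the distance to `l`, one quarter for
-- the slack in `_≤ᵣ_`.
⟶-≲ : ∀ {u l f} → u ⟶ l → (∀ m → u m ≲ f) → l ≲ f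
⟶-≲ {u} {l} {f} u⟶l u≲f = mk≲ λ ε 0<ε →
  let e = ½ ℚ.* (½ ℚ.* ε)
      0<e = 0<½* (0<½* 0<ε)
      (N , h) = u⟶l e 0<e
  in ev-zip
    (λ j p q → ℚₚ.≤-trans
      (ℚₚ.≤-trans
        (ℚₚ.≤-reflexive (norm-cong l (u N + (l - u N)) j (solve𝔾 2 (λ l u → l :≡ u :⊕ (l :⊝ u)) refl (at l j) (at (u N) j))))
        (norm-+ (u N) (l - u N) j))
      (ℚₚ.≤-trans (ℚₚ.+-mono-≤ p (ℚₚ.≤-trans (ℚₚ.≤-reflexive (norm-swap l (u N) j)) q))
        (ℚₚ.≤-reflexive (solve 2 (λ f ε → let e = con ½ :* (con ½ :* ε) in f :+ con ½ :* ε :+ (e :+ e) := f :+ ε) refl (f j) ε))))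
    (dominated (u≲f N) (½ ℚ.* ε) (0<½* 0<ε)) (h N ℕₚ.≤-refl e 0<e)

⟶-suc : ∀ u l → u ⟶ l → (λ m → u (suc m)) ⟶ l
⟶-suc u l u⟶l ε 0<ε = let (N , h) = u⟶l ε 0<ε in N , λ m N≤m → h (suc m) (ℕₚ.m≤n⇒m≤1+n N≤m)

≲⇒≤ᵣ : ∀ z {q} → z ≲ (λ _ → q) → ‖ z ‖ ≤ᵣ ℚ→ℝ q
≲⇒≤ᵣ z = dominated

≤ᵣ⇒≲ : ∀ z q → ‖ z ‖ ≤ᵣ ℚ→ℝ q → z ≲ (λ _ → q)
≤ᵣ⇒≲ z q = mk≲

⟶-- : ∀ u v k l → u ⟶ k → v ⟶ l → (λ m → u m - v m) ⟶ (k - l)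
⟶-- u v k l u⟶k v⟶l ε 0<ε = ev-zip
  (λ m (p : ‖ u m - k ‖ ≤ᵣ ℚ→ℝ (½ ℚ.* ε)) (q : ‖ v m - l ‖ ≤ᵣ ℚ→ℝ (½ ℚ.* ε)) →
    ≲⇒≤ᵣ (u m - v m - (k - l)) (≗-≲ {(u m - k) - (v m - l)}
      (λ j → solve𝔾 4 (λ u v k l → (u :⊝ k) :⊝ (v :⊝ l) :≡ u :⊝ v :⊝ (k :⊝ l)) refl (at (u m) j) (at (v m) j) (at k j) (at l j))
      (≲-mono {(u m - k) - (v m - l)} (always λ _ → ℚₚ.≤-reflexive (halves ε))
        (≲-+ {u m - k} { - (v m - l)} (≤ᵣ⇒≲ (u m - k) (½ ℚ.* ε) p) (≲-neg {v m - l} (≤ᵣ⇒≲ (v m - l) (½ ℚ.* ε) q))))))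
  (u⟶k (½ ℚ.* ε) (0<½* 0<ε)) (v⟶l (½ ℚ.* ε) (0<½* 0<ε))

⟶-*ʳ : ∀ u l w → u ⟶ l → (λ m → u m * w) ⟶ l * w
⟶-*ʳ u l w u⟶l ε 0<ε =
  let (K , w≤K) = bounded w
      (δ , 0<δ , Kδ≤ε) = shrink-nonNeg (ℕ→ℚ K) ε (0≤nat K) 0<ε
  in ev-map
    (λ m (p : ‖ u m - l ‖ ≤ᵣ ℚ→ℝ δ) → ≲⇒≤ᵣ (u m * w - l * w) (≗-≲ {(u m - l) * w}
      (λ j → solve𝔾 3 (λ u l w → (u :⊝ l) :⊗ w :≡ u :⊗ w :⊝ l :⊗ w) refl (at (u m) j) (at l j) (at w j))
      (≲-mono {(u m - l) * w} (always λ _ → ℚₚ.≤-trans (ℚₚ.≤-reflexive (ℚₚ.*-comm δ (ℕ→ℚ K))) Kδ≤ε)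
        (≲-*-bounded {u m - l} {w} (λ _ → ℚₚ.<⇒≤ 0<δ) (≤ᵣ⇒≲ (u m - l) δ p) w≤K))))
    (u⟶l δ 0<δ)

norm-+-≤ : ∀ z w j {a b} → norm z j ℚ.≤ a → norm w j ℚ.≤ b → norm (z + w) j ℚ.≤ a ℚ.+ b
norm-+-≤ z w j p q = ℚₚ.≤-trans (norm-+ z w j) (ℚₚ.+-mono-≤ p q)

norm-*-≤ : ∀ z w j {a b} → norm z j ℚ.≤ a → norm w j ℚ.≤ b → norm (z * w) j ℚ.≤ a ℚ.* b
norm-*-≤ z w j p q = ℚₚ.≤-trans (norm-* z w j) (*-mono-≤ (ℚₚ.≤-trans (0≤norm z j) p) (0≤norm w j) p q)

norm-ℚ : ∀ {q} j → 0ℚ ℚ.≤ q → norm (ℚ→ℂ q) j ≡ q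
norm-ℚ {q} j 0≤q = trans (ℚₚ.+-identityʳ ℚ.∣ q ∣) (ℚₚ.0≤p⇒∣p∣≡p 0≤q)

norm-^ : ∀ z k j {r} → norm z j ℚ.≤ r → norm (z ^ k) j ℚ.≤ qpow r k
norm-^ z zero j h = ℚₚ.≤-refl
norm-^ z (suc k) j h = norm-*-≤ (z ^ k) z j (norm-^ z k j h) h

ℚ→ℂ-* : ∀ p q → ℚ→ℂ (p ℚ.* q) ≗ ℚ→ℂ p * ℚ→ℂ q
ℚ→ℂ-* p q j = cong₂ _,_ (solve 2 (λ p q → p :* q := p :* q :- con 0ℚ :* con 0ℚ) refl p q)
  (solve 2 (λ p q → con 0ℚ := p :* con 0ℚ :+ con 0ℚ :* q) refl p q)

-- First-order remainders of powers.

-- The second derivative of y^(k+1) at y = r. It controls how much the derivative (k+1) y^k varies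
-- inside the ball of radius r.
powCoeff : ℚ → ℕ → ℚ
powCoeff r zero = 0ℚ
powCoeff r (suc k) = ℕ→ℚ (suc k) ℚ.* ℕ→ℚ (suc (suc k)) ℚ.* qpow r k

-- This is (y f)″ = y f″ + 2 f′ for f = y^(k+1), evaluated at r.
powCoeff-suc : ∀ r k →
  powCoeff r k ℚ.* r ℚ.+ (ℕ→ℚ (suc k) ℚ.* qpow r k ℚ.+ ℕ→ℚ (suc k) ℚ.* qpow r k) ≡ powCoeff r (suc k)
powCoeff-suc r zero = solve 1 (λ r → con 0ℚ :* r :+ (con (ℕ→ℚ 1) :* con 1ℚ :+ con (ℕ→ℚ 1) :* con 1ℚ)
  := con (ℕ→ℚ 1) :* con (ℕ→ℚ 2) :* con 1ℚ) refl r
powCoeff-suc r (suc k) = trans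
  (solve 4 (λ m n q r → m :* n :* q :* r :+ (n :* (q :* r) :+ n :* (q :* r)) := n :* (con 1ℚ :+ (con 1ℚ :+ m)) :* (q :* r)) refl
    (ℕ→ℚ (suc k)) (ℕ→ℚ (suc (suc k))) (qpow r k) r)
  (cong (λ n → ℕ→ℚ (suc (suc k)) ℚ.* n ℚ.* qpow r (suc k))
    (trans (cong (1ℚ ℚ.+_) (sym (nat-suc (suc k)))) (sym (nat-suc (suc (suc k))))))

powRemainder : ℂ → ℂ → ℂ → ℕ → ℂ
powRemainder b a t k = b ^ suc k - a ^ suc k - ℚ→ℂ (ℕ→ℚ (suc k)) * t ^ k * (b - a)

module _ {r d : ℚ} (a b t : ℂ) (j : ℕ)
  (a≤r : norm a j ℚ.≤ r) (b≤r : norm b j ℚ.≤ r) (t≤r : norm t j ℚ.≤ r)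
  (a-t≤d : norm (a - t) j ℚ.≤ d) (b-t≤d : norm (b - t) j ℚ.≤ d) where

  pow-difference : ∀ k → norm (a ^ suc k - t ^ suc k) j ℚ.≤ ℕ→ℚ (suc k) ℚ.* qpow r k ℚ.* d
  pow-difference zero = subst₂ ℚ._≤_
    (norm-cong (a - t) (a ^ 1 - t ^ 1) j (solve𝔾 2 (λ a t → a :⊝ t :≡ con𝔾 (1ℚ , 0ℚ) :⊗ a :⊝ con𝔾 (1ℚ , 0ℚ) :⊗ t) refl (at a j) (at t j)))
    (solve 1 (λ d → d := con (ℕ→ℚ 1) :* con 1ℚ :* d) refl d)
    a-t≤d
  pow-difference (suc k) = subst₂ ℚ._≤_
    (norm-cong ((a ^ suc k - t ^ suc k) * a + t ^ suc k * (a - t)) (a ^ suc (suc k) - t ^ suc (suc k)) j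
      (solve𝔾 4 (λ A T a t → (A :⊝ T) :⊗ a :⊕ T :⊗ (a :⊝ t) :≡ A :⊗ a :⊝ T :⊗ t) refl (at (a ^ suc k) j) (at (t ^ suc k) j) (at a j) (at t j)))
    (trans (solve 4 (λ n q d r → n :* q :* d :* r :+ q :* r :* d := (con 1ℚ :+ n) :* (q :* r) :* d) refl (ℕ→ℚ (suc k)) (qpow r k) d r)
      (cong (λ n → n ℚ.* qpow r (suc k) ℚ.* d) (sym (nat-suc (suc k)))))
    (norm-+-≤ ((a ^ suc k - t ^ suc k) * a) (t ^ suc k * (a - t)) j
      (norm-*-≤ (a ^ suc k - t ^ suc k) a j (pow-difference k) a≤r)
      (norm-*-≤ (t ^ suc k) (a - t) j (norm-^ t (suc k) j t≤r) a-t≤d))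

  -- Multiplying by b turns the remainder of y^(k+1) into that of y^(k+2) up to two terms. Both
  -- contain b - a, and each has one further factor that is small with d: b - t in the first,
  -- a^(k+1) - t^(k+1) in the second.
  pow-remainder : ∀ k → norm (powRemainder b a t k) j ℚ.≤ powCoeff r k ℚ.* d ℚ.* norm (b - a) j
  pow-remainder zero = ℚₚ.≤-reflexive (trans
    (norm-cong (powRemainder b a t 0) (ℚ→ℂ 0ℚ) j
      (solve𝔾 2 (λ a b → let 1′ = con𝔾 (1ℚ , 0ℚ) in 1′ :⊗ b :⊝ 1′ :⊗ a :⊝ 1′ :⊗ 1′ :⊗ (b :⊝ a) :≡ con𝔾 (0ℚ , 0ℚ)) refl (at a j) (at b j)))
    (solve 2 (λ d n → con 0ℚ := con 0ℚ :* d :* n) refl d (norm (b - a) j)))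
  pow-remainder (suc k) = subst₂ ℚ._≤_
    (norm-cong (powRemainder b a t k * b + (N * t ^ k * (b - a) * (b - t) + (a ^ suc k - t ^ suc k) * (b - a))) (powRemainder b a t (suc k)) j
      (trans
        (solve𝔾 7 (λ A B T N a b t → (B :⊝ A :⊝ N :⊗ T :⊗ (b :⊝ a)) :⊗ b :⊕ (N :⊗ T :⊗ (b :⊝ a) :⊗ (b :⊝ t) :⊕ (A :⊝ T :⊗ t) :⊗ (b :⊝ a))
            :≡ B :⊗ b :⊝ A :⊗ a :⊝ (con𝔾 (1ℚ , 0ℚ) :⊕ N) :⊗ (T :⊗ t) :⊗ (b :⊝ a)) refl
          (at (a ^ suc k) j) (at (b ^ suc k) j) (at (t ^ k) j) (at N j) (at a j) (at b j) (at t j))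
        (cong (λ q → at (b ^ suc (suc k) - a ^ suc (suc k)) j ⊕ (⊖ ((q , 0ℚ) ⊗ at (t ^ suc k) j ⊗ at (b - a) j))) (sym (nat-suc (suc k))))))
    (trans
      (solve 6 (λ p d n r q m → p :* d :* n :* r :+ (m :* q :* n :* d :+ m :* q :* d :* n) := (p :* r :+ (m :* q :+ m :* q)) :* d :* n) refl
        (powCoeff r k) d n r (qpow r k) (ℕ→ℚ (suc k)))
      (cong (λ q → q ℚ.* d ℚ.* n) (powCoeff-suc r k)))
    (norm-+-≤ (powRemainder b a t k * b) (N * t ^ k * (b - a) * (b - t) + (a ^ suc k - t ^ suc k) * (b - a)) j
      (norm-*-≤ (powRemainder b a t k) b j (pow-remainder k) b≤r)
      (norm-+-≤ (N * t ^ k * (b - a) * (b - t)) ((a ^ suc k - t ^ suc k) * (b - a)) j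
        (norm-*-≤ (N * t ^ k * (b - a)) (b - t) j
          (norm-*-≤ (N * t ^ k) (b - a) j
            (norm-*-≤ N (t ^ k) j (ℚₚ.≤-reflexive (norm-ℚ j (0≤nat (suc k)))) (norm-^ t k j t≤r))
            ℚₚ.≤-refl)
          b-t≤d)
        (norm-*-≤ (a ^ suc k - t ^ suc k) (b - a) j (pow-difference k) ℚₚ.≤-refl)))
    where
    N = ℚ→ℂ (ℕ→ℚ (suc k))
    n = norm (b - a) j

-- Remainders of exponential generating functions.

ev-× : ∀ {P Q : ℕ → Set} → Eventually P → Eventually Q → Eventually λ n → P n × Q n
ev-× = ev-zip λ n → _,_

qpow-* : ∀ p q k → qpow (p ℚ.* q) k ≡ qpow p k ℚ.* qpow q k
qpow-* p q zero = refl
qpow-* p q (suc k) = trans (cong (ℚ._* (p ℚ.* q)) (qpow-* p q k))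
  (solve 4 (λ P Q p q → P :* Q :* (p :* q) := P :* p :* (Q :* q)) refl (qpow p k) (qpow q k) p q)

-- `series s` is the exponential generating function of `s`, and the termwise derivative of
-- `antiderivative s`. Both exp (apart from its constant term) and M - E arise as such
-- antiderivatives.
series antiderivative : (ℕ → ℂ) → ℂ → ℕ → ℂ
series s y m = ∑ m (λ k → s k * y ^ k /! k)
antiderivative s y m = ∑ m (λ k → s k * y ^ suc k /! suc k)

module _ (s : ℕ → ℂ) (K : ℕ) (s≤ : ∀ k → Bounded (s k) (ℕ→ℚ (K ℕ.^ k))) (R : ℕ) where

  private
    κ ρ : ℚ
    κ = ℕ→ℚ K
    ρ = ℕ→ℚ R

  module _ {d : ℚ} (a b t : ℂ)
    (a≤R : Bounded a (ℕ→ℚ R)) (b≤R : Bounded b (ℕ→ℚ R)) (t≤R : Bounded t (ℕ→ℚ R))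
    (a-t≤d : Bounded (a - t) d) (b-t≤d : Bounded (b - t) d) where

    seriesRemainder : ℕ → ℂ
    seriesRemainder m = antiderivative s b m - antiderivative s a m - series s t m * (b - a)

    private
      term : ℕ → ℂ
      term k = s k * powRemainder b a t k /! suc k

      seriesRemainder-suc : ∀ m → seriesRemainder m + term m ≗ seriesRemainder (suc m)
      seriesRemainder-suc m j = trans
        (solve𝔾 11 (λ S A B P x y T N f a b →
            B :⊝ A :⊝ P :⊗ (b :⊝ a) :⊕ S :⊗ (y :⊝ x :⊝ N :⊗ T :⊗ (b :⊝ a)) :⊗ f
            :≡ B :⊕ S :⊗ y :⊗ f :⊝ (A :⊕ S :⊗ x :⊗ f) :⊝ (P :⊕ S :⊗ T :⊗ (N :⊗ f)) :⊗ (b :⊝ a)) refl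
          (at (s m) j) (at (antiderivative s a m) j) (at (antiderivative s b m) j) (at (series s t m) j)
          (at (a ^ suc m) j) (at (b ^ suc m) j) (at (t ^ m) j) (at (ℚ→ℂ (ℕ→ℚ (suc m))) j) (at (ℚ→ℂ (1/! (suc m))) j) (at a j) (at b j))
        (cong (λ f → at (antiderivative s b (suc m) - antiderivative s a (suc m)) j ⊕ (⊖ ((at (series s t m) j ⊕ at (s m * t ^ m) j ⊗ f) ⊗ at (b - a) j)))
          (trans (sym (ℚ→ℂ-* (ℕ→ℚ (suc m)) (1/! (suc m)) j)) (cong (_, 0ℚ) (1/!-suc m))))

      bound : ℕ → ℚ
      bound k = qpow κ k ℚ.* powCoeff ρ k ℚ.* 1/! (suc k)

      -- The factor (k+1)(k+2) from the second derivative cancels against (k+2)!, so the bounds are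
      -- the terms of κ exp(κρ).
      bound-suc : ∀ k → bound (suc k) ≡ κ ℚ.* (qpow (κ ℚ.* ρ) k ℚ.* 1/! k)
      bound-suc k = trans
        (solve 6 (λ P κ m n Q f → P :* κ :* (m :* n :* Q) :* f := κ :* (P :* Q :* (m :* (n :* f)))) refl
          (qpow κ k) κ (ℕ→ℚ (suc k)) (ℕ→ℚ (suc (suc k))) (qpow ρ k) (1/! (suc (suc k))))
        (cong (κ ℚ.*_) (cong₂ ℚ._*_ (sym (qpow-* κ ρ k))
          (trans (cong (ℕ→ℚ (suc k) ℚ.*_) (1/!-suc (suc k))) (1/!-suc k))))

      term-bound : ∀ k → Eventually λ j → norm (term k) j ℚ.≤ bound k ℚ.* d ℚ.* norm (b - a) j
      term-bound k = ev-map
        (λ j (s≤ , a≤R , b≤R , t≤R , a-t≤d , b-t≤d) → ℚₚ.≤-trans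
          (norm-*-≤ (s k * powRemainder b a t k) (ℚ→ℂ (1/! (suc k))) j
            (norm-*-≤ (s k) (powRemainder b a t k) j (subst (norm (s k) j ℚ.≤_) (nat-^ K k) s≤)
              (pow-remainder a b t j a≤R b≤R t≤R a-t≤d b-t≤d k))
            (ℚₚ.≤-reflexive (norm-ℚ j (0≤1/! (suc k)))))
          (ℚₚ.≤-reflexive (solve 5 (λ P p d n f → P :* (p :* d :* n) :* f := P :* p :* f :* d :* n) refl
            (qpow κ k) (powCoeff ρ k) d (norm (b - a) j) (1/! (suc k)))))
        (ev-× (s≤ k) (ev-× a≤R (ev-× b≤R (ev-× t≤R (ev-× a-t≤d b-t≤d)))))

      +-bound : ∀ m e → Eventually (λ j → norm (seriesRemainder m) j ℚ.≤ e ℚ.* d ℚ.* norm (b - a) j) →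
        Eventually (λ j → norm (seriesRemainder (suc m)) j ℚ.≤ (e ℚ.+ bound m) ℚ.* d ℚ.* norm (b - a) j)
      +-bound m e h = ev-zip
        (λ j p q → subst₂ ℚ._≤_
          (norm-cong (seriesRemainder m + term m) (seriesRemainder (suc m)) j (seriesRemainder-suc m j))
          (solve 4 (λ e B d n → e :* d :* n :+ B :* d :* n := (e :+ B) :* d :* n) refl e (bound m) d (norm (b - a) j))
          (norm-+-≤ (seriesRemainder m) (term m) j p q))
        h (term-bound m)

    -- The term of index 0 is linear in y and has no remainder; hence `suc m` terms cost only
    -- `expSum m`. Induction over finitely many terms is essential, as each term bound brings its
    -- own threshold.
    seriesRemainder-bound : ∀ m → Eventually λ j → norm (seriesRemainder (suc m)) j ℚ.≤ κ ℚ.* expSum m (κ ℚ.* ρ) ℚ.* d ℚ.* norm (b - a) j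
    seriesRemainder-bound zero = ev-map
      (λ j → subst (λ e → norm (seriesRemainder 1) j ℚ.≤ e ℚ.* d ℚ.* norm (b - a) j)
        (solve 2 (λ κ f → con 0ℚ :+ con 1ℚ :* con 0ℚ :* f := κ :* con 0ℚ) refl κ (1/! 1)))
      (+-bound 0 0ℚ (always λ j → ℚₚ.≤-reflexive (trans
        (norm-cong (seriesRemainder 0) (ℚ→ℂ 0ℚ) j
          (solve𝔾 2 (λ a b → let 0′ = con𝔾 (0ℚ , 0ℚ) in 0′ :⊝ 0′ :⊝ 0′ :⊗ (b :⊝ a) :≡ 0′) refl (at a j) (at b j)))
        (solve 2 (λ d n → con 0ℚ := con 0ℚ :* d :* n) refl d (norm (b - a) j)))))
    seriesRemainder-bound (suc m) = ev-map
      (λ j → subst (λ e → norm (seriesRemainder (suc (suc m))) j ℚ.≤ e ℚ.* d ℚ.* norm (b - a) j)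
        (trans (cong (κ ℚ.* expSum m (κ ℚ.* ρ) ℚ.+_) (bound-suc m)) (sym (ℚₚ.*-distribˡ-+ κ _ _))))
      (+-bound (suc m) (κ ℚ.* expSum m (κ ℚ.* ρ)) (seriesRemainder-bound m))

    -- The point is a constant independent of `m`, as `⟶-≲` requires; `e-nat` provides it by
    -- bounding every partial sum of exp(K R) by 4^(K R).
    seriesRemainder-≲ : ∀ m → seriesRemainder (suc m) ≲ λ j → ℕ→ℚ (K ℕ.* 4 ℕ.^ (K ℕ.* R)) ℚ.* d ℚ.* norm (b - a) j
    seriesRemainder-≲ m = bounded-≲ {seriesRemainder (suc m)} (ev-zip
      (λ j p q → ℚₚ.≤-trans p (ℚₚ.*-monoʳ-≤-nonNeg (norm (b - a) j) {{ℚ.nonNegative (0≤norm (b - a) j)}}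
        (ℚₚ.*-monoʳ-≤-nonNeg d {{ℚ.nonNegative (ℚₚ.≤-trans (0≤norm (a - t) j) q)}} e≤)))
      (seriesRemainder-bound m) a-t≤d)
      where
      e≤ : κ ℚ.* expSum m (κ ℚ.* ρ) ℚ.≤ ℕ→ℚ (K ℕ.* 4 ℕ.^ (K ℕ.* R))
      e≤ = subst₂ ℚ._≤_ (cong (λ r → κ ℚ.* expSum m r) (nat-* K R)) (sym (nat-* K (4 ℕ.^ (K ℕ.* R))))
        (ℚₚ.*-monoˡ-≤-nonNeg κ {{ℚ.nonNegative (0≤nat K)}} (e-nat m (K ℕ.* R)))

-- Quantitative differentiability on balls and its calculus.

BoundedBy : ℕ → (ℂ → ℂ) → ℚ → Set
BoundedBy R H q = ∀ z → Bounded z (ℕ→ℚ R) → Bounded (H z) q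

Estimate : ℕ → (ℂ → ℂ) → (ℂ → ℂ) → ℚ → Set
Estimate R H h q = ∀ {d} a b t → Bounded a (ℕ→ℚ R) → Bounded b (ℕ→ℚ R) → Bounded t (ℕ→ℚ R) →
  Bounded (a - t) d → Bounded (b - t) d →
  H b - H a - h t * (b - a) ≲ λ j → q ℚ.* d ℚ.* norm (b - a) j

-- Both constants are uniform on the ball of radius `R`. A single `size` serves for the function and
-- its derivative, since the product rule mixes the two.
Differentiable : ℕ → (ℂ → ℂ) → (ℂ → ℂ) → Set
Differentiable R H h = ∃[ size ] ∃[ rate ]
  (0ℚ ℚ.≤ size × 0ℚ ℚ.≤ rate × BoundedBy R H size × BoundedBy R h size × Estimate R H h rate)

module Derivative (R : ℕ) (H h : ℂ → ℂ) (D : Differentiable R H h) where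

  size rate : ℚ
  size = proj₁ D
  rate = proj₁ (proj₂ D)

  0≤size : 0ℚ ℚ.≤ size
  0≤size = proj₁ (proj₂ (proj₂ D))

  0≤rate : 0ℚ ℚ.≤ rate
  0≤rate = proj₁ (proj₂ (proj₂ (proj₂ D)))

  value≤size : BoundedBy R H size
  value≤size = proj₁ (proj₂ (proj₂ (proj₂ (proj₂ D))))

  derivative≤size : BoundedBy R h size
  derivative≤size = proj₁ (proj₂ (proj₂ (proj₂ (proj₂ (proj₂ D)))))

  estimate : Estimate R H h rate
  estimate = proj₂ (proj₂ (proj₂ (proj₂ (proj₂ (proj₂ D)))))

  lipschitzConstant : ℚ
  lipschitzConstant = rate ℚ.* (ℕ→ℚ R ℚ.+ ℕ→ℚ R) ℚ.+ size

  0≤lipschitzConstant : 0ℚ ℚ.≤ lipschitzConstant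
  0≤lipschitzConstant = 0≤+ {rate ℚ.* (ℕ→ℚ R ℚ.+ ℕ→ℚ R)} {size}
    (0≤* {rate} {ℕ→ℚ R ℚ.+ ℕ→ℚ R} 0≤rate (0≤+ {ℕ→ℚ R} {ℕ→ℚ R} (0≤nat R) (0≤nat R))) 0≤size

  -- The estimate at t = a with the crude distance d = 2R, which any two points of the ball satisfy,
  -- plus the bound on h(a)(b - a).
  lipschitz : ∀ a b → Bounded a (ℕ→ℚ R) → Bounded b (ℕ→ℚ R) → H b - H a ≲ λ j → lipschitzConstant ℚ.* norm (b - a) j
  lipschitz a b a≤R b≤R = ≗-≲ {e₁ + e₂} {H b - H a}
    (λ j → solve𝔾 3 (λ x y z → y :⊝ x :⊝ z :⊕ z :≡ y :⊝ x) refl (at (H a) j) (at (H b) j) (at e₂ j))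
    (≲-mono {e₁ + e₂} {λ j → rate ℚ.* (ℕ→ℚ R ℚ.+ ℕ→ℚ R) ℚ.* norm (b - a) j ℚ.+ size ℚ.* norm (b - a) j}
      (always λ j → ℚₚ.≤-reflexive (sym (ℚₚ.*-distribʳ-+ (norm (b - a) j) (rate ℚ.* (ℕ→ℚ R ℚ.+ ℕ→ℚ R)) size)))
      (≲-+ {e₁} {e₂}
        (estimate {ρ ℚ.+ ρ} a b a a≤R b≤R a≤R (bounded-- a a {ρ} {ρ} a≤R a≤R) (bounded-- b a {ρ} {ρ} b≤R a≤R))
        (bounded-≲ {e₂} {λ j → size ℚ.* norm (b - a) j}
          (ev-map (λ j (p : norm (h a) j ℚ.≤ size) → norm-*-≤ (h a) (b - a) j p ℚₚ.≤-refl) (derivative≤size a a≤R)))))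
    where
    ρ = ℕ→ℚ R
    e₁ e₂ : ℂ
    e₁ = H b - H a - h a * (b - a)
    e₂ = h a * (b - a)

  -- In effect H respects `_≈_` on the ball, which is not automatic for a map on representatives. It
  -- is needed because the end nodes of a partition equal 0 and 1 only up to `_≈ᵣ_`.
  continuous : ∀ a b → Bounded a (ℕ→ℚ R) → Bounded b (ℕ→ℚ R) → b - a ≲ (λ _ → 0ℚ) → H b - H a ≲ λ _ → 0ℚ
  continuous a b a≤R b≤R b-a≲0 = ≲-relax {H b - H a}
    (λ ε 0<ε →
      let L = lipschitzConstant
          (δ , 0<δ , Lδ≤ε) = shrink-nonNeg L ε 0≤lipschitzConstant 0<ε
      in ev-map
        (λ j p → ℚₚ.≤-trans
          (ℚₚ.*-monoˡ-≤-nonNeg L {{ℚ.nonNegative 0≤lipschitzConstant}}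
            (ℚₚ.≤-trans p (ℚₚ.≤-reflexive (ℚₚ.+-identityˡ δ))))
          (ℚₚ.≤-trans Lδ≤ε (ℚₚ.≤-reflexive (sym (ℚₚ.+-identityˡ ε)))))
        (dominated b-a≲0 δ 0<δ))
    (lipschitz a b a≤R b≤R)

differentiable-cong : ∀ R H h k → (∀ t → h t ≗ k t) → Differentiable R H h → Differentiable R H k
differentiable-cong R H h k h≗k D =
  size , rate , 0≤size , 0≤rate , value≤size
  , (λ z z≤R → ≗-bounded (h z) (k z) (h≗k z) (derivative≤size z z≤R))
  , λ {d} a b t p q r s u → ≗-≲ {H b - H a - h t * (b - a)} {H b - H a - k t * (b - a)}
      (λ j → cong (λ y → at (H b - H a) j ⊕ (⊖ (y ⊗ at (b - a) j))) (h≗k t j)) (estimate {d} a b t p q r s u)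
  where open Derivative R H h D

differentiable-neg : ∀ R H h → Differentiable R H h → Differentiable R (λ z → H (- z)) (λ z → - h (- z))
differentiable-neg R H h D =
  size , rate , 0≤size , 0≤rate
  , (λ z z≤R → value≤size (- z) (bounded-neg z z≤R))
  , (λ z z≤R → bounded-neg (h (- z)) (derivative≤size (- z) (bounded-neg z z≤R)))
  , λ {d} a b t a≤R b≤R t≤R a-t≤d b-t≤d →
      ≗-≲ {H (- b) - H (- a) - h (- t) * (- b - - a)} {H (- b) - H (- a) - (- h (- t)) * (b - a)}
        (λ j → solve𝔾 5 (λ x y z a b → y :⊝ x :⊝ z :⊗ (:⊖ b :⊝ :⊖ a) :≡ y :⊝ x :⊝ (:⊖ z) :⊗ (b :⊝ a)) refl
          (at (H (- a)) j) (at (H (- b)) j) (at (h (- t)) j) (at a j) (at b j))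
        (≲-mono {H (- b) - H (- a) - h (- t) * (- b - - a)} {λ j → rate ℚ.* d ℚ.* norm (- b - - a) j}
          (always λ j → ℚₚ.≤-reflexive (cong (rate ℚ.* d ℚ.*_)
            (trans (norm-cong (- b - - a) (- (b - a)) j (neg-- a b j)) (norm-neg (b - a) j))))
          (estimate {d} (- a) (- b) (- t) (bounded-neg a a≤R) (bounded-neg b b≤R) (bounded-neg t t≤R)
            (≗-bounded (- (a - t)) (- a - - t) (λ j → sym (neg-- t a j)) (bounded-neg (a - t) a-t≤d))
            (≗-bounded (- (b - t)) (- b - - t) (λ j → sym (neg-- t b j)) (bounded-neg (b - t) b-t≤d))))
  where
  open Derivative R H h D

  neg-- : ∀ a b → - b - - a ≗ - (b - a)
  neg-- a b j = solve𝔾 2 (λ a b → :⊖ b :⊝ :⊖ a :≡ :⊖ (b :⊝ a)) refl (at a j) (at b j)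

module _ (R : ℕ) (H h G g : ℂ → ℂ) (DH : Differentiable R H h) (DG : Differentiable R G g) where

  private
    module 𝐇 = Derivative R H h DH
    module 𝐆 = Derivative R G g DG
    SH = 𝐇.size
    SG = 𝐆.size
    RH = 𝐇.rate
    RG = 𝐆.rate
    LH = 𝐇.lipschitzConstant
    LG = 𝐆.lipschitzConstant
    0≤LH = 𝐇.0≤lipschitzConstant
    0≤LG = 𝐆.0≤lipschitzConstant
    0≤SHSG = 0≤* {SH} {SG} 𝐇.0≤size 𝐆.0≤size

  -- The usual splitting H(b)(G(b) - G(a)) + (H(b) - H(a))G(a) leaves the derivatives multiplied by
  -- H(b) and G(a) instead of H(t) and G(t). Exchanging these costs `e₃` and `e₄`, where the
  -- Lipschitz bounds supply the factor d.
  estimate-* : ∀ {d} a b t → Bounded a (ℕ→ℚ R) → Bounded b (ℕ→ℚ R) → Bounded t (ℕ→ℚ R) →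
    Bounded (a - t) d → Bounded (b - t) d →
    H b * G b - H a * G a - (h t * G t + H t * g t) * (b - a)
      ≲ λ j → (RG ℚ.* SH ℚ.+ RH ℚ.* SG ℚ.+ (LH ℚ.* SG ℚ.+ LG ℚ.* SH)) ℚ.* d ℚ.* norm (b - a) j
  estimate-* {d} a b t a≤R b≤R t≤R a-t≤d b-t≤d = ≗-≲ {e₁ + e₂ + (e₃ + e₄)}
    (λ j → solve𝔾 10 (λ Ha Hb Ht Ga Gb Gt h g a b → let c = b :⊝ a in
        (Gb :⊝ Ga :⊝ g :⊗ c) :⊗ Hb :⊕ (Hb :⊝ Ha :⊝ h :⊗ c) :⊗ Ga :⊕ ((Hb :⊝ Ht) :⊗ (g :⊗ c) :⊕ (Ga :⊝ Gt) :⊗ (h :⊗ c))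
        :≡ Hb :⊗ Gb :⊝ Ha :⊗ Ga :⊝ (h :⊗ Gt :⊕ Ht :⊗ g) :⊗ c) refl
      (at (H a) j) (at (H b) j) (at (H t) j) (at (G a) j) (at (G b) j) (at (G t) j) (at (h t) j) (at (g t) j) (at a j) (at b j))
    (≲-mono {e₁ + e₂ + (e₃ + e₄)}
      (always λ j → ℚₚ.≤-reflexive
        (solve 8 (λ RH RG SH SG LH LG d n →
            RG :* d :* n :* SH :+ RH :* d :* n :* SG :+ (LH :* d :* (SG :* n) :+ LG :* d :* (SH :* n))
            := (RG :* SH :+ RH :* SG :+ (LH :* SG :+ LG :* SH)) :* d :* n) refl
          RH RG SH SG LH LG d (n j)))
      (≲-+ {e₁ + e₂} {e₃ + e₄} (≲-+ {e₁} {e₂} bound₁ bound₂) (≲-+ {e₃} {e₄} bound₃ bound₄)))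
    where
    n : ℕ → ℚ
    n j = norm (b - a) j

    e₁ e₂ e₃ e₄ : ℂ
    e₁ = (G b - G a - g t * (b - a)) * H b
    e₂ = (H b - H a - h t * (b - a)) * G a
    e₃ = (H b - H t) * (g t * (b - a))
    e₄ = (G a - G t) * (h t * (b - a))

    -- `d` dominates a norm at some stage, which fixes its sign.
    0≤d : 0ℚ ℚ.≤ d
    0≤d = let (N , p) = a-t≤d in ℚₚ.≤-trans (0≤norm (a - t) N) (p N ℕₚ.≤-refl)

    bound₁ : e₁ ≲ λ j → RG ℚ.* d ℚ.* n j ℚ.* SH
    bound₁ = ≲-*-bounded {G b - G a - g t * (b - a)} {H b} (λ j → 0≤* (0≤* 𝐆.0≤rate 0≤d) (0≤norm (b - a) j))
      (𝐆.estimate a b t a≤R b≤R t≤R a-t≤d b-t≤d) (𝐇.value≤size b b≤R)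

    bound₂ : e₂ ≲ λ j → RH ℚ.* d ℚ.* n j ℚ.* SG
    bound₂ = ≲-*-bounded {H b - H a - h t * (b - a)} {G a} (λ j → 0≤* (0≤* 𝐇.0≤rate 0≤d) (0≤norm (b - a) j))
      (𝐇.estimate a b t a≤R b≤R t≤R a-t≤d b-t≤d) (𝐆.value≤size a a≤R)

    bound₃ : e₃ ≲ λ j → LH ℚ.* d ℚ.* (SG ℚ.* n j)
    bound₃ = ≲-*-bounded {H b - H t} {g t * (b - a)} (λ _ → 0≤* 0≤LH 0≤d)
      (≲-mono {H b - H t} (ev-map (λ j (p : norm (b - t) j ℚ.≤ d) → ℚₚ.*-monoˡ-≤-nonNeg LH {{ℚ.nonNegative 0≤LH}} p) b-t≤d) (𝐇.lipschitz t b t≤R b≤R))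
      (ev-map (λ j p → norm-*-≤ (g t) (b - a) j p ℚₚ.≤-refl) (𝐆.derivative≤size t t≤R))

    bound₄ : e₄ ≲ λ j → LG ℚ.* d ℚ.* (SH ℚ.* n j)
    bound₄ = ≲-*-bounded {G a - G t} {h t * (b - a)} (λ _ → 0≤* 0≤LG 0≤d)
      (≲-mono {G a - G t} (ev-map (λ j (p : norm (a - t) j ℚ.≤ d) → ℚₚ.*-monoˡ-≤-nonNeg LG {{ℚ.nonNegative 0≤LG}} p) a-t≤d) (𝐆.lipschitz t a t≤R a≤R))
      (ev-map (λ j p → norm-*-≤ (h t) (b - a) j p ℚₚ.≤-refl) (𝐇.derivative≤size t t≤R))

  differentiable-* : Differentiable R (λ z → H z * G z) (λ z → h z * G z + H z * g z)
  differentiable-* =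
    SH ℚ.* SG ℚ.+ SH ℚ.* SG
    , RG ℚ.* SH ℚ.+ RH ℚ.* SG ℚ.+ (LH ℚ.* SG ℚ.+ LG ℚ.* SH)
    , 0≤+ {SH ℚ.* SG} {SH ℚ.* SG} 0≤SHSG 0≤SHSG
    , 0≤+ {RG ℚ.* SH ℚ.+ RH ℚ.* SG} {LH ℚ.* SG ℚ.+ LG ℚ.* SH}
        (0≤+ {RG ℚ.* SH} {RH ℚ.* SG} (0≤* {RG} {SH} 𝐆.0≤rate 𝐇.0≤size) (0≤* {RH} {SG} 𝐇.0≤rate 𝐆.0≤size))
        (0≤+ {LH ℚ.* SG} {LG ℚ.* SH} (0≤* {LH} {SG} 0≤LH 𝐆.0≤size) (0≤* {LG} {SH} 0≤LG 𝐇.0≤size))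
    , (λ z z≤R → bounded-weaken (H z * G z) (≤-+ʳ (SH ℚ.* SG) 0≤SHSG)
        (bounded-* (H z) (G z) {SH} {SG} (𝐇.value≤size z z≤R) (𝐆.value≤size z z≤R)))
    , (λ z z≤R → bounded-+ (h z * G z) (H z * g z) {SH ℚ.* SG} {SH ℚ.* SG}
        (bounded-* (h z) (G z) {SH} {SG} (𝐇.derivative≤size z z≤R) (𝐆.value≤size z z≤R))
        (bounded-* (H z) (g z) {SH} {SG} (𝐇.value≤size z z≤R) (𝐆.derivative≤size z z≤R)))
    , estimate-*

-- The fundamental theorem of calculus for tagged partitions.

≤ᵣ-trans : ∀ x y z → x ≤ᵣ y → y ≤ᵣ z → x ≤ᵣ z
≤ᵣ-trans x y z x≤y y≤z ε 0<ε = ev-zip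
  (λ j (p : approx x j ℚ.≤ approx y j ℚ.+ ½ ℚ.* ε) (q : approx y j ℚ.≤ approx z j ℚ.+ ½ ℚ.* ε) →
    ℚₚ.≤-trans p (ℚₚ.≤-trans (ℚₚ.+-monoˡ-≤ (½ ℚ.* ε) q)
      (ℚₚ.≤-reflexive (solve 2 (λ z ε → z :+ con ½ :* ε :+ con ½ :* ε := z :+ ε) refl (approx z j) ε))))
  (x≤y (½ ℚ.* ε) (0<½* 0<ε)) (y≤z (½ ℚ.* ε) (0<½* 0<ε))

∣∣≤ : ∀ {p q} → p ℚ.≤ q → ℚ.- p ℚ.≤ q → ℚ.∣ p ∣ ℚ.≤ q
∣∣≤ {p} {q} p≤q -p≤q with ℚₚ.∣p∣≡p∨∣p∣≡-p p
... | inj₁ eq = subst (ℚ._≤ q) (sym eq) p≤q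
... | inj₂ eq = subst (ℚ._≤ q) (sym eq) -p≤q

norm-ℝ : ∀ r j → norm (ℝ→ℂ r) j ≡ ℚ.∣ approx r j ∣
norm-ℝ r j = ℚₚ.+-identityʳ ℚ.∣ approx r j ∣

ℝ→ℂ-- : ∀ u v x → ℝ→ℂ (u -ᵣ v) * x ≗ ℝ→ℂ u * x - ℝ→ℂ v * x
ℝ→ℂ-- u v x j = solve𝔾 3 (λ u v x → (u :⊝ v) :⊗ x :≡ u :⊗ x :⊝ v :⊗ x) refl (at (ℝ→ℂ u) j) (at (ℝ→ℂ v) j) (at x j)

-- At any finite stage the approximations satisfy the inequalities between nodes and tags only up to
-- an error, hence 2δ in place of the mesh δ.
step≤2δ : ∀ u v w {δ} → 0ℚ ℚ.< δ → u ≤ᵣ v → v ≤ᵣ w → w -ᵣ u ≤ᵣ ℚ→ℝ δ →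
  Eventually λ j → ℚ.∣ approx u j ℚ.- approx v j ∣ ℚ.≤ δ ℚ.+ δ × ℚ.∣ approx w j ℚ.- approx v j ∣ ℚ.≤ δ ℚ.+ δ
step≤2δ u v w {δ} 0<δ u≤v v≤w w-u≤δ = ev-map
  (λ j (p , q , r) → bound (approx u j) (approx v j) (approx w j) p q r)
  (ev-× (u≤v (½ ℚ.* δ) (0<½* 0<δ)) (ev-× (v≤w (½ ℚ.* δ) (0<½* 0<δ)) (w-u≤δ (½ ℚ.* δ) (0<½* 0<δ))))
  where
  −-≤ : ∀ {a b e} → a ℚ.≤ b ℚ.+ e → a ℚ.- b ℚ.≤ e
  −-≤ {a} {b} {e} p = ℚₚ.≤-trans (ℚₚ.+-monoˡ-≤ (ℚ.- b) p) (ℚₚ.≤-reflexive (solve 2 (λ b e → b :+ e :- b := e) refl b e))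

  three-halves : δ ℚ.+ ½ ℚ.* δ ℚ.+ ½ ℚ.* δ ≡ δ ℚ.+ δ
  three-halves = solve 1 (λ δ → δ :+ con ½ :* δ :+ con ½ :* δ := δ :+ δ) refl δ

  ½δ≤ : ½ ℚ.* δ ℚ.≤ δ ℚ.+ δ
  ½δ≤ = ℚₚ.≤-trans (ℚₚ.≤-trans (≤-+ʳ (½ ℚ.* δ) (ℚₚ.<⇒≤ (0<½* 0<δ))) (ℚₚ.≤-reflexive (halves δ))) (≤-+ʳ δ (ℚₚ.<⇒≤ 0<δ))

  bound : ∀ a b c → a ℚ.≤ b ℚ.+ ½ ℚ.* δ → b ℚ.≤ c ℚ.+ ½ ℚ.* δ → c ℚ.- a ℚ.≤ δ ℚ.+ ½ ℚ.* δ →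
    ℚ.∣ a ℚ.- b ∣ ℚ.≤ δ ℚ.+ δ × ℚ.∣ c ℚ.- b ∣ ℚ.≤ δ ℚ.+ δ
  bound a b c p q r =
      ∣∣≤ (ℚₚ.≤-trans (−-≤ {a} {b} p) ½δ≤) (subst₂ ℚ._≤_
        (solve 3 (λ a b c → c :- a :+ (b :- c) := :- (a :- b)) refl a b c) three-halves
        (ℚₚ.+-mono-≤ r (−-≤ {b} {c} q)))
    , ∣∣≤ (subst₂ ℚ._≤_
        (solve 3 (λ a b c → c :- a :+ (a :- b) := c :- b) refl a b c) three-halves
        (ℚₚ.+-mono-≤ r (−-≤ {a} {b} p)))
      (subst (ℚ._≤ δ ℚ.+ δ) (solve 2 (λ b c → b :- c := :- (c :- b)) refl b c) (ℚₚ.≤-trans (−-≤ {b} {c} q) ½δ≤))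

-- Approximations to a point of [0, 1] may leave the interval, and slack 1 on either side keeps them
-- within absolute value 2. This is why the segment to x, with |x| ≤ K, is treated in the ball of
-- radius 2K.
unit≤2 : ∀ r → ℚ→ℝ 0ℚ ≤ᵣ r → r ≤ᵣ ℚ→ℝ 1ℚ → Eventually λ j → ℚ.∣ approx r j ∣ ℚ.≤ ℕ→ℚ 2
unit≤2 r 0≤r r≤1 = ev-zip
  (λ j (p : 0ℚ ℚ.≤ approx r j ℚ.+ 1ℚ) (q : approx r j ℚ.≤ 1ℚ ℚ.+ 1ℚ) →
    ∣∣≤ q (ℚₚ.≤-trans (subst₂ ℚ._≤_
        (ℚₚ.+-identityˡ (ℚ.- approx r j)) (solve 1 (λ r → r :+ con 1ℚ :- r := con 1ℚ) refl (approx r j))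
        (ℚₚ.+-monoˡ-≤ (ℚ.- approx r j) p))
      (nat-mono {1} {2} (s≤s z≤n))))
  (0≤r 1ℚ 0<1) (r≤1 1ℚ 0<1)

-- Consecutive nodes are ordered only up to ε at a given stage. Replacing the absolute value of
-- their difference by the signed difference at cost 2ε makes the step bounds telescope.
∣-∣≤ : ∀ a b {ε} → a ℚ.≤ b ℚ.+ ε → 0ℚ ℚ.≤ ε → ℚ.∣ b ℚ.- a ∣ ℚ.≤ (b ℚ.- a) ℚ.+ (ε ℚ.+ ε)
∣-∣≤ a b {ε} a≤b+ε 0≤ε = ∣∣≤ (≤-+ʳ (b ℚ.- a) (0≤+ {ε} {ε} 0≤ε 0≤ε))
  (subst₂ ℚ._≤_
    (solve 2 (λ a b → a :+ a :- (a :+ b) := :- (b :- a)) refl a b)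
    (solve 3 (λ a b ε → b :+ ε :+ (b :+ ε) :- (a :+ b) := b :- a :+ (ε :+ ε)) refl a b ε)
    (ℚₚ.+-monoˡ-≤ (ℚ.- (a ℚ.+ b)) (ℚₚ.+-mono-≤ a≤b+ε a≤b+ε)))

≈ᵣ⇒≤ᵣ : ∀ x y → x ≈ᵣ y → x ≤ᵣ y
≈ᵣ⇒≤ᵣ x y x≈y ε 0<ε = ev-map
  (λ j (p : ℚ.∣ approx x j ℚ.- approx y j ∣ ℚ.≤ ε) → subst (ℚ._≤ approx y j ℚ.+ ε)
    (solve 2 (λ x y → y :+ (x :- y) := x) refl (approx x j) (approx y j))
    (ℚₚ.+-monoʳ-≤ (approx y j) (ℚₚ.≤-trans (≤-∣∣ (approx x j ℚ.- approx y j)) p)))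
  (x≈y ε 0<ε)

≈ᵣ-sym : ∀ x y → x ≈ᵣ y → y ≈ᵣ x
≈ᵣ-sym x y x≈y ε 0<ε = ev-map (λ j → subst (ℚ._≤ ε) (∣-∣-swap (approx x j) (approx y j))) (x≈y ε 0<ε)

≈ᵣ-≲ : ∀ u v x → u ≈ᵣ v → ℝ→ℂ (u -ᵣ v) * x ≲ λ _ → 0ℚ
≈ᵣ-≲ u v x u≈v = ≲-mono {ℝ→ℂ (u -ᵣ v) * x} {λ j → 0ℚ ℚ.* norm x j} (always λ j → ℚₚ.≤-reflexive (ℚₚ.*-zeroˡ (norm x j)))
  (≲-* {ℝ→ℂ (u -ᵣ v)} {x} {λ _ → 0ℚ} (mk≲ λ ε 0<ε →
    ev-map (λ j → subst₂ ℚ._≤_ (sym (norm-ℝ (u -ᵣ v) j)) (sym (ℚₚ.+-identityˡ ε))) (u≈v ε 0<ε)))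

module _ (H h : ℂ → ℂ) (x : ℂ) (K : ℕ) (x≤K : Bounded x (ℕ→ℚ K)) (D : Differentiable (2 ℕ.* K) H h) where

  private
    module 𝐇 = Derivative (2 ℕ.* K) H h D

    point : ℝ → ℂ
    point r = ℝ→ℂ r * x

    κ : ℚ
    κ = ℕ→ℚ K

    difference≤ : ∀ u v {q} → Eventually (λ j → ℚ.∣ approx u j ℚ.- approx v j ∣ ℚ.≤ q) → Bounded (point u - point v) (q ℚ.* κ)
    difference≤ u v {q} h = ≗-bounded (ℝ→ℂ (u -ᵣ v) * x) (point u - point v) (ℝ→ℂ-- u v x)
      (bounded-* (ℝ→ℂ (u -ᵣ v)) x {q} {κ} (bounded-ℝ (u -ᵣ v) h) x≤K)

    point≤ : ∀ r → ℚ→ℝ 0ℚ ≤ᵣ r → r ≤ᵣ ℚ→ℝ 1ℚ → Bounded (point r) (ℕ→ℚ (2 ℕ.* K))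
    point≤ r 0≤r r≤1 = bounded-weaken (point r) (ℚₚ.≤-reflexive (sym (nat-* 2 K)))
      (bounded-* (ℝ→ℂ r) x {ℕ→ℚ 2} {κ} (bounded-ℝ r (unit≤2 r 0≤r r≤1)) x≤K)

  module _ {δ : ℚ} (0<δ : 0ℚ ℚ.< δ) (P : TaggedPartition δ) where

    open TaggedPartition P

    private
      d c : ℚ
      -- `d` bounds the distance from tag point to node points after scaling by x; `c` is the
      -- resulting error per unit of parameter length.
      d = (δ ℚ.+ δ) ℚ.* κ
      c = 𝐇.rate ℚ.* d ℚ.* κ

      0≤d : 0ℚ ℚ.≤ d
      0≤d = 0≤* {δ ℚ.+ δ} {κ} (0≤+ {δ} {δ} (ℚₚ.<⇒≤ 0<δ) (ℚₚ.<⇒≤ 0<δ)) (0≤nat K)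

      0≤rd : 0ℚ ℚ.≤ 𝐇.rate ℚ.* d
      0≤rd = 0≤* {𝐇.rate} {d} 𝐇.0≤rate 0≤d

      0≤c : 0ℚ ℚ.≤ c
      0≤c = 0≤* {𝐇.rate ℚ.* d} {κ} 0≤rd (0≤nat K)

      node≤node : ∀ i → i ℕ.< size → node i ≤ᵣ node (suc i)
      node≤node i i<n = ≤ᵣ-trans (node i) (tag i) (node (suc i)) (node≤tag i i<n) (tag≤node i i<n)

      0≤node : ∀ i → i ℕ.≤ size → ℚ→ℝ 0ℚ ≤ᵣ node i
      0≤node zero _ = ≈ᵣ⇒≤ᵣ (ℚ→ℝ 0ℚ) (node 0) (≈ᵣ-sym (node 0) (ℚ→ℝ 0ℚ) first)
      0≤node (suc i) i<n = ≤ᵣ-trans (ℚ→ℝ 0ℚ) (node i) (node (suc i)) (0≤node i (ℕₚ.<⇒≤ i<n)) (node≤node i i<n)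

      -- Induction on the distance `e` to the last node, the only one known to be 1.
      node≤1 : ∀ e i → e ℕ.+ i ≡ size → node i ≤ᵣ ℚ→ℝ 1ℚ
      node≤1 zero i eq = subst (λ k → node k ≤ᵣ ℚ→ℝ 1ℚ) (sym eq) (≈ᵣ⇒≤ᵣ (node size) (ℚ→ℝ 1ℚ) last)
      node≤1 (suc e) i eq = ≤ᵣ-trans (node i) (node (suc i)) (ℚ→ℝ 1ℚ)
        (node≤node i (subst (suc i ℕ.≤_) eq (s≤s (ℕₚ.m≤n+m i e))))
        (node≤1 e (suc i) (trans (ℕₚ.+-suc e i) eq))

      node≤1′ : ∀ i → i ℕ.≤ size → node i ≤ᵣ ℚ→ℝ 1ℚ
      node≤1′ i i≤n = node≤1 (size ℕ.∸ i) i (ℕₚ.m∸n+n≡m i≤n)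

      node-point≤ : ∀ i → i ℕ.≤ size → Bounded (point (node i)) (ℕ→ℚ (2 ℕ.* K))
      node-point≤ i i≤n = point≤ (node i) (0≤node i i≤n) (node≤1′ i i≤n)

      tag-point≤ : ∀ i → i ℕ.< size → Bounded (point (tag i)) (ℕ→ℚ (2 ℕ.* K))
      tag-point≤ i i<n = point≤ (tag i)
        (≤ᵣ-trans (ℚ→ℝ 0ℚ) (node i) (tag i) (0≤node i (ℕₚ.<⇒≤ i<n)) (node≤tag i i<n))
        (≤ᵣ-trans (tag i) (node (suc i)) (ℚ→ℝ 1ℚ) (tag≤node i i<n) (node≤1′ (suc i) i<n))

      Δ : ℕ → ℕ → ℚ
      Δ i j = approx (node (suc i)) j ℚ.- approx (node i) j

      stepError : ℕ → ℂ
      stepError i = H (point (node (suc i))) - H (point (node i)) - h (point (tag i)) * (point (node (suc i)) - point (node i))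

      -- The bound uses the signed increment `Δ i j`, so summing over the partition gives c times
      -- (last node - first node), that is, c.
      stepError-≲ : ∀ i → i ℕ.< size → stepError i ≲ λ j → c ℚ.* Δ i j
      stepError-≲ i i<n = ≲-relax {stepError i}
        {λ j → 𝐇.rate ℚ.* d ℚ.* norm (point (node (suc i)) - point (node i)) j} {λ j → c ℚ.* Δ i j}
        (λ ε 0<ε →
          let (η , 0<η , cη≤) = shrink-nonNeg (c ℚ.+ c) ε (0≤+ {c} {c} 0≤c 0≤c) 0<ε
          in ev-map
            (λ j (p , q) → bound j 0<η cη≤ p q)
            (ev-× (node≤node i i<n η 0<η) x≤K))
        (𝐇.estimate {d} (point (node i)) (point (node (suc i))) (point (tag i))
          (node-point≤ i (ℕₚ.<⇒≤ i<n)) (node-point≤ (suc i) i<n) (tag-point≤ i i<n)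
          (difference≤ (node i) (tag i) (ev-map (λ _ → proj₁) steps))
          (difference≤ (node (suc i)) (tag i) (ev-map (λ _ → proj₂) steps)))
        where
        steps = step≤2δ (node i) (tag i) (node (suc i)) 0<δ (node≤tag i i<n) (tag≤node i i<n) (mesh i i<n)

        bound : ∀ {ε η} j → 0ℚ ℚ.< η → (c ℚ.+ c) ℚ.* η ℚ.≤ ε → approx (node i) j ℚ.≤ approx (node (suc i)) j ℚ.+ η →
          norm x j ℚ.≤ κ → 𝐇.rate ℚ.* d ℚ.* norm (point (node (suc i)) - point (node i)) j ℚ.≤ c ℚ.* Δ i j ℚ.+ ε
        bound {ε} {η} j 0<η cη≤ p q = ℚₚ.≤-trans
          (ℚₚ.*-monoˡ-≤-nonNeg (𝐇.rate ℚ.* d) {{ℚ.nonNegative 0≤rd}}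
            (ℚₚ.≤-trans
              (ℚₚ.≤-reflexive (sym (norm-cong (ℝ→ℂ (node (suc i) -ᵣ node i) * x) (point (node (suc i)) - point (node i)) j (ℝ→ℂ-- (node (suc i)) (node i) x j))))
              (norm-*-≤ (ℝ→ℂ (node (suc i) -ᵣ node i)) x j {Δ i j ℚ.+ (η ℚ.+ η)} {κ}
                (ℚₚ.≤-trans (ℚₚ.≤-reflexive (norm-ℝ (node (suc i) -ᵣ node i) j))
                  (∣-∣≤ (approx (node i) j) (approx (node (suc i)) j) p (ℚₚ.<⇒≤ 0<η)))
                q)))
          (ℚₚ.≤-trans
            (ℚₚ.≤-reflexive (solve 4 (λ r κ Δ η → r :* ((Δ :+ (η :+ η)) :* κ) := r :* κ :* Δ :+ (r :* κ :+ r :* κ) :* η) refl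
              (𝐇.rate ℚ.* d) κ (Δ i j) η))
            (ℚₚ.+-monoʳ-≤ (c ℚ.* Δ i j) cη≤))

      partial : ℕ → ℂ
      partial i = ∑ i (λ i → h (ℝ→ℂ (tag i) * x) * (ℝ→ℂ (node (suc i) -ᵣ node i) * x))

      defect : ℕ → ℂ
      defect i = H (point (node i)) - H (point (node zero)) - partial i

      defect-zero : defect zero ≲ λ j → c ℚ.* (approx (node zero) j ℚ.- approx (node zero) j)
      defect-zero = bounded-≲ {defect zero} (always λ j → ℚₚ.≤-reflexive (trans
        (norm-cong (defect zero) (ℚ→ℂ 0ℚ) j
          (solve𝔾 1 (λ y → y :⊝ y :⊝ con𝔾 (0ℚ , 0ℚ) :≡ con𝔾 (0ℚ , 0ℚ)) refl (at (H (point (node zero))) j)))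
        (solve 2 (λ c n → con 0ℚ := c :* (n :- n)) refl c (approx (node zero) j))))

      defect-suc : ∀ i → defect i + stepError i ≗ defect (suc i)
      defect-suc i j = trans
        (solve𝔾 6 (λ a b z s h d → a :⊝ z :⊝ s :⊕ (b :⊝ a :⊝ h :⊗ d) :≡ b :⊝ z :⊝ (s :⊕ h :⊗ d)) refl
          (at (H (point (node i))) j) (at (H (point (node (suc i)))) j) (at (H (point (node zero))) j)
          (at (partial i) j) (at (h (point (tag i))) j) (at (point (node (suc i)) - point (node i)) j))
        (cong (λ d → at (H (point (node (suc i))) - H (point (node zero))) j ⊕ (⊖ (at (partial i) j ⊕ at (h (point (tag i))) j ⊗ d)))
          (sym (ℝ→ℂ-- (node (suc i)) (node i) x j)))

      extend : ∀ i → defect i ≲ (λ j → c ℚ.* (approx (node i) j ℚ.- approx (node zero) j)) → stepError i ≲ (λ j → c ℚ.* Δ i j) →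
        defect (suc i) ≲ λ j → c ℚ.* (approx (node (suc i)) j ℚ.- approx (node zero) j)
      extend i p q = ≗-≲ {defect i + stepError i} {defect (suc i)} (defect-suc i)
        (≲-mono {defect i + stepError i}
          {λ j → c ℚ.* (approx (node i) j ℚ.- approx (node zero) j) ℚ.+ c ℚ.* Δ i j}
          (always λ j → ℚₚ.≤-reflexive (solve 4 (λ c s i z → c :* (i :- z) :+ c :* (s :- i) := c :* (s :- z)) refl
            c (approx (node (suc i)) j) (approx (node i) j) (approx (node zero) j)))
          (≲-+ {defect i} {stepError i} p q))
      defect-≲ : ∀ i → i ℕ.≤ size → defect i ≲ λ j → c ℚ.* (approx (node i) j ℚ.- approx (node zero) j)
      defect-≲ zero _ = defect-zero
      defect-≲ (suc i) i<n = extend i (defect-≲ i (ℕₚ.<⇒≤ i<n)) (stepError-≲ i i<n)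

      ball : ∀ z → Bounded z κ → Bounded z (ℕ→ℚ (2 ℕ.* K))
      ball z = bounded-weaken z (nat-mono (ℕₚ.m≤m+n K (K ℕ.+ zero)))

      total≤1 : ∀ ε → 0ℚ ℚ.< ε → Eventually λ j → approx (node size) j ℚ.- approx (node zero) j ℚ.≤ 1ℚ ℚ.+ ε
      total≤1 ε 0<ε = ev-zip
        (λ j p q → bound (approx (node size) j) (approx (node zero) j) p q)
        (≈ᵣ⇒≤ᵣ (node size) (ℚ→ℝ 1ℚ) last (½ ℚ.* ε) (0<½* 0<ε))
        (≈ᵣ⇒≤ᵣ (ℚ→ℝ 0ℚ) (node zero) (≈ᵣ-sym (node zero) (ℚ→ℝ 0ℚ) first) (½ ℚ.* ε) (0<½* 0<ε))
        where
        bound : ∀ s z → s ℚ.≤ 1ℚ ℚ.+ ½ ℚ.* ε → 0ℚ ℚ.≤ z ℚ.+ ½ ℚ.* ε → s ℚ.- z ℚ.≤ 1ℚ ℚ.+ ε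
        bound s z p q = subst₂ ℚ._≤_
          (solve 2 (λ s z → s :+ con 0ℚ :- z := s :- z) refl s z)
          (solve 2 (λ z ε → con 1ℚ :+ con ½ :* ε :+ (z :+ con ½ :* ε) :- z := con 1ℚ :+ ε) refl z ε)
          (ℚₚ.+-monoˡ-≤ (ℚ.- z) (ℚₚ.+-mono-≤ p q))

      defect-size : defect size ≲ λ _ → c
      defect-size = ≲-relax {defect size}
        {λ j → c ℚ.* (approx (node size) j ℚ.- approx (node zero) j)} {λ _ → c}
        (λ ε 0<ε →
          let (η , 0<η , cη≤ε) = shrink-nonNeg c ε 0≤c 0<ε
          in ev-map (λ j p → ℚₚ.≤-trans (ℚₚ.*-monoˡ-≤-nonNeg c {{ℚ.nonNegative 0≤c}} p)
               (subst (ℚ._≤ c ℚ.+ ε) (solve 2 (λ c η → c :+ c :* η := c :* (con 1ℚ :+ η)) refl c η) (ℚₚ.+-monoʳ-≤ c cη≤ε)))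
             (total≤1 η 0<η))
        (defect-≲ size ℕₚ.≤-refl)

      size-point≲ : point (node size) - x ≲ λ _ → 0ℚ
      size-point≲ = ≗-≲ {ℝ→ℂ (node size -ᵣ ℚ→ℝ 1ℚ) * x} {point (node size) - x}
        (λ j → solve𝔾 2 (λ s x → (s :⊝ con𝔾 (1ℚ , 0ℚ)) :⊗ x :≡ s :⊗ x :⊝ x) refl (at (ℝ→ℂ (node size)) j) (at x j))
        (≈ᵣ-≲ (node size) (ℚ→ℝ 1ℚ) x last)

      zero-point≲ : ℚ→ℂ 0ℚ - point (node zero) ≲ λ _ → 0ℚ
      zero-point≲ = ≗-≲ {ℝ→ℂ (ℚ→ℝ 0ℚ -ᵣ node zero) * x} {ℚ→ℂ 0ℚ - point (node zero)}
        (λ j → solve𝔾 2 (λ s x → (con𝔾 (0ℚ , 0ℚ) :⊝ s) :⊗ x :≡ con𝔾 (0ℚ , 0ℚ) :⊝ s :⊗ x) refl (at (ℝ→ℂ (node zero)) j) (at x j))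
        (≈ᵣ-≲ (ℚ→ℝ 0ℚ) (node zero) x (≈ᵣ-sym (node zero) (ℚ→ℝ 0ℚ) first))

      e₁ e₂ : ℂ
      e₁ = H (point (node size)) - H x
      e₂ = H (ℚ→ℂ 0ℚ) - H (point (node zero))

      endpoints : e₁ + e₂ ≲ λ _ → 0ℚ ℚ.+ 0ℚ
      endpoints = ≲-+ {e₁} {e₂}
        (𝐇.continuous x (point (node size)) (ball x x≤K) (node-point≤ size ℕₚ.≤-refl) size-point≲)
        (𝐇.continuous (point (node zero)) (ℚ→ℂ 0ℚ) (node-point≤ zero z≤n)
          (bounded-weaken (ℚ→ℂ 0ℚ) (0≤nat (2 ℕ.* K)) (bounded-ℚ {0ℚ} ℚₚ.≤-refl)) zero-point≲)

    riemannSum-≲ : riemannSum h x P - (H x - H (ℚ→ℂ 0ℚ)) ≲ λ _ → c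
    riemannSum-≲ = ≗-≲ { - defect size + (e₁ + e₂)} {riemannSum h x P - (H x - H (ℚ→ℂ 0ℚ))}
      (λ j → solve𝔾 5 (λ n z x o s → :⊖ (n :⊝ z :⊝ s) :⊕ (n :⊝ x :⊕ (o :⊝ z)) :≡ s :⊝ (x :⊝ o)) refl
        (at (H (point (node size))) j) (at (H (point (node zero))) j) (at (H x) j) (at (H (ℚ→ℂ 0ℚ)) j) (at (partial size) j))
      (≲-mono { - defect size + (e₁ + e₂)} {λ _ → c ℚ.+ (0ℚ ℚ.+ 0ℚ)} {λ _ → c} (always λ _ → ℚₚ.≤-reflexive (ℚₚ.+-identityʳ c))
        (≲-+ { - defect size} {e₁ + e₂} (≲-neg {defect size} defect-size) endpoints))

  -- At mesh δ the total error is rate · (2δκ) · κ, linear in δ; the coefficient of δ is what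
  -- `shrink-nonNeg` is applied to.
  integral : IsIntegral h x (H x - H (ℚ→ℂ 0ℚ))
  integral ε 0<ε =
    let (δ , 0<δ , le) = shrink-nonNeg (𝐇.rate ℚ.* (κ ℚ.+ κ) ℚ.* κ) ε
          (0≤* {𝐇.rate ℚ.* (κ ℚ.+ κ)} {κ} (0≤* {𝐇.rate} {κ ℚ.+ κ} 𝐇.0≤rate (0≤+ {κ} {κ} (0≤nat K) (0≤nat K))) (0≤nat K)) 0<ε
    in δ , 0<δ , λ P → ≲⇒≤ᵣ (riemannSum h x P - (H x - H (ℚ→ℂ 0ℚ)))
      (≲-mono {riemannSum h x P - (H x - H (ℚ→ℂ 0ℚ))}
        {λ _ → 𝐇.rate ℚ.* ((δ ℚ.+ δ) ℚ.* κ) ℚ.* κ} {λ _ → ε}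
        (always λ _ → subst (ℚ._≤ ε)
          (solve 3 (λ r κ δ → r :* (κ :+ κ) :* κ :* δ := r :* ((δ :+ δ) :* κ) :* κ) refl 𝐇.rate κ δ) le)
        (riemannSum-≲ 0<δ P))

-- Null differences, finite sums, and functions with zero derivative.

⟶-const : ∀ z → (λ _ → z) ⟶ z
⟶-const z ε 0<ε = always λ _ → ≲⇒≤ᵣ (z - z) (≗-≲ {ℚ→ℂ 0ℚ} {z - z}
  (λ j → solve𝔾 1 (λ z → con𝔾 (0ℚ , 0ℚ) :≡ z :⊝ z) refl (at z j))
  (bounded-≲ {ℚ→ℂ 0ℚ} (always λ _ → ℚₚ.<⇒≤ 0<ε)))

≗0⇒≲ : ∀ z → z ≗ ℚ→ℂ 0ℚ → z ≲ λ _ → 0ℚ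
≗0⇒≲ z z≗0 = ≗-≲ {ℚ→ℂ 0ℚ} {z} (λ j → sym (z≗0 j)) (bounded-≲ {ℚ→ℂ 0ℚ} (always λ _ → ℚₚ.≤-refl))

≲0-+ : ∀ z w → z ≲ (λ _ → 0ℚ) → w ≲ (λ _ → 0ℚ) → z + w ≲ λ _ → 0ℚ
≲0-+ z w p q = ≲-mono {z + w} {λ _ → 0ℚ ℚ.+ 0ℚ} (always λ _ → ℚₚ.≤-refl) (≲-+ {z} {w} p q)

≲0-* : ∀ z w → z ≲ (λ _ → 0ℚ) → z * w ≲ λ _ → 0ℚ
≲0-* z w p = ≲-mono {z * w} {λ j → 0ℚ ℚ.* norm w j} (always λ j → ℚₚ.≤-reflexive (ℚₚ.*-zeroˡ (norm w j))) (≲-* {z} {w} p)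

≲0⇒≈ : ∀ z w → z - w ≲ (λ _ → 0ℚ) → z ≈ w
≲0⇒≈ z w p =
    (λ ε 0<ε → ev-map (λ j q → ℚₚ.≤-trans (≤-+ʳ ℚ.∣ approx (re (z - w)) j ∣ (ℚₚ.0≤∣p∣ (approx (im (z - w)) j))) (bound ε j q)) (dominated p ε 0<ε))
  , (λ ε 0<ε → ev-map (λ j q → ℚₚ.≤-trans (≤-+ˡ ℚ.∣ approx (im (z - w)) j ∣ (ℚₚ.0≤∣p∣ (approx (re (z - w)) j))) (bound ε j q)) (dominated p ε 0<ε))
  where
  bound : ∀ ε j → norm (z - w) j ℚ.≤ 0ℚ ℚ.+ ε → norm (z - w) j ℚ.≤ ε
  bound ε j = subst (norm (z - w) j ℚ.≤_) (ℚₚ.+-identityˡ ε)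

∑-cong : ∀ (a b : ℕ → ℂ) → (∀ k → a k ≗ b k) → ∀ n → ∑ n a ≗ ∑ n b
∑-cong a b a≗b zero j = refl
∑-cong a b a≗b (suc n) j = cong₂ _⊕_ (∑-cong a b a≗b n j) (a≗b n j)

∑-zero : ∀ (a : ℕ → ℂ) → (∀ k → a k ≗ ℚ→ℂ 0ℚ) → ∀ n → ∑ n a ≗ ℚ→ℂ 0ℚ
∑-zero a a≗0 zero j = refl
∑-zero a a≗0 (suc n) j = cong₂ _⊕_ (∑-zero a a≗0 n j) (a≗0 n j)

∑-suc : ∀ (a : ℕ → ℂ) n → ∑ (suc n) a ≗ a zero + ∑ n (λ k → a (suc k))
∑-suc a zero j = solve𝔾 1 (λ a → con𝔾 (0ℚ , 0ℚ) :⊕ a :≡ a :⊕ con𝔾 (0ℚ , 0ℚ)) refl (at (a zero) j)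
∑-suc a (suc n) j = trans (cong (_⊕ at (a (suc n)) j) (∑-suc a n j))
  (solve𝔾 3 (λ a s b → a :⊕ s :⊕ b :≡ a :⊕ (s :⊕ b)) refl (at (a zero) j) (at (∑ n (λ k → a (suc k))) j) (at (a (suc n)) j))

∑-- : ∀ (a b : ℕ → ℂ) n → ∑ n a - ∑ n b ≗ ∑ n (λ k → a k - b k)
∑-- a b zero j = refl
∑-- a b (suc n) j = trans
  (solve𝔾 4 (λ A B a b → A :⊕ a :⊝ (B :⊕ b) :≡ A :⊝ B :⊕ (a :⊝ b)) refl (at (∑ n a) j) (at (∑ n b) j) (at (a n) j) (at (b n) j))
  (cong (_⊕ at (a n - b n) j) (∑-- a b n j))

≤⇒≤ᵣ : ∀ {p q} → p ℚ.≤ q → ℚ→ℝ p ≤ᵣ ℚ→ℝ q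
≤⇒≤ᵣ {p} {q} p≤q ε 0<ε = always λ _ → ℚₚ.≤-trans p≤q (≤-+ʳ q (ℚₚ.<⇒≤ 0<ε))

≡⇒≈ᵣ : ∀ {p q} → p ≡ q → ℚ→ℝ p ≈ᵣ ℚ→ℝ q
≡⇒≈ᵣ {p} {q} p≡q ε 0<ε = always λ _ → subst (ℚ._≤ ε)
  (sym (cong ℚ.∣_∣ (trans (cong (ℚ._- q) p≡q) (ℚₚ.+-inverseʳ q)))) (ℚₚ.<⇒≤ 0<ε)

-- `IsIntegral` speaks about all partitions of a given mesh; drawing a conclusion from it requires
-- at least one to exist.
uniformPartition : ∀ δ → 0ℚ ℚ.< δ → TaggedPartition δ
uniformPartition δ 0<δ = record
  { size = suc n
  ; node = node
  ; tag = node
  ; first = ≡⇒≈ᵣ (ℚₚ.*-zeroˡ r)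
  ; last = ≡⇒≈ᵣ (trans (ℚₚ.*-comm (ℕ→ℚ (suc n)) r) (1/suc*nat n))
  ; node≤tag = λ i _ → ≤⇒≤ᵣ {ℕ→ℚ i ℚ.* r} ℚₚ.≤-refl
  ; tag≤node = λ i _ → ≤⇒≤ᵣ {ℕ→ℚ i ℚ.* r} {ℕ→ℚ (suc i) ℚ.* r}
      (ℚₚ.*-monoʳ-≤-nonNeg r {{ℚ.nonNegative (0≤1/suc n)}} (nat-mono (ℕₚ.n≤1+n i)))
  ; mesh = λ i _ ε 0<ε → always λ _ → ℚₚ.≤-trans (ℚₚ.≤-reflexive (step i)) (ℚₚ.≤-trans r≤δ (≤-+ʳ δ (ℚₚ.<⇒≤ 0<ε))) }
  where
  n = proj₁ (archimedean δ 0<δ)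
  r = 1/suc n
  r≤δ = proj₂ (archimedean δ 0<δ)
  node : ℕ → ℝ
  node i = ℚ→ℝ (ℕ→ℚ i ℚ.* r)
  step : ∀ i → ℕ→ℚ (suc i) ℚ.* r ℚ.- ℕ→ℚ i ℚ.* r ≡ r
  step i = trans (cong (λ k → k ℚ.* r ℚ.- ℕ→ℚ i ℚ.* r) (nat-suc i))
    (solve 2 (λ i r → (con 1ℚ :+ i) :* r :- i :* r := r) refl (ℕ→ℚ i) r)

-- Every Riemann sum of the zero function is exactly 0, so one sufficiently fine partition already
-- puts H(x) - H(0) within ε of 0.
constant : ∀ H x K → Bounded x (ℕ→ℚ K) → Differentiable (2 ℕ.* K) H (λ _ → ℚ→ℂ 0ℚ) → H x - H (ℚ→ℂ 0ℚ) ≲ λ _ → 0ℚ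
constant H x K x≤K D = mk≲ λ ε 0<ε →
  let (δ , 0<δ , close) = integral H (λ _ → ℚ→ℂ 0ℚ) x K x≤K D (½ ℚ.* ε) (0<½* 0<ε)
      P = uniformPartition δ 0<δ
      S = riemannSum (λ _ → ℚ→ℂ 0ℚ) x P
  in ev-map
    (λ j (p : norm (S - (H x - H (ℚ→ℂ 0ℚ))) j ℚ.≤ ½ ℚ.* ε ℚ.+ ½ ℚ.* ε) → subst₂ ℚ._≤_
      (trans
        (norm-cong (S - (H x - H (ℚ→ℂ 0ℚ))) (- (H x - H (ℚ→ℂ 0ℚ))) j
          (trans (cong (λ s → s ⊕ (⊖ at (H x - H (ℚ→ℂ 0ℚ)) j)) (sum≗0 P j))
            (solve𝔾 1 (λ d → con𝔾 (0ℚ , 0ℚ) :⊝ d :≡ :⊖ d) refl (at (H x - H (ℚ→ℂ 0ℚ)) j))))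
        (norm-neg (H x - H (ℚ→ℂ 0ℚ)) j))
      (trans (halves ε) (sym (ℚₚ.+-identityˡ ε))) p)
    (close P (½ ℚ.* ε) (0<½* 0<ε))
  where
  sum≗0 : ∀ {δ} (P : TaggedPartition δ) → riemannSum (λ _ → ℚ→ℂ 0ℚ) x P ≗ ℚ→ℂ 0ℚ
  sum≗0 P = ∑-zero (λ i → ℚ→ℂ 0ℚ * (ℝ→ℂ (node (suc i) -ᵣ node i) * x))
    (λ i j → solve𝔾 1 (λ w → con𝔾 (0ℚ , 0ℚ) :⊗ w :≡ con𝔾 (0ℚ , 0ℚ)) refl (at (ℝ→ℂ (node (suc i) -ᵣ node i) * x) j)) size
    where open TaggedPartition P

-- The exponential is its own derivative.

expTerm : ℂ → ℕ → ℂ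
expTerm z k = z ^ k /! k

exp-limit : ∀ z → (λ m → ∑ m (expTerm z)) ⟶ exp z
exp-limit z = ∑∞-limit (expTerm z) (exp-summable z)

module _ (R : ℕ) where

  private
    one : ℕ → ℂ
    one _ = ℚ→ℂ 1ℚ

    one≤ : ∀ k → Bounded (one k) (ℕ→ℚ (1 ℕ.^ k))
    one≤ k = subst (λ n → Bounded (ℚ→ℂ 1ℚ) (ℕ→ℚ n)) (sym (ℕₚ.^-zeroˡ k)) (bounded-ℚ {1ℚ} 0≤1)

    series≗ : ∀ y n → series one y n ≗ ∑ n (expTerm y)
    series≗ y = ∑-cong (λ k → one k * y ^ k /! k) (expTerm y) λ k j →
      solve𝔾 2 (λ y f → con𝔾 (1ℚ , 0ℚ) :⊗ y :⊗ f :≡ y :⊗ f) refl (at (y ^ k) j) (at (ℚ→ℂ (1/! k)) j)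

    antiderivative≗ : ∀ y n → ℚ→ℂ 1ℚ * ℚ→ℂ (1/! zero) + antiderivative one y n ≗ ∑ (suc n) (expTerm y)
    antiderivative≗ y n j = trans
      (cong (at (expTerm y zero) j ⊕_) (∑-cong (λ k → one k * y ^ suc k /! suc k) (λ k → expTerm y (suc k))
        (λ k j → solve𝔾 2 (λ y f → con𝔾 (1ℚ , 0ℚ) :⊗ y :⊗ f :≡ y :⊗ f) refl (at (y ^ suc k) j) (at (ℚ→ℂ (1/! (suc k))) j)) n j))
      (sym (∑-suc (expTerm y) n j))

    module _ {d : ℚ} (a b t : ℂ) (a≤R : Bounded a (ℕ→ℚ R)) (b≤R : Bounded b (ℕ→ℚ R)) (t≤R : Bounded t (ℕ→ℚ R))
      (a-t≤d : Bounded (a - t) d) (b-t≤d : Bounded (b - t) d) where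

      approximant : ℕ → ℂ
      -- Differentiation lowers the degree, so the partial sum at t has one term fewer. The constant
      -- term, missing from `antiderivative one`, cancels between b and a.
      approximant m = ∑ (suc (suc m)) (expTerm b) - ∑ (suc (suc m)) (expTerm a) - ∑ (suc m) (expTerm t) * (b - a)

      approximant⟶ : approximant ⟶ exp b - exp a - exp t * (b - a)
      approximant⟶ = ⟶-- (λ m → ∑ (suc (suc m)) (expTerm b) - ∑ (suc (suc m)) (expTerm a)) (λ m → ∑ (suc m) (expTerm t) * (b - a))
        (exp b - exp a) (exp t * (b - a))
        (⟶-- (λ m → ∑ (suc (suc m)) (expTerm b)) (λ m → ∑ (suc (suc m)) (expTerm a)) (exp b) (exp a) (shift b) (shift a))
        (⟶-*ʳ (λ m → ∑ (suc m) (expTerm t)) (exp t) (b - a) (⟶-suc (λ m → ∑ m (expTerm t)) (exp t) (exp-limit t)))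
        where
        shift : ∀ y → (λ m → ∑ (suc (suc m)) (expTerm y)) ⟶ exp y
        shift y = ⟶-suc (λ m → ∑ (suc m) (expTerm y)) (exp y) (⟶-suc (λ m → ∑ m (expTerm y)) (exp y) (exp-limit y))

      remainder : ℕ → ℂ
      remainder = seriesRemainder one 1 one≤ R a b t a≤R b≤R t≤R a-t≤d b-t≤d

      remainder≗ : ∀ m → remainder (suc m) ≗ approximant m
      remainder≗ m j = trans
        (solve𝔾 5 (λ o B A T d → B :⊝ A :⊝ T :⊗ d :≡ (o :⊕ B) :⊝ (o :⊕ A) :⊝ T :⊗ d) refl
          (at (ℚ→ℂ 1ℚ * ℚ→ℂ (1/! zero)) j) (at (antiderivative one b (suc m)) j) (at (antiderivative one a (suc m)) j)
          (at (series one t (suc m)) j) (at (b - a) j))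
        (cong₂ (λ u v → u ⊕ (⊖ (v ⊗ at (b - a) j)))
          (cong₂ (λ u v → u ⊕ (⊖ v)) (antiderivative≗ b (suc m) j) (antiderivative≗ a (suc m) j))
          (series≗ t (suc m) j))

      exp-estimate : exp b - exp a - exp t * (b - a) ≲ λ j → ℕ→ℚ (1 ℕ.* 4 ℕ.^ (1 ℕ.* R)) ℚ.* d ℚ.* norm (b - a) j
      exp-estimate = ⟶-≲ {approximant} {exp b - exp a - exp t * (b - a)} approximant⟶ λ m →
        ≗-≲ {remainder (suc m)} {approximant m} (remainder≗ m)
          (seriesRemainder-≲ one 1 one≤ R a b t a≤R b≤R t≤R a-t≤d b-t≤d m)

  exp-differentiable : Differentiable R exp exp
  exp-differentiable =
    ℕ→ℚ (4 ℕ.^ R ℕ.+ 1) , ℕ→ℚ (1 ℕ.* 4 ℕ.^ (1 ℕ.* R))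
    , 0≤nat (4 ℕ.^ R ℕ.+ 1) , 0≤nat (1 ℕ.* 4 ℕ.^ (1 ℕ.* R))
    , (λ z → bounded-exp z R) , (λ z → bounded-exp z R)
    , exp-estimate

-- The derivative of M - E.

shiftedTerm : (ℕ → ℂ) → ℂ → ℕ → ℂ
shiftedTerm c y k = c k * y ^ suc k /! suc k

-- The sums are compared with `expSum (suc m)` at G R, whose initial term 1 has no counterpart here
-- and covers the index shift. The final 1 is the loss in `bounded-limit`.
shifted-bounded : ∀ c G R y → (∀ k → Bounded (c k) (ℕ→ℚ (G ℕ.^ suc k))) → Bounded y (ℕ→ℚ R) →
  ∀ l → (λ m → ∑ m (shiftedTerm c y)) ⟶ l → Bounded l (ℕ→ℚ (4 ℕ.^ (G ℕ.* R) ℕ.+ 1))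
shifted-bounded c G R y c≤ y≤R l ⟶l = bounded-weaken l (ℚₚ.≤-reflexive (sym (nat-+ (4 ℕ.^ (G ℕ.* R)) 1)))
  (bounded-limit (λ m → ∑ m (shiftedTerm c y)) l ⟶l
    (λ m → bounded-weaken (∑ m (shiftedTerm c y)) (e-nat (suc m) (G ℕ.* R)) (partial m)))
  where
  γρ : ℚ
  γρ = ℕ→ℚ (G ℕ.* R)

  coefficient : ∀ k → ℕ→ℚ (G ℕ.^ suc k) ℚ.* ℕ→ℚ (R ℕ.^ suc k) ≡ qpow γρ (suc k)
  coefficient k = trans (sym (nat-* (G ℕ.^ suc k) (R ℕ.^ suc k)))
    (trans (cong ℕ→ℚ (sym (^-distrib-* G R (suc k)))) (nat-^ (G ℕ.* R) (suc k)))

  partial : ∀ m → Bounded (∑ m (shiftedTerm c y)) (expSum (suc m) γρ)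
  partial zero = bounded-weaken (ℚ→ℂ 0ℚ) (0≤e (suc zero) (0≤nat (G ℕ.* R))) (bounded-ℚ {0ℚ} ℚₚ.≤-refl)
  partial (suc m) = bounded-+ (∑ m (shiftedTerm c y)) (shiftedTerm c y m) (partial m)
    (bounded-weaken (shiftedTerm c y m) (ℚₚ.≤-reflexive (cong (ℚ._* 1/! (suc m)) (coefficient m)))
      (bounded-/! (c m * y ^ suc m) (suc m)
        (bounded-* (c m) (y ^ suc m) {ℕ→ℚ (G ℕ.^ suc m)} {ℕ→ℚ (R ℕ.^ suc m)} (c≤ m) (bounded-^ y R (suc m) y≤R))))

-- With s_n = 1ᵖ + ⋯ + nᵖ, the sum of (s_n − nᵖ) xⁿ/n! over n ≥ 1 is that of s_n xⁿ⁺¹/(n+1)! over n ≥ 0,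
-- whose termwise derivative is the sum of s_n xⁿ/n!.
module _ (c : ℕ → ℂ) (G : ℕ) (c≤ : ∀ k → Bounded (c k) (ℕ→ℚ (G ℕ.^ suc k))) (e m : ℂ → ℂ)
  (e-limit : ∀ y → (λ n → ∑ n (shiftedTerm c y)) ⟶ e y)
  (m-limit : ∀ y → (λ n → ∑ n (shiftedTerm (λ k → ∑ (suc k) c) y)) ⟶ m y) (R : ℕ) where

  private
    partialSum : ℕ → ℂ
    partialSum k = ∑ k c

    partialSum≤ : ∀ k → Bounded (partialSum k) (ℕ→ℚ ((G ℕ.+ 1) ℕ.^ k))
    partialSum≤ = bounded-power-sum c G c≤

    eTerm mTerm : ℂ → ℕ → ℂ
    eTerm = shiftedTerm c
    mTerm = shiftedTerm (λ k → ∑ (suc k) c)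

    sTerm : ℂ → ℕ → ℂ
    sTerm y k = partialSum k * y ^ k /! k

    sTerm-zero : ∀ y → sTerm y zero ≗ ℚ→ℂ 0ℚ
    sTerm-zero y j = solve𝔾 1 (λ f → con𝔾 (0ℚ , 0ℚ) :⊗ con𝔾 (1ℚ , 0ℚ) :⊗ f :≡ con𝔾 (0ℚ , 0ℚ)) refl (at (ℚ→ℂ (1/! zero)) j)

    series≗ : ∀ y n → series partialSum y (suc n) ≗ ∑ n (mTerm y)
    series≗ y n j = trans (∑-suc (sTerm y) n j)
      (trans (cong₂ _⊕_ (sTerm-zero y j) (∑-cong (λ k → sTerm y (suc k)) (mTerm y) (λ _ _ → refl) n j))
        (solve𝔾 1 (λ s → con𝔾 (0ℚ , 0ℚ) :⊕ s :≡ s) refl (at (∑ n (mTerm y)) j)))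

    antiderivative≗ : ∀ y n → antiderivative partialSum y n ≗ ∑ n (mTerm y) - ∑ n (eTerm y)
    antiderivative≗ y n j = trans
      (∑-cong (λ k → partialSum k * y ^ suc k /! suc k) (λ k → mTerm y k - eTerm y k)
        (λ k j → solve𝔾 4 (λ S c y f → S :⊗ y :⊗ f :≡ (S :⊕ c) :⊗ y :⊗ f :⊝ c :⊗ y :⊗ f) refl
          (at (partialSum k) j) (at (c k) j) (at (y ^ suc k) j) (at (ℚ→ℂ (1/! (suc k))) j)) n j)
      (sym (∑-- (mTerm y) (eTerm y) n j))

    module _ {d : ℚ} (a b t : ℂ) (a≤R : Bounded a (ℕ→ℚ R)) (b≤R : Bounded b (ℕ→ℚ R)) (t≤R : Bounded t (ℕ→ℚ R))
      (a-t≤d : Bounded (a - t) d) (b-t≤d : Bounded (b - t) d) where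

      difference : ℂ → ℕ → ℂ
      difference y n = ∑ (suc n) (mTerm y) - ∑ (suc n) (eTerm y)

      difference⟶ : ∀ y → difference y ⟶ m y - e y
      difference⟶ y = ⟶-suc (λ n → ∑ n (mTerm y) - ∑ n (eTerm y)) (m y - e y)
        (⟶-- (λ n → ∑ n (mTerm y)) (λ n → ∑ n (eTerm y)) (m y) (e y) (m-limit y) (e-limit y))

      approximant : ℕ → ℂ
      -- `difference` takes `suc n` terms but the series at t only `n`: the empty power sum makes
      -- the term of index 0 in `series partialSum` vanish.
      approximant n = difference b n - difference a n - ∑ n (mTerm t) * (b - a)

      approximant⟶ : approximant ⟶ (m b - e b) - (m a - e a) - m t * (b - a)
      approximant⟶ = ⟶-- (λ n → difference b n - difference a n) (λ n → ∑ n (mTerm t) * (b - a))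
        ((m b - e b) - (m a - e a)) (m t * (b - a))
        (⟶-- (difference b) (difference a) (m b - e b) (m a - e a) (difference⟶ b) (difference⟶ a))
        (⟶-*ʳ (λ n → ∑ n (mTerm t)) (m t) (b - a) (m-limit t))

      remainder : ℕ → ℂ
      remainder = seriesRemainder partialSum (G ℕ.+ 1) partialSum≤ R a b t a≤R b≤R t≤R a-t≤d b-t≤d

      remainder≗ : ∀ n → remainder (suc n) ≗ approximant n
      remainder≗ n j = cong₂ (λ u v → u ⊕ (⊖ (v ⊗ at (b - a) j)))
        (cong₂ (λ u v → u ⊕ (⊖ v)) (antiderivative≗ b (suc n) j) (antiderivative≗ a (suc n) j))
        (series≗ t n j)

      difference-estimate : (m b - e b) - (m a - e a) - m t * (b - a)
        ≲ λ j → ℕ→ℚ ((G ℕ.+ 1) ℕ.* 4 ℕ.^ ((G ℕ.+ 1) ℕ.* R)) ℚ.* d ℚ.* norm (b - a) j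
      difference-estimate = ⟶-≲ {approximant} {(m b - e b) - (m a - e a) - m t * (b - a)} approximant⟶ λ n →
        ≗-≲ {remainder (suc n)} {approximant n} (remainder≗ n)
          (seriesRemainder-≲ partialSum (G ℕ.+ 1) partialSum≤ R a b t a≤R b≤R t≤R a-t≤d b-t≤d n)

    Bₘ Bₑ : ℕ
    Bₘ = 4 ℕ.^ ((G ℕ.+ 1) ℕ.* R) ℕ.+ 1
    Bₑ = 4 ℕ.^ (G ℕ.* R) ℕ.+ 1

    m≤ : ∀ y → Bounded y (ℕ→ℚ R) → Bounded (m y) (ℕ→ℚ Bₘ)
    m≤ y y≤R = shifted-bounded (λ k → ∑ (suc k) c) (G ℕ.+ 1) R y (λ k → partialSum≤ (suc k)) y≤R (m y) (m-limit y)

    e≤ : ∀ y → Bounded y (ℕ→ℚ R) → Bounded (e y) (ℕ→ℚ Bₑ)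
    e≤ y y≤R = shifted-bounded c G R y c≤ y≤R (e y) (e-limit y)

  difference-differentiable : Differentiable R (λ y → m y - e y) m
  difference-differentiable =
    ℕ→ℚ Bₘ ℚ.+ ℕ→ℚ Bₑ , ℕ→ℚ ((G ℕ.+ 1) ℕ.* 4 ℕ.^ ((G ℕ.+ 1) ℕ.* R))
    , 0≤+ {ℕ→ℚ Bₘ} {ℕ→ℚ Bₑ} (0≤nat Bₘ) (0≤nat Bₑ) , 0≤nat ((G ℕ.+ 1) ℕ.* 4 ℕ.^ ((G ℕ.+ 1) ℕ.* R))
    , (λ y y≤R → bounded-- (m y) (e y) {ℕ→ℚ Bₘ} {ℕ→ℚ Bₑ} (m≤ y y≤R) (e≤ y y≤R))
    , (λ y y≤R → bounded-weaken (m y) (≤-+ʳ (ℕ→ℚ Bₘ) (0≤nat Bₑ)) (m≤ y y≤R))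
    , difference-estimate

-- Values at 0, the reciprocal of exp, and the identity for M.

-- Formulated for any `z` with zero approximations so as to cover `- ℚ→ℂ 0ℚ` too. Every nonempty
-- partial sum is then exactly 1.
exp-zero : ∀ z → z ≗ ℚ→ℂ 0ℚ → exp z - ℚ→ℂ 1ℚ ≲ λ _ → 0ℚ
exp-zero z z≗0 = ⟶-≲ {λ m → ∑ (suc m) (expTerm z) - ℚ→ℂ 1ℚ} {exp z - ℚ→ℂ 1ℚ}
  (⟶-- (λ m → ∑ (suc m) (expTerm z)) (λ _ → ℚ→ℂ 1ℚ) (exp z) (ℚ→ℂ 1ℚ)
    (⟶-suc (λ m → ∑ m (expTerm z)) (exp z) (exp-limit z)) (⟶-const (ℚ→ℂ 1ℚ)))
  (λ m → ≗0⇒≲ (∑ (suc m) (expTerm z) - ℚ→ℂ 1ℚ) λ j → cong (_⊕ (⊖ (1ℚ , 0ℚ)))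
    (trans (∑-suc (expTerm z) m j) (cong (at (expTerm z zero) j ⊕_) (∑-zero (λ k → expTerm z (suc k)) positive m j))))
  where
  positive : ∀ k → expTerm z (suc k) ≗ ℚ→ℂ 0ℚ
  positive k j = trans (cong (λ w → at (z ^ k) j ⊗ w ⊗ at (ℚ→ℂ (1/! (suc k))) j) (z≗0 j))
    (solve𝔾 2 (λ y f → y :⊗ con𝔾 (0ℚ , 0ℚ) :⊗ f :≡ con𝔾 (0ℚ , 0ℚ)) refl (at (z ^ k) j) (at (ℚ→ℂ (1/! (suc k))) j))

shifted-zero : ∀ c l → (λ m → ∑ m (shiftedTerm c (ℚ→ℂ 0ℚ))) ⟶ l → l ≲ λ _ → 0ℚ
shifted-zero c l ⟶l = ⟶-≲ {λ m → ∑ m (shiftedTerm c (ℚ→ℂ 0ℚ))} {l} ⟶l λ m →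
  ≗0⇒≲ (∑ m (shiftedTerm c (ℚ→ℂ 0ℚ))) (∑-zero (shiftedTerm c (ℚ→ℂ 0ℚ))
    (λ k j → solve𝔾 3 (λ c y f → c :⊗ (y :⊗ con𝔾 (0ℚ , 0ℚ)) :⊗ f :≡ con𝔾 (0ℚ , 0ℚ)) refl
      (at (c k) j) (at (ℚ→ℂ 0ℚ ^ k) j) (at (ℚ→ℂ (1/! (suc k))) j)) m)

reciprocal-differentiable : ∀ (R : ℕ) (f g : ℂ → ℂ) → Differentiable R f f → Differentiable R g (λ z → - g z) →
  Differentiable R (λ z → f z * g z) (λ _ → ℚ→ℂ 0ℚ)
reciprocal-differentiable R f g Df Dg = differentiable-cong R (λ z → f z * g z)
  (λ z → f z * g z + f z * (- g z)) (λ _ → ℚ→ℂ 0ℚ)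
  (λ z j → solve𝔾 2 (λ u v → u :⊗ v :⊕ u :⊗ (:⊖ v) :≡ con𝔾 (0ℚ , 0ℚ)) refl (at (f z) j) (at (g z) j))
  (differentiable-* R f f g (λ z → - g z) Df Dg)

damped-differentiable : ∀ (R : ℕ) (g e m : ℂ → ℂ) → Differentiable R g (λ z → - g z) → Differentiable R (λ y → m y - e y) m →
  Differentiable R (λ z → g z * (m z - e z)) (λ z → g z * e z)
damped-differentiable R g e m Dg D = differentiable-cong R (λ z → g z * (m z - e z))
  (λ z → (- g z) * (m z - e z) + g z * m z) (λ z → g z * e z)
  (λ z j → solve𝔾 3 (λ v m e → (:⊖ v) :⊗ (m :⊝ e) :⊕ v :⊗ m :≡ v :⊗ e) refl (at (g z) j) (at (m z) j) (at (e z) j))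
  (differentiable-* R g (λ z → - g z) (λ y → m y - e y) m Dg D)

exp-neg-differentiable : ∀ R → Differentiable R (λ z → exp (- z)) (λ z → - exp (- z))
exp-neg-differentiable R = differentiable-neg R exp exp (exp-differentiable R)

-- To be used with c = exp 0 and d = exp(-0), which are 1 only up to a null difference; cd - 1 is
-- split as (c - 1)d + (d - 1).
product-one : ∀ a b c d → a * b - c * d ≲ (λ _ → 0ℚ) → c - ℚ→ℂ 1ℚ ≲ (λ _ → 0ℚ) → d - ℚ→ℂ 1ℚ ≲ (λ _ → 0ℚ) →
  a * b - ℚ→ℂ 1ℚ ≲ λ _ → 0ℚ
product-one a b c d p q r = ≗-≲ {u + (v + w)} {a * b - ℚ→ℂ 1ℚ}
  (λ j → solve𝔾 4 (λ a b c d → let 1′ = con𝔾 (1ℚ , 0ℚ) in (a :⊗ b :⊝ c :⊗ d) :⊕ ((c :⊝ 1′) :⊗ d :⊕ (d :⊝ 1′)) :≡ a :⊗ b :⊝ 1′) refl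
    (at a j) (at b j) (at c j) (at d j))
  (≲0-+ u (v + w) p (≲0-+ v w (≲0-* (c - ℚ→ℂ 1ℚ) d q) r))
  where
  u v w : ℂ
  u = a * b - c * d
  v = (c - ℚ→ℂ 1ℚ) * d
  w = d - ℚ→ℂ 1ℚ

exp-reciprocal : ∀ x → exp x * exp (- x) - exp (ℚ→ℂ 0ℚ) * exp (- ℚ→ℂ 0ℚ) ≲ λ _ → 0ℚ
exp-reciprocal x = constant (λ z → exp z * exp (- z)) x (proj₁ (bounded x)) (proj₂ (bounded x))
  (reciprocal-differentiable (2 ℕ.* proj₁ (bounded x)) exp (λ z → exp (- z))
    (exp-differentiable (2 ℕ.* proj₁ (bounded x))) (exp-neg-differentiable (2 ℕ.* proj₁ (bounded x))))

exp*exp-neg : ∀ x → exp x * exp (- x) - ℚ→ℂ 1ℚ ≲ λ _ → 0ℚ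
exp*exp-neg x = product-one (exp x) (exp (- x)) (exp (ℚ→ℂ 0ℚ)) (exp (- ℚ→ℂ 0ℚ)) (exp-reciprocal x)
  (exp-zero (ℚ→ℂ 0ℚ) (λ _ → refl)) (exp-zero (- ℚ→ℂ 0ℚ) (λ _ → refl))

damped-integral : ∀ (e m : ℂ → ℂ) → (∀ R → Differentiable R (λ y → m y - e y) m) → ∀ x →
  IsIntegral (λ t → exp (- t) * e t) x (exp (- x) * (m x - e x) - exp (- ℚ→ℂ 0ℚ) * (m (ℚ→ℂ 0ℚ) - e (ℚ→ℂ 0ℚ)))
damped-integral e m D x = integral (λ y → exp (- y) * (m y - e y)) (λ t → exp (- t) * e t) x (proj₁ (bounded x)) (proj₂ (bounded x))
  (damped-differentiable (2 ℕ.* proj₁ (bounded x)) (λ z → exp (- z)) e m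
    (exp-neg-differentiable (2 ℕ.* proj₁ (bounded x))) (D (2 ℕ.* proj₁ (bounded x))))

-- With a = eˣ, b = e⁻ˣ and d = e⁻⁰, the inner bracket is F(x) - F(0) as the fundamental theorem
-- delivers it. F(0) is not removed beforehand: k and l stand for M(0) and E(0), so the term d(k -
-- l) is null whatever d is.
solve-damped : ∀ a b d m e k l → a * b - ℚ→ℂ 1ℚ ≲ (λ _ → 0ℚ) → k ≲ (λ _ → 0ℚ) → l ≲ (λ _ → 0ℚ) →
  m ≈ e + a * (b * (m - e) - d * (k - l))
solve-damped a b d m e k l p q r = ≲0⇒≈ m w (≗-≲ { - u + v} {m - w}
  (λ j → solve𝔾 7 (λ a b d m e k l → let 1′ = con𝔾 (1ℚ , 0ℚ) in
      :⊖ ((a :⊗ b :⊝ 1′) :⊗ (m :⊝ e)) :⊕ (k :⊝ l) :⊗ (a :⊗ d) :≡ m :⊝ (e :⊕ a :⊗ (b :⊗ (m :⊝ e) :⊝ d :⊗ (k :⊝ l)))) refl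
    (at a j) (at b j) (at d j) (at m j) (at e j) (at k j) (at l j))
  (≲0-+ (- u) v
    (≲-neg {u} (≲0-* (a * b - ℚ→ℂ 1ℚ) (m - e) p))
    (≲0-* (k - l) (a * d) (≲0-+ k (- l) q (≲-neg {l} r)))))
  where
  u v w : ℂ
  u = (a * b - ℚ→ℂ 1ℚ) * (m - e)
  v = (k - l) * (a * d)
  w = e + a * (b * (m - e) - d * (k - l))

E-limit : ∀ p y → (λ n → ∑ n (shiftedTerm (λ k → suc k ^ᶜ p) y)) ⟶ E y p
E-limit p y = ∑∞-limit (shiftedTerm (λ k → suc k ^ᶜ p) y) (E-summable y p)

M-limit : ∀ p y → (λ n → ∑ n (shiftedTerm (λ k → ∑ (suc k) (λ j → suc j ^ᶜ p)) y)) ⟶ M y p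
M-limit p y = ∑∞-limit (shiftedTerm (λ k → ∑ (suc k) (λ j → suc j ^ᶜ p)) y) (M-summable y p)

E-zero : ∀ p → E (ℚ→ℂ 0ℚ) p ≲ λ _ → 0ℚ
E-zero p = shifted-zero (λ k → suc k ^ᶜ p) (E (ℚ→ℂ 0ℚ) p) (E-limit p (ℚ→ℂ 0ℚ))

M-zero : ∀ p → M (ℚ→ℂ 0ℚ) p ≲ λ _ → 0ℚ
M-zero p = shifted-zero (λ k → ∑ (suc k) (λ j → suc j ^ᶜ p)) (M (ℚ→ℂ 0ℚ) p) (M-limit p (ℚ→ℂ 0ℚ))

M-E-differentiable : ∀ (p : ℂ) (R : ℕ) → Differentiable R (λ y → M y p - E y p) (λ y → M y p)
M-E-differentiable p = difference-differentiable (λ k → suc k ^ᶜ p) (pow-base p) (bounded-^ᶜ p)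
  (λ y → E y p) (λ y → M y p) (E-limit p) (M-limit p)

M-E-integral : ∀ (p x : ℂ) → IsIntegral (λ t → exp (- t) * E t p) x
  (exp (- x) * (M x p - E x p) - exp (- ℚ→ℂ 0ℚ) * (M (ℚ→ℂ 0ℚ) p - E (ℚ→ℂ 0ℚ) p))
M-E-integral p x = damped-integral (λ y → E y p) (λ y → M y p) (M-E-differentiable p) x

proposition1 : ∀ (p x : ℂ) → ∃[ I ] (IsIntegral (λ t → exp (- t) * E t p) x I × M x p ≈ E x p + exp x * I)
proposition1 p x = exp (- x) * (M x p - E x p) - exp (- ℚ→ℂ 0ℚ) * (M (ℚ→ℂ 0ℚ) p - E (ℚ→ℂ 0ℚ) p)
  , M-E-integral p x
  , solve-damped (exp x) (exp (- x)) (exp (- ℚ→ℂ 0ℚ)) (M x p) (E x p) (M (ℚ→ℂ 0ℚ) p) (E (ℚ→ℂ 0ℚ) p)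
      (exp*exp-neg x) (M-zero p) (E-zero p)
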